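{- Let $A$ be a fixed $s \times t$ binary matrix. There exists a polynomial $p$ (depending only on $A$) such that for every $\epsilon > 0$ the following holds with $\delta = 1/p(\epsilon^{ -1})$: if an $n \times n$ binary matrix $M$ contains $\epsilon n^2$ pairwise-disjoint copies of $A$, then the total number of copies of $A$ in $M$ is at least $\delta n^{s+t}$.
   Context: An $m\times n$ matrix over an alphabet $\Gamma$ is a function $M:[m]\times[n]\to\Gamma$; binary means $\Gamma=\{0,1\}$. A submatrix of $M$ is obtained by deleting some rows and columns while preserving the row and column order: for row indices $r_1<\dots<r_s$ and column indices $c_1<\dots<c_t$, the submatrix on $\{r_1,\dots,r_s\}\times\{c_1,\dots,c_t\}$ has $(i,j)$ entry $M(r_i,c_j)$. A copy of $A$ in $M$ is an $s\times t$ submatrix of $M$ equal to $A$. A set of copies is pairwise disjoint if every entry (position) of $M$ is contained in at most one of the copies. -}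

module Defs where

open import Data.Fin using (Fin; _<_)
open import Data.Fin.Properties using (_≟_; _<?_; all?)
open import Data.Integer using (+_)
open import Data.List using (List; []; _∷_; allFin; cartesianProduct; cartesianProductWith; filter; length)
import Data.List.Membership.Propositional as List
open import Data.List.Relation.Unary.All using (All)
open import Data.List.Relation.Unary.Unique.Propositional using (Unique)
open import Data.Nat using (ℕ; zero; suc)
open import Data.Product using (_×_; _,_; ∃-syntax)
open import Data.Rational using (ℚ; 0ℚ; 1/_; _+_; _*_; _≤_; _/_; >-nonZero)
import Data.Rational as ℚ
open import Data.Vec using (Vec; []; _∷_; lookup)
open import Data.Vec.Membership.Propositional using (_∈_)
open import Relation.Binary.PropositionalEquality using (_≡_)
open import Relation.Nullary using (Dec; _×-dec_; _→-dec_)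

fromℕ : ℕ → ℚ
fromℕ k = + k / 1

inv : (q : ℚ) → 0ℚ ℚ.< q → ℚ
inv q 0<q = (1/ q) {{>-nonZero 0<q}}

-- Coefficients in increasing degree: a₀ ∷ a₁ ∷ … stands for a₀ + a₁x + ….
Polynomial : Set
Polynomial = List ℚ

eval : Polynomial → ℚ → ℚ
eval []      x = 0ℚ
eval (a ∷ p) x = a + x * eval p x

Matrix : Set → ℕ → ℕ → Set
Matrix Γ m n = Fin m → Fin n → Γ

BinaryMatrix : ℕ → ℕ → Set
BinaryMatrix = Matrix (Fin 2)

Increasing : ∀ {m s} → Vec (Fin m) s → Set
Increasing r = ∀ i j → i < j → lookup r i < lookup r j

increasing? : ∀ {m s} (r : Vec (Fin m) s) → Dec (Increasing r)
increasing? r = all? λ i → all? λ j → (i <? j) →-dec (lookup r i <? lookup r j)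

-- Row indices r₁, …, r_s and column indices c₁, …, c_t. A copy is identified
-- with its location (r , c), so equal submatrices at different locations are
-- different copies.
Location : (s t m n : ℕ) → Set
Location s t m n = Vec (Fin m) s × Vec (Fin n) t

submatrix : ∀ {Γ s t m n} → Matrix Γ m n → Location s t m n → Matrix Γ s t
submatrix M (r , c) i j = M (lookup r i) (lookup c j)

IsCopy : ∀ {s t m n} → BinaryMatrix s t → BinaryMatrix m n → Location s t m n → Set
IsCopy A M P@(r , c) =
  Increasing r × Increasing c × (∀ i j → submatrix M P i j ≡ A i j)

isCopy? : ∀ {s t m n} (A : BinaryMatrix s t) (M : BinaryMatrix m n)
          (P : Location s t m n) → Dec (IsCopy A M P)
isCopy? A M P@(r , c) =
  increasing? r ×-dec increasing? c ×-dec
  all? λ i → all? λ j → submatrix M P i j ≟ A i j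

allVecs : ∀ m s → List (Vec (Fin m) s)
allVecs m zero    = [] ∷ []
allVecs m (suc s) = cartesianProductWith _∷_ (allFin m) (allVecs m s)

-- allVecs lists every vector exactly once, so every copy occurs exactly once.
copies : ∀ {s t m n} → BinaryMatrix s t → BinaryMatrix m n → List (Location s t m n)
copies {s} {t} {m} {n} A M =
  filter (isCopy? A M) (cartesianProduct (allVecs m s) (allVecs n t))

numberOfCopies : ∀ {s t m n} → BinaryMatrix s t → BinaryMatrix m n → ℕ
numberOfCopies A M = length (copies A M)

Covers : ∀ {s t m n} → Location s t m n → Fin m → Fin n → Set
Covers (r , c) x y = x ∈ r × y ∈ c

PairwiseDisjoint : ∀ {s t m n} → List (Location s t m n) → Set
PairwiseDisjoint L = ∀ x y {P Q} → P List.∈ L → Q List.∈ L →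
                     Covers P x y → Covers Q x y → P ≡ Q

-- A finite set of copies is given as a duplicate-free list; its size is at
-- least q, which need not be an integer.
ContainsDisjointCopies : ∀ {s t m n} → BinaryMatrix s t → BinaryMatrix m n → ℚ → Set
ContainsDisjointCopies {s} {t} {m} {n} A M q =
  ∃[ L ] Unique {A = Location s t m n} L × All (IsCopy A M) L ×
         PairwiseDisjoint L × q ≤ fromℕ (length L)

{-# OPTIONS --safe #-}

-- Columns are picked one at a time so that each puts many rows into the
-- minority of their class, rows being equivalent when they agree on all columns
-- picked so far. A row in a large class loses at most logarithmically often, so
-- this soon stops, and then M is nearly constant on classes. If there were more
-- than polynomially many large classes, then by Sauer–Shelah they would shatter
-- s^s · t picked columns, where A occurs many times: split the columns into s^s
-- blocks, one for each map k : [s] → [s], and let the i-th of s words show row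
-- k i of A on block k. Whatever order the classes of these words can be
-- separated in, some block shows the rows of A in that order. So, unless A has
-- many copies, few columns are unsuitable and picking can be greedy.
--
-- Doing this for rows and for columns gives polynomially many row and column
-- types such that, off a sparse set of errors, M depends only on the types.
-- Divide the rows into a tree of intervals with s + t children per node. A type
-- present at a node but nearly absent from a child loses a constant factor of
-- its possible rows there, so after logarithmically many levels almost every row
-- has met few such nodes. A copy none of whose entries is exceptional survives
-- (copies are disjoint, so few are lost); at a common good level its i-th row
-- may be replaced by any row of the same type in the i-th child, likewise for
-- columns, and most of these choices avoid the errors.

module Submission where

-- The inverse of ε is replaced by a power `2 ^ g`, and a quantity is polynomial in it when it is at
-- most `2 ^ (C * g)`. Two demands threaten this. The number `K = 2 ^ Λ` of types must exceed a
-- fixed power of `Γ * Λ`, since about `Γ * Λ` columns are picked when errors of density of order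
-- `1 / Γ` are allowed. And `Γ` must exceed a fixed power of the depth of the tree, which in turn is
-- linear in `Λ`. Both can be met because `Λ` and the depth are logarithms of what they control:
-- each enters the other demand only polynomially, against an exponential.
--
-- The obstacle throughout is order. Large classes of rows may lie in any order, so shattered
-- columns give the rows of A only up to a permutation that is unknown when the words are chosen.
-- Likewise a surviving copy cannot be moved to arbitrary rows of the same types; each of its rows
-- moves only within an interval around it, and the numbering of the children keeps the order.
--
-- Disjointness enters once: a deleted entry destroys at most one of the given copies, so fewer
-- deletions than copies leave one intact.

module Counting where

  import Algebra.Properties.Semiring.Sum as SemiringSum
  open import Data.Bool.Base using (Bool; true; false)
  import Data.Bool.Properties as Bool
  open import Data.Empty using (⊥)
  open import Data.Fin.Base as Fin using (Fin; zero; suc; toℕ; fromℕ<; combine)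
  import Data.Fin.Properties as Fin
  open import Data.List.Base as List using (List; []; _∷_; length; map; _++_; filter; cartesianProduct; cartesianProductWith; allFin)
  open import Data.List.Membership.Propositional using (_∈_; find)
  open import Data.List.Membership.Propositional.Properties using (∈-allFin; ∈-cartesianProductWith⁺; ∈-cartesianProduct⁺; ∈-filter⁺; ∈-length)
  import Data.List.Properties as List
  open import Data.List.Relation.Binary.Sublist.Propositional as Sublist using (_⊆_; []; _∷_; _∷ʳ_)
  open import Data.List.Relation.Binary.Sublist.Propositional.Properties using (All-resp-⊆)
  open import Data.List.Relation.Unary.All as All using (All; []; _∷_)
  open import Data.List.Relation.Unary.AllPairs using (AllPairs; []; _∷_; allPairs?)
  open import Data.List.Relation.Unary.Any as Any using (here; there)
  open import Data.List.Relation.Unary.Unique.Propositional using (Unique)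
  open import Data.List.Sort.InsertionSort.Base using (insert; sort)
  open import Data.Nat.Base
  open import Data.Nat.Divisibility using (divides)
  open import Data.Nat.DivMod
  open import Data.Nat.Properties hiding (_≟_)
  import Data.Nat.Properties as ℕ
  open import Data.Nat.Tactic.RingSolver using (solve-∀)
  open import Data.Product.Base using (∃; ∃-syntax; _×_; _,_; proj₁; proj₂)
  open import Data.Sum.Base using (_⊎_; inj₁; inj₂; [_,_]′)
  open import Data.Unit.Base using (⊤; tt)
  open import Data.Vec.Base using (Vec; []; _∷_; lookup; toList)
  import Data.Vec.Membership.Propositional.Properties as Vec
  import Data.Vec.Relation.Unary.Any as Vec
  open import Defs
  open import Function.Base using (_∘_; _$_; id; case_of_)
  open import Relation.Binary.PropositionalEquality
  open import Relation.Nullary using (Dec; yes; no; ¬_; contradiction; _×-dec_; _⊎-dec_; ¬?; decidable-stable; does; proof; ofʸ; ofⁿ)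
  open import Relation.Unary using (Decidable)
  open import Algebra.Properties.CommutativeSemigroup *-commutativeSemigroup using () renaming
    ( x∙yz≈y∙xz to *-x∙yz≈y∙xz; x∙yz≈yx∙z to *-x∙yz≈yx∙z; x∙yz≈xz∙y to *-x∙yz≈xz∙y
    ; xy∙z≈xz∙y to *-xy∙z≈xz∙y; xy∙z≈y∙xz to *-xy∙z≈y∙xz
    ; interchange to *-interchange )
  private module Sum = SemiringSum +-*-semiring
  open ≤-Reasoning

  -- Indicators and finite sums.

  𝟙 : {P : Set} → Dec P → ℕ
  𝟙 (yes _) = 1
  𝟙 (no _) = 0

  𝟙-yes : {P : Set} (p : Dec P) → P → 𝟙 p ≡ 1
  𝟙-yes (yes _) _ = refl
  𝟙-yes (no ¬p) p = contradiction p ¬p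

  𝟙-no : {P : Set} (p : Dec P) → ¬ P → 𝟙 p ≡ 0
  𝟙-no (yes p) ¬p = contradiction p ¬p
  𝟙-no (no _) _ = refl

  𝟙≤1 : {P : Set} (p : Dec P) → 𝟙 p ≤ 1
  𝟙≤1 (yes _) = ≤-refl
  𝟙≤1 (no _) = z≤n

  𝟙-pos : {P : Set} (p : Dec P) → 0 < 𝟙 p → P
  𝟙-pos (yes p) _ = p

  𝟙-mono : {P Q : Set} (p : Dec P) (q : Dec Q) → (P → Q) → 𝟙 p ≤ 𝟙 q
  𝟙-mono (yes p) q f = ≤-reflexive (sym (𝟙-yes q (f p)))
  𝟙-mono (no _) _ _ = z≤n

  𝟙-cong : {P Q : Set} (p : Dec P) (q : Dec Q) → (P → Q) → (Q → P) → 𝟙 p ≡ 𝟙 q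
  𝟙-cong p q f g = ≤-antisym (𝟙-mono p q f) (𝟙-mono q p g)

  𝟙-∪ : {P Q R : Set} (p : Dec P) (q : Dec Q) (r : Dec R) → (P → Q ⊎ R) → 𝟙 p ≤ 𝟙 q + 𝟙 r
  𝟙-∪ (no _) _ _ _ = z≤n
  𝟙-∪ (yes p) q r f with f p
  ... | inj₁ x = ≤-trans (≤-reflexive (sym (𝟙-yes q x))) (m≤m+n _ _)
  ... | inj₂ y = ≤-trans (≤-reflexive (sym (𝟙-yes r y))) (m≤n+m _ _)

  𝟙-× : {P Q : Set} (p : Dec P) (q : Dec Q) → 𝟙 (p ×-dec q) ≡ 𝟙 p * 𝟙 q
  𝟙-× (yes _) (yes _) = refl
  𝟙-× (yes _) (no _) = refl
  𝟙-× (no _) (yes _) = refl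
  𝟙-× (no _) (no _) = refl

  𝟙-*-mono : {P : Set} (p : Dec P) {x y : ℕ} → (P → x ≤ y) → 𝟙 p * x ≤ 𝟙 p * y
  𝟙-*-mono (yes p) f = +-monoˡ-≤ 0 (f p)
  𝟙-*-mono (no _) _ = z≤n

  -- Opaque, so that unification never unfolds a sum.
  opaque
    sum : ∀ {n} → (Fin n → ℕ) → ℕ
    sum = Sum.sum

    sum-suc : ∀ {n} (f : Fin (suc n) → ℕ) → sum f ≡ f zero + sum (f ∘ suc)
    sum-suc f = refl

    sum-cong : ∀ {n} {f g : Fin n → ℕ} → (∀ i → f i ≡ g i) → sum f ≡ sum g
    sum-cong = Sum.sum-cong-≗

    sum-+ : ∀ {n} (f g : Fin n → ℕ) → sum (λ i → f i + g i) ≡ sum f + sum g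
    sum-+ = Sum.∑-distrib-+

    sum-comm : ∀ {m n} (f : Fin m → Fin n → ℕ) →
               sum (λ i → sum (λ j → f i j)) ≡ sum (λ j → sum (λ i → f i j))
    sum-comm = Sum.∑-comm

    *-sum : ∀ {n} k (f : Fin n → ℕ) → k * sum f ≡ sum (λ i → k * f i)
    *-sum = Sum.*-distribˡ-sum

    sum-* : ∀ {n} k (f : Fin n → ℕ) → sum f * k ≡ sum (λ i → f i * k)
    sum-* = Sum.*-distribʳ-sum

    sum-mono : ∀ {n} {f g : Fin n → ℕ} → (∀ i → f i ≤ g i) → sum f ≤ sum g
    sum-mono {zero} _ = z≤n
    sum-mono {suc n} h = +-mono-≤ (h zero) (sum-mono (h ∘ suc))

    sum-const : ∀ n k → sum {n} (λ _ → k) ≡ n * k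
    sum-const zero k = refl
    sum-const (suc n) k = cong (k +_) (sum-const n k)

    sum-< : ∀ {n} (f g : Fin n → ℕ) → sum f < sum g → ∃[ i ] f i < g i
    sum-< {suc n} f g f<g with f zero ℕ.<? g zero
    ... | yes p = zero , p
    ... | no ¬p with sum-< (f ∘ suc) (g ∘ suc) (+-cancelˡ-< (g zero) _ _
                      (≤-<-trans (+-monoˡ-≤ _ (≮⇒≥ ¬p)) f<g))
    ... | i , q = suc i , q

    term≤sum : ∀ {n} (f : Fin n → ℕ) i → f i ≤ sum f
    term≤sum f zero = m≤m+n _ _
    term≤sum f (suc i) = ≤-trans (term≤sum (f ∘ suc) i) (m≤n+m _ _)

  sum-bound : ∀ {n} {f : Fin n → ℕ} {k} → (∀ i → f i ≤ k) → sum f ≤ n * k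
  sum-bound {n} {k = k} h = ≤-trans (sum-mono h) (≤-reflexive (sum-const n k))

  sum-δ : ∀ {k} (j : Fin k) (h : Fin k → ℕ) → sum (λ i → 𝟙 (j Fin.≟ i) * h i) ≡ h j
  sum-δ {suc k} zero h = begin-equality
    sum (λ i → 𝟙 (zero Fin.≟ i) * h i) ≡⟨ sum-suc _ ⟩
    1 * h zero + sum (λ i → 𝟙 (zero Fin.≟ suc i) * h (suc i)) ≡⟨ cong₂ _+_ (*-identityˡ _) (trans (sum-const k 0) (*-zeroʳ k)) ⟩
    h zero + 0 ≡⟨ +-identityʳ _ ⟩
    h zero ∎
  sum-δ {suc k} (suc j) h = trans (sum-suc _) $ trans
    (sum-cong (λ i → cong (_* h (suc i)) (𝟙-cong (suc j Fin.≟ suc i) (j Fin.≟ i) Fin.suc-injective (cong suc))))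
    (sum-δ j (h ∘ suc))

  sum-fibres : ∀ {n k} (α : Fin n → Fin k) (h : Fin n → ℕ) →
               sum h ≡ sum (λ P → sum (λ r → 𝟙 (α r Fin.≟ P) * h r))
  sum-fibres α h = trans (sum-cong (λ r → sym (sum-δ (α r) (λ _ → h r))))
                         (sum-comm (λ r P → 𝟙 (α r Fin.≟ P) * h r))

  opaque
    # : ∀ {n} {P : Fin n → Set} → Decidable P → ℕ
    # P? = sum (λ i → 𝟙 (P? i))

    #-def : ∀ {n} {P : Fin n → Set} (P? : Decidable P) → # P? ≡ sum (λ i → 𝟙 (P? i))
    #-def P? = refl

    #-mono : ∀ {n} {P Q : Fin n → Set} (P? : Decidable P) (Q? : Decidable Q) →
             (∀ i → P i → Q i) → # P? ≤ # Q?
    #-mono P? Q? f = sum-mono (λ i → 𝟙-mono (P? i) (Q? i) (f i))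

    #-cong : ∀ {n} {P Q : Fin n → Set} (P? : Decidable P) (Q? : Decidable Q) →
             (∀ i → P i → Q i) → (∀ i → Q i → P i) → # P? ≡ # Q?
    #-cong P? Q? f g = ≤-antisym (#-mono P? Q? f) (#-mono Q? P? g)

    #-∪ : ∀ {n} {P Q R : Fin n → Set} (P? : Decidable P) (Q? : Decidable Q) (R? : Decidable R) →
          (∀ i → P i → Q i ⊎ R i) → # P? ≤ # Q? + # R?
    #-∪ P? Q? R? f = ≤-trans (sum-mono (λ i → 𝟙-∪ (P? i) (Q? i) (R? i) (f i)))
                             (≤-reflexive (sum-+ (𝟙 ∘ Q?) (𝟙 ∘ R?)))

    #≤n : ∀ {n} {P : Fin n → Set} (P? : Decidable P) → # P? ≤ n
    #≤n {n} P? = ≤-trans (sum-bound (λ i → 𝟙≤1 (P? i))) (≤-reflexive (*-identityʳ n))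

    #-∃ : ∀ {n} {P : Fin n → Set} (P? : Decidable P) → 0 < # P? → ∃ P
    #-∃ {n} P? 0<# with sum-< (λ _ → 0) (𝟙 ∘ P?) (subst (λ z → z < # P?) (sym (trans (sum-const n 0) (*-zeroʳ n))) 0<#)
    ... | i , q = i , 𝟙-pos (P? i) q

    #-pos : ∀ {n} {P : Fin n → Set} (P? : Decidable P) {i} → P i → 0 < # P?
    #-pos P? {i} p = ≤-trans (≤-reflexive (sym (𝟙-yes (P? i) p))) (term≤sum (𝟙 ∘ P?) i)

  #-none : ∀ {n} {P : Fin n → Set} (P? : Decidable P) → (∀ i → ¬ P i) → # P? ≡ 0
  #-none P? h with # P? in eq
  ... | zero = refl
  ... | suc _ = let i , p = #-∃ P? (≤-trans (s≤s z≤n) (≤-reflexive (sym eq))) in contradiction p (h i)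

  #-all : ∀ {n} {P : Fin n → Set} (P? : Decidable P) → (∀ i → P i) → # P? ≡ n
  #-all {n} P? h = trans (#-def P?) (trans (sum-cong (λ i → 𝟙-yes (P? i) (h i))) (trans (sum-const n 1) (*-identityʳ n)))

  single : ∀ n y → # {n} (λ r → toℕ r ℕ.≟ y) ≤ 1
  single n y with y ℕ.<? n
  ... | yes y<n = ≤-reflexive (trans (#-def _) $ trans
    (sum-cong (λ r → trans (𝟙-cong (toℕ r ℕ.≟ y) (fromℕ< y<n Fin.≟ r)
        (λ e → Fin.toℕ-injective (trans (Fin.toℕ-fromℕ< y<n) (sym e)))
        (λ e → trans (cong toℕ (sym e)) (Fin.toℕ-fromℕ< y<n))) (sym (*-identityʳ _))))
    (sum-δ (fromℕ< y<n) (λ _ → 1)))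
  ... | no y≮n = ≤-trans (≤-reflexive (#-none (λ r → toℕ r ℕ.≟ y) (λ r e → y≮n (subst (_< n) e (Fin.toℕ<n r))))) z≤n

  -- Tuples, insertion sort and the Sauer–Shelah lemma

  -- Tuples are lists, so that they can be appended, sorted and cut into blocks; their length is
  -- fixed by the sum.
  ∑ℓ : ∀ {n} (k : ℕ) → (List (Fin n) → ℕ) → ℕ
  ∑ℓ zero f = f []
  ∑ℓ (suc k) f = sum (λ x → ∑ℓ k (λ v → f (x ∷ v)))

  ∑ℓ-mono : ∀ {n} k {f g : List (Fin n) → ℕ} → (∀ v → length v ≡ k → f v ≤ g v) → ∑ℓ k f ≤ ∑ℓ k g
  ∑ℓ-mono zero h = h [] refl
  ∑ℓ-mono (suc k) h = sum-mono (λ x → ∑ℓ-mono k (λ v e → h (x ∷ v) (cong suc e)))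

  ∑ℓ-+ : ∀ {n} k (f g : List (Fin n) → ℕ) → ∑ℓ k (λ v → f v + g v) ≡ ∑ℓ k f + ∑ℓ k g
  ∑ℓ-+ zero f g = refl
  ∑ℓ-+ (suc k) f g = trans (sum-cong (λ x → ∑ℓ-+ k (f ∘ (x ∷_)) (g ∘ (x ∷_)))) (sum-+ _ _)

  ∑ℓ-* : ∀ {n} k c (f : List (Fin n) → ℕ) → ∑ℓ k (λ v → c * f v) ≡ c * ∑ℓ k f
  ∑ℓ-* zero c f = refl
  ∑ℓ-* (suc k) c f = trans (sum-cong (λ x → ∑ℓ-* k c (f ∘ (x ∷_)))) (sym (*-sum c _))

  ∑ℓ-snoc : ∀ {n} k (c : List (Fin n)) (f : List (Fin n) → ℕ) →
            sum (λ x → ∑ℓ k (λ v → f (v ++ x ∷ c))) ≡ ∑ℓ (suc k) (λ v → f (v ++ c))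
  ∑ℓ-snoc zero c f = refl
  ∑ℓ-snoc {n} (suc k) c f = trans
    (sum-comm (λ x y → ∑ℓ k (λ v → f (y ∷ v ++ x ∷ c))))
    (sum-cong (λ y → ∑ℓ-snoc k c (f ∘ (y ∷_))))

  module _ {n : ℕ} where

    private O = Fin.≤-decTotalOrder n

    insert′ : Fin n → List (Fin n) → List (Fin n)
    insert′ = insert O

    sort′ : List (Fin n) → List (Fin n)
    sort′ = sort O

    -- Paying for both branches at once allows the sums over `x` and `y` to be exchanged without
    -- knowing which is smaller.
    insert-either : ∀ (f : List (Fin n) → ℕ) x y v →
                    f (insert′ x (y ∷ v)) ≤ f (x ∷ y ∷ v) + f (y ∷ insert′ x v)
    insert-either f x y v with does (x Fin.≤? y)
    ... | true = m≤m+n _ _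
    ... | false = m≤n+m _ _

    -- Each list of length k + 1 arises at most k + 1 times as an insertion.
    ∑ℓ-insert : ∀ k (f : List (Fin n) → ℕ) →
                sum (λ x → ∑ℓ k (λ v → f (insert′ x v))) ≤ suc k * ∑ℓ (suc k) f
    ∑ℓ-insert zero f = ≤-reflexive (sym (+-identityʳ _))
    ∑ℓ-insert (suc k) f = begin
      sum (λ x → sum (λ y → ∑ℓ k (λ v → f (insert′ x (y ∷ v)))))
        ≤⟨ sum-mono (λ x → sum-mono (λ y → ∑ℓ-mono k (λ v _ → insert-either f x y v))) ⟩
      sum (λ x → sum (λ y → ∑ℓ k (λ v → f (x ∷ y ∷ v) + f (y ∷ insert′ x v))))
        ≡⟨ sum-cong (λ x → trans (sum-cong (λ y → ∑ℓ-+ k _ _)) (sum-+ _ _)) ⟩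
      sum (λ x → sum (λ y → ∑ℓ k (λ v → f (x ∷ y ∷ v))) + sum (λ y → ∑ℓ k (λ v → f (y ∷ insert′ x v))))
        ≡⟨ sum-+ _ _ ⟩
      ∑ℓ (suc (suc k)) f + sum (λ x → sum (λ y → ∑ℓ k (λ v → f (y ∷ insert′ x v))))
        ≡⟨ cong (∑ℓ (suc (suc k)) f +_) (sum-comm (λ x y → ∑ℓ k (λ v → f (y ∷ insert′ x v)))) ⟩
      ∑ℓ (suc (suc k)) f + sum (λ y → sum (λ x → ∑ℓ k (λ v → f (y ∷ insert′ x v))))
        ≤⟨ +-monoʳ-≤ (∑ℓ (suc (suc k)) f) (sum-mono (λ y → ∑ℓ-insert k (f ∘ (y ∷_)))) ⟩
      ∑ℓ (suc (suc k)) f + sum (λ y → suc k * ∑ℓ (suc k) (f ∘ (y ∷_)))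
        ≡⟨ cong (∑ℓ (suc (suc k)) f +_) (sym (*-sum (suc k) _)) ⟩
      suc (suc k) * ∑ℓ (suc (suc k)) f ∎

    ∑ℓ-sort : ∀ k (f : List (Fin n) → ℕ) → ∑ℓ k (f ∘ sort′) ≤ k ! * ∑ℓ k f
    ∑ℓ-sort zero f = ≤-reflexive (sym (+-identityʳ _))
    ∑ℓ-sort (suc k) f = begin
      sum (λ x → ∑ℓ k (λ v → f (insert′ x (sort′ v)))) ≤⟨ sum-mono (λ x → ∑ℓ-sort k (f ∘ insert′ x)) ⟩
      sum (λ x → k ! * ∑ℓ k (f ∘ insert′ x)) ≡⟨ *-sum (k !) _ ⟨
      k ! * sum (λ x → ∑ℓ k (f ∘ insert′ x)) ≤⟨ *-monoʳ-≤ (k !) (∑ℓ-insert k f) ⟩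
      k ! * (suc k * ∑ℓ (suc k) f) ≡⟨ *-assoc (k !) (suc k) _ ⟨
      k ! * suc k * ∑ℓ (suc k) f ≡⟨ cong (_* ∑ℓ (suc k) f) (*-comm (k !) (suc k)) ⟩
      suc k ! * ∑ℓ (suc k) f ∎

    -- Reads a pattern on `insert′ x v` back on `x ∷ v`: the bit that lands on `x` moves to the
    -- front. Empty results occur only for words of the wrong length.
    unsort-insert : Fin n → List (Fin n) → List Bool → List Bool
    unsort-insert x [] w = w
    unsort-insert x (y ∷ v) w with does (x Fin.≤? y)
    ... | true = w
    unsort-insert x (y ∷ v) [] | false = []
    unsort-insert x (y ∷ v) (a ∷ w) | false with unsort-insert x v w
    ... | [] = []
    ... | b ∷ w′ = b ∷ a ∷ w′

    unsort-insert-length : ∀ x v w → length w ≡ suc (length v) →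
                           length (unsort-insert x v w) ≡ suc (length v)
    unsort-insert-length x [] w e = e
    unsort-insert-length x (y ∷ v) w e with does (x Fin.≤? y)
    ... | true = e
    unsort-insert-length x (y ∷ v) (a ∷ w) e | false
      with unsort-insert x v w | unsort-insert-length x v w (suc-injective e)
    ... | b ∷ w′ | e′ = cong suc e′

    unsort-insert-correct : ∀ (f : Fin n → Bool) x v w → length w ≡ suc (length v) →
      map f (x ∷ v) ≡ unsort-insert x v w → map f (insert′ x v) ≡ w
    unsort-insert-correct f x [] w e h = h
    unsort-insert-correct f x (y ∷ v) w e h with does (x Fin.≤? y)
    ... | true = h
    unsort-insert-correct f x (y ∷ v) (a ∷ w) e h | false
      with unsort-insert x v w | unsort-insert-length x v w (suc-injective e) | unsort-insert-correct f x v w (suc-injective e)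
    ... | b ∷ w′ | _ | ih = cong₂ _∷_ (List.∷-injectiveˡ (List.∷-injectiveʳ h))
           (ih (cong₂ _∷_ (List.∷-injectiveˡ h) (List.∷-injectiveʳ (List.∷-injectiveʳ h))))

    insert-length : ∀ x v → length (insert′ x v) ≡ suc (length v)
    insert-length x [] = refl
    insert-length x (y ∷ v) with does (x Fin.≤? y)
    ... | true = refl
    ... | false = cong suc (insert-length x v)

    sort-length : ∀ v → length (sort′ v) ≡ length v
    sort-length [] = refl
    sort-length (x ∷ v) = trans (insert-length x (sort′ v)) (cong suc (sort-length v))

    -- The pattern on v which turns into w when v is sorted.
    unsort : List (Fin n) → List Bool → List Bool
    unsort [] w = w
    unsort (x ∷ v) w with unsort-insert x (sort′ v) w
    ... | [] = []
    ... | b ∷ w′ = b ∷ unsort v w′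

    unsort-length : ∀ v w → length w ≡ length v → length (unsort v w) ≡ length v
    unsort-length [] w e = e
    unsort-length (x ∷ v) w e
      with unsort-insert x (sort′ v) w
         | unsort-insert-length x (sort′ v) w (trans e (cong suc (sym (sort-length v))))
    ... | b ∷ w′ | e′ = cong suc (unsort-length v w′ (trans (suc-injective e′) (sort-length v)))

    unsort-correct : ∀ (f : Fin n → Bool) v w → length w ≡ length v →
                     map f v ≡ unsort v w → map f (sort′ v) ≡ w
    unsort-correct f [] w e h = h
    unsort-correct f (x ∷ v) w e h
      with unsort-insert x (sort′ v) w
         | unsort-insert-length x (sort′ v) w (trans e (cong suc (sym (sort-length v))))
         | unsort-insert-correct f x (sort′ v) w (trans e (cong suc (sym (sort-length v))))
    ... | b ∷ w′ | e′ | ih = ih (cong₂ _∷_ (List.∷-injectiveˡ h)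
            (unsort-correct f v w′ (trans (suc-injective e′) (sort-length v)) (List.∷-injectiveʳ h)))

  ∑⊆ : ∀ {n} (i : ℕ) → List (Fin n) → (List (Fin n) → ℕ) → ℕ
  ∑⊆ zero κ f = f []
  ∑⊆ (suc i) [] f = 0
  ∑⊆ (suc i) (y ∷ κ) f = ∑⊆ i κ (f ∘ (y ∷_)) + ∑⊆ (suc i) κ f

  ∑⊆-term : ∀ {n} {κ c : List (Fin n)} (f : List (Fin n) → ℕ) → c ⊆ κ → f c ≤ ∑⊆ (length c) κ f
  ∑⊆-term {c = []} f σ = ≤-refl
  ∑⊆-term {c = x ∷ c} f (y ∷ʳ σ) = ≤-trans (∑⊆-term f σ) (m≤n+m _ _)
  ∑⊆-term {c = x ∷ c} f (refl ∷ σ) = ≤-trans (∑⊆-term (f ∘ (x ∷_)) σ) (m≤m+n _ _)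

  ∑⊆-bound : ∀ {n} i (κ : List (Fin n)) {f : List (Fin n) → ℕ} {B} →
             (∀ {c} → c ⊆ κ → length c ≡ i → f c ≤ B) → ∑⊆ i κ f ≤ suc (length κ) ^ i * B
  ∑⊆-bound zero κ {B = B} h = ≤-trans (h (Sublist.minimum κ) refl) (≤-reflexive (sym (+-identityʳ B)))
  ∑⊆-bound (suc i) [] h = z≤n
  ∑⊆-bound (suc i) (y ∷ κ) {f} {B} h = begin
    ∑⊆ i κ (f ∘ (y ∷_)) + ∑⊆ (suc i) κ f
      ≤⟨ +-mono-≤ (∑⊆-bound i κ (λ σ e → h (refl ∷ σ) (cong suc e))) (∑⊆-bound (suc i) κ (λ σ e → h (y ∷ʳ σ) e)) ⟩
    suc q ^ i * B + suc q ^ suc i * B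
      ≡⟨ *-distribʳ-+ B (suc q ^ i) (suc q ^ suc i) ⟨
    suc (suc q) * suc q ^ i * B
      ≤⟨ *-monoˡ-≤ B (*-monoʳ-≤ (suc (suc q)) (^-monoˡ-≤ i (n≤1+n (suc q)))) ⟩
    suc (suc q) ^ suc i * B ∎
    where q = length κ

  ∑⊆-cong : ∀ {n} i (κ : List (Fin n)) {f g : List (Fin n) → ℕ} → (∀ c → f c ≡ g c) → ∑⊆ i κ f ≡ ∑⊆ i κ g
  ∑⊆-cong zero κ h = h []
  ∑⊆-cong (suc i) [] h = refl
  ∑⊆-cong (suc i) (y ∷ κ) h = cong₂ _+_ (∑⊆-cong i κ (h ∘ (y ∷_))) (∑⊆-cong (suc i) κ h)

  sum-∑⊆ : ∀ {m n} i (κ : List (Fin n)) (f : Fin m → List (Fin n) → ℕ) →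
           sum (λ x → ∑⊆ i κ (f x)) ≡ ∑⊆ i κ (λ c → sum (λ x → f x c))
  sum-∑⊆ zero κ f = refl
  sum-∑⊆ {m} (suc i) [] f = trans (sum-const m 0) (*-zeroʳ m)
  sum-∑⊆ (suc i) (y ∷ κ) f = trans (sum-+ _ _)
    (cong₂ _+_ (sum-∑⊆ i κ (λ x → f x ∘ (y ∷_))) (sum-∑⊆ (suc i) κ f))

  ∑⊆-* : ∀ {n} i k (κ : List (Fin n)) (f : List (Fin n) → ℕ) → k * ∑⊆ i κ f ≡ ∑⊆ i κ (λ c → k * f c)
  ∑⊆-* zero k κ f = refl
  ∑⊆-* (suc i) k [] f = *-zeroʳ k
  ∑⊆-* (suc i) k (y ∷ κ) f = trans (*-distribˡ-+ k _ _) (cong₂ _+_ (∑⊆-* i k κ _) (∑⊆-* (suc i) k κ f))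

  -- A list that is not heavy has few heavy extensions by one element, so heavy lists
  -- (and with them lists satisfying Q) can be avoided while adding columns one at a time.
  module Heaviness {n : ℕ} (Δ : ℕ) (Q : List (Fin n) → Set) (Q? : Decidable Q) where

    Heavy : ℕ → List (Fin n) → Set
    Heavy? : ∀ k → Decidable (Heavy k)
    Heavy zero c = Q c
    Heavy (suc k) c = n ≤ Δ * # (λ x → Heavy? k (x ∷ c))
    Heavy? zero c = Q? c
    Heavy? (suc k) c = n ℕ.≤? Δ * # (λ x → Heavy? k (x ∷ c))

    -- Unfolding `Heavy` gives at least `n / Δ` continuations at each of the `k` steps, hence a
    -- share of `1 / Δ ^ k` of all `k`-tuples.
    Heavy⇒many : ∀ k c → Heavy k c → n ^ k ≤ Δ ^ k * ∑ℓ k (λ v → 𝟙 (Q? (v ++ c)))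
    Heavy⇒many zero c q = ≤-reflexive (sym (trans (+-identityʳ _) (𝟙-yes (Q? c) q)))
    Heavy⇒many (suc k) c h = begin
      n * n ^ k
        ≤⟨ *-monoˡ-≤ (n ^ k) h ⟩
      Δ * # (λ x → Heavy? k (x ∷ c)) * n ^ k
        ≡⟨ *-assoc Δ _ (n ^ k) ⟩
      Δ * (# (λ x → Heavy? k (x ∷ c)) * n ^ k)
        ≡⟨ cong (Δ *_) (trans (cong (_* n ^ k) (#-def (λ x → Heavy? k (x ∷ c)))) (sum-* (n ^ k) _)) ⟩
      Δ * sum (λ x → 𝟙 (Heavy? k (x ∷ c)) * n ^ k)
        ≤⟨ *-monoʳ-≤ Δ (sum-mono (λ x → 𝟙-*-mono (Heavy? k (x ∷ c)) (Heavy⇒many k (x ∷ c)))) ⟩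
      Δ * sum (λ x → 𝟙 (Heavy? k (x ∷ c)) * (Δ ^ k * ∑ℓ k (λ v → 𝟙 (Q? (v ++ x ∷ c)))))
        ≤⟨ *-monoʳ-≤ Δ (sum-mono (λ x → ≤-trans (*-monoˡ-≤ _ (𝟙≤1 (Heavy? k (x ∷ c)))) (≤-reflexive (*-identityˡ _)))) ⟩
      Δ * sum (λ x → Δ ^ k * ∑ℓ k (λ v → 𝟙 (Q? (v ++ x ∷ c))))
        ≡⟨ cong (Δ *_) (sym (*-sum (Δ ^ k) _)) ⟩
      Δ * (Δ ^ k * sum (λ x → ∑ℓ k (λ v → 𝟙 (Q? (v ++ x ∷ c)))))
        ≡⟨ cong (λ z → Δ * (Δ ^ k * z)) (∑ℓ-snoc k c (𝟙 ∘ Q?)) ⟩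
      Δ * (Δ ^ k * ∑ℓ (suc k) (λ v → 𝟙 (Q? (v ++ c))))
        ≡⟨ *-assoc Δ (Δ ^ k) _ ⟨
      Δ ^ suc k * ∑ℓ (suc k) (λ v → 𝟙 (Q? (v ++ c))) ∎

  -- Only the length of `κ` matters; recursion on the list keeps the sum in step with the refinement
  -- of classes when a column is added.
  ∑𝔹 : {X : Set} → List X → (List Bool → ℕ) → ℕ
  ∑𝔹 [] f = f []
  ∑𝔹 (_ ∷ κ) f = ∑𝔹 κ (λ w → f (false ∷ w)) + ∑𝔹 κ (λ w → f (true ∷ w))

  ∑𝔹-mono : {X : Set} (κ : List X) {f g : List Bool → ℕ} → (∀ w → f w ≤ g w) → ∑𝔹 κ f ≤ ∑𝔹 κ g
  ∑𝔹-mono [] h = h []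
  ∑𝔹-mono (_ ∷ κ) h = +-mono-≤ (∑𝔹-mono κ (h ∘ (false ∷_))) (∑𝔹-mono κ (h ∘ (true ∷_)))

  ∑𝔹-+ : {X : Set} (κ : List X) (f g : List Bool → ℕ) → ∑𝔹 κ (λ w → f w + g w) ≡ ∑𝔹 κ f + ∑𝔹 κ g
  ∑𝔹-+ [] f g = refl
  ∑𝔹-+ (_ ∷ κ) f g = trans
    (cong₂ _+_ (∑𝔹-+ κ (f ∘ (false ∷_)) (g ∘ (false ∷_))) (∑𝔹-+ κ (f ∘ (true ∷_)) (g ∘ (true ∷_))))
    (lemma (∑𝔹 κ (f ∘ (false ∷_))) _ _ _)
    where
    lemma : ∀ a b c d → (a + b) + (c + d) ≡ (a + c) + (b + d)
    lemma = solve-∀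

  ∑𝔹-* : ∀ {X : Set} (κ : List X) k (f : List Bool → ℕ) → ∑𝔹 κ (λ w → k * f w) ≡ k * ∑𝔹 κ f
  ∑𝔹-* [] k f = refl
  ∑𝔹-* (_ ∷ κ) k f = trans (cong₂ _+_ (∑𝔹-* κ k _) (∑𝔹-* κ k _)) (sym (*-distribˡ-+ k _ _))

  ∑𝔹-∃ : {X : Set} (κ : List X) {P : List Bool → Set} (P? : Decidable P) → 0 < ∑𝔹 κ (𝟙 ∘ P?) → ∃ P
  ∑𝔹-∃ [] P? h = [] , 𝟙-pos (P? []) h
  ∑𝔹-∃ (_ ∷ κ) P? h with ∑𝔹 κ (𝟙 ∘ P? ∘ (false ∷_)) in eq
  ... | suc _ = let w , p = ∑𝔹-∃ κ (P? ∘ (false ∷_)) (subst (0 <_) (sym eq) (s≤s z≤n)) in false ∷ w , p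
  ... | zero = let w , p = ∑𝔹-∃ κ (P? ∘ (true ∷_)) h in true ∷ w , p

  sum-∑𝔹 : ∀ {X : Set} {n : ℕ} (κ : List X) (f : Fin n → List Bool → ℕ) →
           sum (λ x → ∑𝔹 κ (f x)) ≡ ∑𝔹 κ (λ w → sum (λ x → f x w))
  sum-∑𝔹 [] f = refl
  sum-∑𝔹 (_ ∷ κ) f = trans (sum-+ _ _)
    (cong₂ _+_ (sum-∑𝔹 κ (λ x → f x ∘ (false ∷_))) (sum-∑𝔹 κ (λ x → f x ∘ (true ∷_))))

  -- The sum of the binomial coefficients `q` over `i` for `i < d`, by Pascal's rule.
  sauerBound : ℕ → ℕ → ℕ
  sauerBound q zero = 0
  sauerBound zero (suc d) = 1
  sauerBound (suc q) (suc d) = sauerBound q (suc d) + sauerBound q d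

  sauerBound≤ : ∀ q d → sauerBound q d ≤ suc q ^ d
  sauerBound≤ q zero = z≤n
  sauerBound≤ zero (suc d) = ≤-reflexive (sym (^-zeroˡ (suc d)))
  sauerBound≤ (suc q) (suc d) = begin
    sauerBound q (suc d) + sauerBound q d ≤⟨ +-mono-≤ (sauerBound≤ q (suc d)) (sauerBound≤ q d) ⟩
    suc q ^ suc d + suc q ^ d ≡⟨ +-comm (suc q ^ suc d) _ ⟩
    suc (suc q) * suc q ^ d ≤⟨ *-monoʳ-≤ (suc (suc q)) (^-monoˡ-≤ d (n≤1+n (suc q))) ⟩
    suc (suc q) ^ suc d ∎

  -- The restriction of a word from `κ` to `c` is expressed through the functions `f` that induce
  -- it, so no embedding of `c` into `κ` has to be carried along.
  Shatters : {X : Set} → (List Bool → Set) → List X → List X → Set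
  Shatters P κ c = ∀ u → length u ≡ length c → ∃[ w ] P w × (∀ f → map f κ ≡ w → map f c ≡ u)

  -- Words with at least one extension by a first letter in `P`, and words with both, add up to the
  -- size of `P`, so one of the two families exceeds its bound. The first family shatters `suc d`
  -- elements of `κ`; the second shatters `d` of them, to which `y` can be added.
  sauer : {X : Set} (κ : List X) (d : ℕ) {P : List Bool → Set} (P? : Decidable P) →
          sauerBound (length κ) d < ∑𝔹 κ (𝟙 ∘ P?) →
          ∃[ c ] c ⊆ κ × length c ≡ d × Shatters P κ c
  sauer κ zero P? h with ∑𝔹-∃ κ P? h
  ... | w , p = [] , Sublist.minimum κ , refl , λ { [] _ → w , p , λ _ _ → refl }
  sauer [] (suc d) P? h = contradiction (𝟙≤1 (P? [])) (<⇒≱ h)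
  sauer (y ∷ κ) (suc d) {P} P? h with sauerBound (length κ) (suc d) ℕ.<? ∑𝔹 κ (𝟙 ∘ P∪?)
    where P∪? : Decidable (λ w → P (false ∷ w) ⊎ P (true ∷ w))
          P∪? w = P? (false ∷ w) ⊎-dec P? (true ∷ w)
  ... | yes h∪ = let c , σ , e , sh = sauer κ (suc d) _ h∪ in
    c , y ∷ʳ σ , e , λ u l → case sh u l of λ where
      (w , inj₁ p , t) → false ∷ w , p , λ f q → t f (List.∷-injectiveʳ q)
      (w , inj₂ p , t) → true ∷ w , p , λ f q → t f (List.∷-injectiveʳ q)
  ... | no ¬h∪ = let c , σ , e , sh = sauer κ d P∩? h∩ in
    y ∷ c , refl ∷ σ , cong suc e , λ where
      (false ∷ u) l → let w , p , t = sh u (suc-injective l) in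
        false ∷ w , proj₁ p , λ f q → cong₂ _∷_ (List.∷-injectiveˡ q) (t f (List.∷-injectiveʳ q))
      (true ∷ u) l → let w , p , t = sh u (suc-injective l) in
        true ∷ w , proj₂ p , λ f q → cong₂ _∷_ (List.∷-injectiveˡ q) (t f (List.∷-injectiveʳ q))
    where
    P∪? : Decidable (λ w → P (false ∷ w) ⊎ P (true ∷ w))
    P∪? w = P? (false ∷ w) ⊎-dec P? (true ∷ w)
    P∩? : Decidable (λ w → P (false ∷ w) × P (true ∷ w))
    P∩? w = P? (false ∷ w) ×-dec P? (true ∷ w)
    inclusion-exclusion : ∀ w → 𝟙 (P? (false ∷ w)) + 𝟙 (P? (true ∷ w)) ≤ 𝟙 (P∪? w) + 𝟙 (P∩? w)
    inclusion-exclusion w with P? (false ∷ w) | P? (true ∷ w)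
    ... | yes _ | yes _ = ≤-refl
    ... | yes _ | no _ = ≤-refl
    ... | no _ | yes _ = ≤-refl
    ... | no _ | no _ = ≤-refl
    h∩ : sauerBound (length κ) d < ∑𝔹 κ (𝟙 ∘ P∩?)
    h∩ = +-cancelˡ-< (sauerBound (length κ) (suc d)) _ _ (begin-strict
      sauerBound (length κ) (suc d) + sauerBound (length κ) d <⟨ h ⟩
      ∑𝔹 κ (𝟙 ∘ P? ∘ (false ∷_)) + ∑𝔹 κ (𝟙 ∘ P? ∘ (true ∷_)) ≡⟨ ∑𝔹-+ κ _ _ ⟨
      ∑𝔹 κ (λ w → 𝟙 (P? (false ∷ w)) + 𝟙 (P? (true ∷ w))) ≤⟨ ∑𝔹-mono κ inclusion-exclusion ⟩
      ∑𝔹 κ (λ w → 𝟙 (P∪? w) + 𝟙 (P∩? w)) ≡⟨ ∑𝔹-+ κ _ _ ⟩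
      ∑𝔹 κ (𝟙 ∘ P∪?) + ∑𝔹 κ (𝟙 ∘ P∩?) ≤⟨ +-monoˡ-≤ _ (≮⇒≥ ¬h∪) ⟩
      sauerBound (length κ) (suc d) + ∑𝔹 κ (𝟙 ∘ P∩?) ∎)

  -- Products of sets and separated choices.

  ∑Π : ∀ {n} s {P : Fin s → Fin n → Set} → (∀ i → Decidable (P i)) → (List (Fin n) → ℕ) → ℕ
  ∑Π zero P? f = f []
  ∑Π (suc s) P? f = sum (λ x → 𝟙 (P? zero x) * ∑Π s (P? ∘ suc) (f ∘ (x ∷_)))

  _∈Π_ : ∀ {n s} → List (Fin n) → (Fin s → Fin n → Set) → Set
  _∈Π_ {s = zero} [] P = ⊤
  _∈Π_ {s = suc s} [] P = ⊥
  _∈Π_ {s = zero} (x ∷ r) P = ⊥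
  _∈Π_ {s = suc s} (x ∷ r) P = P zero x × r ∈Π (P ∘ suc)

  ∑Π≤∑ℓ : ∀ {n} s {P : Fin s → Fin n → Set} (P? : ∀ i → Decidable (P i)) {f g : List (Fin n) → ℕ} →
          (∀ r → r ∈Π P → f r ≤ g r) → ∑Π s P? f ≤ ∑ℓ s g
  ∑Π≤∑ℓ zero P? h = h [] tt
  ∑Π≤∑ℓ (suc s) {P} P? {f} {g} h = sum-mono go
    where
    go : ∀ x → 𝟙 (P? zero x) * ∑Π s (P? ∘ suc) (f ∘ (x ∷_)) ≤ ∑ℓ s (g ∘ (x ∷_))
    go x with P? zero x
    ... | yes p = ≤-trans (≤-reflexive (*-identityˡ _)) (∑Π≤∑ℓ s (P? ∘ suc) (λ r q → h (x ∷ r) (p , q)))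
    ... | no _ = z≤n

  ∑Π-large : ∀ {n} b F s {P : Fin s → Fin n → Set} (P? : ∀ i → Decidable (P i)) →
             (∀ i → b ≤ F * # (P? i)) → b ^ s ≤ F ^ s * ∑Π s P? (λ _ → 1)
  ∑Π-large b F zero P? h = ≤-refl
  ∑Π-large b F (suc s) P? h = begin
    b * b ^ s ≤⟨ *-mono-≤ (h zero) (∑Π-large b F s (P? ∘ suc) (h ∘ suc)) ⟩
    F * # (P? zero) * (F ^ s * T) ≡⟨ *-interchange F (# (P? zero)) (F ^ s) T ⟩
    F ^ suc s * (# (P? zero) * T) ≡⟨ cong (F ^ suc s *_) (trans (cong (_* T) (#-def (P? zero))) (sum-* T _)) ⟩
    F ^ suc s * sum (λ x → 𝟙 (P? zero x) * T) ∎
    where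
    T = ∑Π s (P? ∘ suc) (λ _ → 1)

  Separated : ∀ {n s} → (Fin s → Fin n → Set) → Set
  Separated P = ∀ {i j x y} → i Fin.< j → P i x → P j y → x Fin.< y

  separated⇒increasing : ∀ {n} s {P : Fin s → Fin n → Set} → Separated P → ∀ r → r ∈Π P → AllPairs Fin._<_ r
  separated⇒increasing zero sep [] _ = []
  separated⇒increasing (suc s) {P} sep (x ∷ r) (p , q) =
    above s (P ∘ suc) r q (λ i → sep {zero} {suc i} (s≤s z≤n) p) ∷
    separated⇒increasing s (λ {i} {j} i<j → sep {suc i} {suc j} (s≤s i<j)) r q
    where
    above : ∀ s (P : Fin s → Fin _ → Set) r → r ∈Π P → (∀ i {y} → P i y → x Fin.< y) → All (x Fin.<_) r
    above zero P [] _ h = []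
    above (suc s) P (y ∷ r) (p , q) h = h zero p ∷ above s (P ∘ suc) r q (h ∘ suc)

  ∈Π-map : ∀ {n} {A : Set} s {P : Fin s → Fin n → Set} {f : Fin n → A} {g : Fin s → A} →
           (∀ i {x} → P i x → f x ≡ g i) → ∀ r → r ∈Π P → map f r ≡ List.tabulate g
  ∈Π-map zero h [] _ = refl
  ∈Π-map (suc s) h (x ∷ r) (p , q) = cong₂ _∷_ (h zero p) (∈Π-map s (h ∘ suc) r q)

  -- `τ i` is the set that supplies the `i`-th part from the left. Its inverse `ρ` is kept because
  -- it will name the block of columns to use. The bound `x` lets the choice continue to the right
  -- of a separator.
  record OrderedChoice {n s} (b x : ℕ) (P : Fin s → Fin n → Set) : Set₁ where
    field
      τ ρ : Fin s → Fin s
      ρ∘τ : ∀ i → ρ (τ i) ≡ i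
      R : Fin s → Fin n → Set
      R? : ∀ i → Decidable (R i)
      R⊆P : ∀ i {r} → R i r → P (τ i) r
      R≥x : ∀ i {r} → R i r → x ≤ toℕ r
      separated : Separated R
      large : ∀ i → b ≤ # (R? i)

  -- The first threshold y below which some P j has b elements is a separator:
  -- every other P j has at most b elements below y.
  orderedChoice : ∀ {n} s b x {P : Fin s → Fin n → Set} (P? : ∀ j → Decidable (P j)) → 0 < b →
             (∀ j → s * b ≤ # (λ r → P? j r ×-dec x ℕ.≤? toℕ r)) → OrderedChoice b x P
  orderedChoice zero b x P? 0<b h = record
    { τ = λ (); ρ = λ (); ρ∘τ = λ (); R = λ (); R? = λ (); R⊆P = λ (); R≥x = λ ()
    ; separated = λ { {()} }; large = λ () }
  orderedChoice {n} (suc s) b x {P} P? 0<b h with sweep n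
    where
    between? : ∀ j y → Decidable (λ (r : Fin n) → P j r × x ≤ toℕ r × toℕ r < y)
    between? j y r = P? j r ×-dec x ℕ.≤? toℕ r ×-dec toℕ r ℕ.<? y

    before : Fin (suc s) → ℕ → ℕ
    before j y = # (between? j y)

    step : ∀ j y → before j (suc y) ≤ suc (before j y)
    step j y = begin
      before j (suc y) ≤⟨ #-∪ (between? j (suc y)) (λ r → toℕ r ℕ.≟ y) (between? j y) split ⟩
      # {n} (λ r → toℕ r ℕ.≟ y) + before j y ≤⟨ +-monoˡ-≤ _ (single n y) ⟩
      suc (before j y) ∎
      where
      split : ∀ r → P j r × x ≤ toℕ r × toℕ r < suc y → toℕ r ≡ y ⊎ (P j r × x ≤ toℕ r × toℕ r < y)
      split r (p , q , s≤s u) with m≤n⇒m<n∨m≡n u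
      ... | inj₁ v = inj₂ (p , q , v)
      ... | inj₂ v = inj₁ v

    sweep : ∀ k → (∃[ y ] ∃[ j ] b ≤ before j y × (∀ i → before i y ≤ b)) ⊎ (∀ j → before j k < b)
    sweep zero = inj₂ λ j → ≤-<-trans (≤-reflexive (#-none (between? j 0) (λ { r (_ , _ , ()) }))) 0<b
    sweep (suc k) with sweep k
    ... | inj₁ found = inj₁ found
    ... | inj₂ below with Fin.any? (λ j → b ℕ.≤? before j (suc k))
    ... | yes (j , q) = inj₁ (suc k , j , q , λ i → ≤-trans (step i k) (below i))
    ... | no none = inj₂ λ j → ≰⇒> (λ q → none (j , q))
  ... | inj₂ below = contradiction
    (≤-trans (m≤m+n b (s * b)) (≤-trans (h zero) (#-mono _ _ (λ r (p , q) → p , q , Fin.toℕ<n r))))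
    (<⇒≱ (below zero))
  ... | inj₁ (y , j₀ , enough , few) = record
    { τ = τ′ ; ρ = ρ′ ; ρ∘τ = ρτ ; R = R′ ; R? = R′? ; R⊆P = R′⊆P ; R≥x = R′≥x ; separated = sep ; large = lrg }
    where
    between? : ∀ j → Decidable (λ (r : Fin n) → P j r × x ≤ toℕ r × toℕ r < y)
    between? j r = P? j r ×-dec x ℕ.≤? toℕ r ×-dec toℕ r ℕ.<? y

    rest : ∀ j → s * b ≤ # (λ r → P? j r ×-dec y ℕ.≤? toℕ r)
    rest j = +-cancelˡ-≤ b _ _ (≤-trans (h j) (≤-trans
      (#-∪ (λ r → P? j r ×-dec x ℕ.≤? toℕ r) (between? j) (λ r → P? j r ×-dec y ℕ.≤? toℕ r) split)
      (+-monoˡ-≤ _ (few j))))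
      where
      split : ∀ r → P j r × x ≤ toℕ r → (P j r × x ≤ toℕ r × toℕ r < y) ⊎ (P j r × y ≤ toℕ r)
      split r (p , q) with toℕ r ℕ.<? y
      ... | yes u = inj₁ (p , q , u)
      ... | no u = inj₂ (p , ≮⇒≥ u)

    open OrderedChoice (orderedChoice s b y {P ∘ Fin.punchIn j₀} (P? ∘ Fin.punchIn j₀) 0<b (rest ∘ Fin.punchIn j₀))

    x≤y : x ≤ y
    x≤y with #-∃ (between? j₀) (<-≤-trans 0<b enough)
    ... | _ , _ , p , q = <⇒≤ (≤-<-trans p q)

    τ′ ρ′ : Fin (suc s) → Fin (suc s)
    τ′ zero = j₀
    τ′ (suc i) = Fin.punchIn j₀ (τ i)
    ρ′ j with j₀ Fin.≟ j
    ... | yes _ = zero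
    ... | no ne = suc (ρ (Fin.punchOut ne))

    ρτ : ∀ i → ρ′ (τ′ i) ≡ i
    ρτ zero with j₀ Fin.≟ j₀
    ... | yes _ = refl
    ... | no ne = contradiction refl ne
    ρτ (suc i) with j₀ Fin.≟ Fin.punchIn j₀ (τ i)
    ... | yes e = contradiction (sym e) (Fin.punchInᵢ≢i j₀ (τ i))
    ... | no ne = cong suc (trans (cong ρ (trans (Fin.punchOut-cong j₀ refl) (Fin.punchOut-punchIn j₀))) (ρ∘τ i))

    R′ : Fin (suc s) → Fin n → Set
    R′ zero r = P j₀ r × x ≤ toℕ r × toℕ r < y
    R′ (suc i) r = R i r

    R′? : ∀ i → Decidable (R′ i)
    R′? zero = between? j₀
    R′? (suc i) = R? i

    R′⊆P : ∀ i {r} → R′ i r → P (τ′ i) r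
    R′⊆P zero = proj₁
    R′⊆P (suc i) = R⊆P i

    R′≥x : ∀ i {r} → R′ i r → x ≤ toℕ r
    R′≥x zero (_ , p , _) = p
    R′≥x (suc i) p = ≤-trans x≤y (R≥x i p)

    sep : Separated R′
    sep {zero} {suc j} _ (_ , _ , p) q = <-≤-trans p (R≥x j q)
    sep {suc i} {suc j} (s≤s i<j) p q = separated i<j p q

    lrg : ∀ i → b ≤ # (R′? i)
    lrg zero = enough
    lrg (suc i) = large i

  -- Patterns prescribed on blocks of columns.

  take-⊆ : ∀ {A : Set} k (c : List A) → List.take k c ⊆ c
  take-⊆ zero c = Sublist.minimum c
  take-⊆ (suc k) [] = []
  take-⊆ (suc k) (x ∷ c) = refl ∷ take-⊆ k c

  drop-⊆ : ∀ {A : Set} k (c : List A) → List.drop k c ⊆ c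
  drop-⊆ zero c = Sublist.⊆-refl
  drop-⊆ (suc k) [] = []
  drop-⊆ (suc k) (x ∷ c) = x ∷ʳ drop-⊆ k c

  ++-injective : ∀ {A : Set} (xs ys : List A) {zs ws} → length xs ≡ length ys →
                 xs ++ zs ≡ ys ++ ws → xs ≡ ys × zs ≡ ws
  ++-injective [] [] _ e = refl , e
  ++-injective (x ∷ xs) (y ∷ ys) l e with ++-injective xs ys (suc-injective l) (List.∷-injectiveʳ e)
  ... | e₁ , e₂ = cong₂ _∷_ (List.∷-injectiveˡ e) e₁ , e₂

  block : ∀ {A : Set} t {N} → Fin N → List A → List A
  block t zero c = List.take t c
  block t (suc j) c = block t j (List.drop t c)

  block-⊆ : ∀ {A : Set} t {N} (j : Fin N) (c : List A) → block t j c ⊆ c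
  block-⊆ t zero c = take-⊆ t c
  block-⊆ t (suc j) c = Sublist.⊆-trans (block-⊆ t j (List.drop t c)) (drop-⊆ t c)

  length-take-+ : ∀ {A : Set} t {k} (c : List A) → length c ≡ t + k → length (List.take t c) ≡ t
  length-take-+ t c e = trans (List.length-take t c) (m≤n⇒m⊓n≡m (≤-trans (m≤m+n t _) (≤-reflexive (sym e))))

  length-drop-+ : ∀ {A : Set} t {k} (c : List A) → length c ≡ t + k → length (List.drop t c) ≡ k
  length-drop-+ t {k} c e = trans (List.length-drop t c) (trans (cong (_∸ t) e) (m+n∸m≡n t k))

  block-length : ∀ {A : Set} t {N} (j : Fin N) (c : List A) → length c ≡ N * t → length (block t j c) ≡ t
  block-length t zero c e = length-take-+ t c e
  block-length t (suc j) c e = block-length t j (List.drop t c) (length-drop-+ t c e)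

  -- The pattern on c which shows p j on the j-th block once that block is sorted.
  word : ∀ {n} t N → (Fin N → List Bool) → List (Fin n) → List Bool
  word t zero p c = []
  word t (suc N) p c = unsort (List.take t c) (p zero) ++ word t N (p ∘ suc) (List.drop t c)

  word-length : ∀ {n} t N {p : Fin N → List Bool} (c : List (Fin n)) → (∀ j → length (p j) ≡ t) →
                length c ≡ N * t → length (word t N p c) ≡ N * t
  word-length t zero c h e = refl
  word-length t (suc N) {p} c h e = trans (List.length-++ (unsort (List.take t c) (p zero)))
    (cong₂ _+_ (trans (unsort-length (List.take t c) (p zero) (trans (h zero) (sym (length-take-+ t c e)))) (length-take-+ t c e))
               (word-length t N (List.drop t c) (h ∘ suc) (length-drop-+ t c e)))

  word-correct : ∀ {n} t N {p : Fin N → List Bool} (c : List (Fin n)) → (∀ j → length (p j) ≡ t) →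
                 length c ≡ N * t → ∀ (f : Fin n → Bool) j → map f c ≡ word t N p c →
                 map f (sort′ (block t j c)) ≡ p j
  word-correct t (suc N) {p} c h e f j eq
    with ++-injective (map f (List.take t c)) (unsort (List.take t c) (p zero))
           (trans (List.length-map f (List.take t c)) (sym (unsort-length (List.take t c) (p zero) l)))
           (trans (sym (List.map-++ f (List.take t c) (List.drop t c))) (trans (cong (map f) (List.take++drop≡id t c)) eq))
    where l = trans (h zero) (sym (length-take-+ t c e))
  word-correct t (suc N) {p} c h e f zero eq | e₁ , _ =
    unsort-correct f (List.take t c) (p zero) (trans (h zero) (sym (length-take-+ t c e))) e₁
  word-correct t (suc N) {p} c h e f (suc j) eq | _ , e₂ =
    word-correct t N (List.drop t c) (h ∘ suc) (length-drop-+ t c e) f j e₂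

  module _ {n : ℕ} where

    insert-All : ∀ {P : Fin n → Set} {x v} → P x → All P v → All P (insert′ x v)
    insert-All {x = x} p [] = p ∷ []
    insert-All {x = x} {y ∷ v} p (q ∷ qs) with does (x Fin.≤? y)
    ... | true = p ∷ q ∷ qs
    ... | false = q ∷ insert-All p qs

    sort-All : ∀ {P : Fin n → Set} {v} → All P v → All P (sort′ v)
    sort-All [] = []
    sort-All (p ∷ ps) = insert-All p (sort-All ps)

    insert-increasing : ∀ {x v} → All (x ≢_) v → AllPairs Fin._<_ v → AllPairs Fin._<_ (insert′ x v)
    insert-increasing [] [] = [] ∷ []
    insert-increasing {x} {y ∷ v} (x≢y ∷ ne) (y< ∷ inc) with does (x Fin.≤? y) | proof (x Fin.≤? y)
    ... | true | ofʸ x≤y = (x<y ∷ All.map (Fin.<-trans x<y) y<) ∷ y< ∷ inc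
      where x<y = ≤∧≢⇒< x≤y (x≢y ∘ Fin.toℕ-injective)
    ... | false | ofⁿ x≰y = insert-All (≰⇒> x≰y) y< ∷ insert-increasing ne inc

    sort-increasing : ∀ {v} → AllPairs _≢_ v → AllPairs Fin._<_ (sort′ v)
    sort-increasing [] = []
    sort-increasing (ne ∷ nes) = insert-increasing (sort-All ne) (sort-increasing nes)

  ⊆-AllPairs : ∀ {A : Set} {R : A → A → Set} {c κ : List A} → c ⊆ κ → AllPairs R κ → AllPairs R c
  ⊆-AllPairs [] [] = []
  ⊆-AllPairs (y ∷ʳ σ) (_ ∷ ps) = ⊆-AllPairs σ ps
  ⊆-AllPairs (refl ∷ σ) (p ∷ ps) = All-resp-⊆ σ p ∷ ⊆-AllPairs σ ps

  module ListCopies {n s : ℕ} (M : Fin n → Fin n → Bool) (𝒜 : Fin s → List Bool) where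

    Copy : List (Fin n) → List (Fin n) → Set
    Copy r e = AllPairs Fin._<_ r × AllPairs Fin._<_ e × map (λ x → map (M x) e) r ≡ List.tabulate 𝒜

    copy? : ∀ r e → Dec (Copy r e)
    copy? r e = allPairs? Fin._<?_ r ×-dec allPairs? Fin._<?_ e ×-dec
                List.≡-dec (List.≡-dec Bool._≟_) (map (λ x → map (M x) e) r) (List.tabulate 𝒜)

    copiesOn : List (Fin n) → ℕ
    copiesOn e = ∑ℓ s (λ r → 𝟙 (copy? r e))

    copiesOn-large : ∀ {b e} {R : Fin s → Fin n → Set} (R? : ∀ i → Decidable (R i)) →
      (∀ i → b ≤ # (R? i)) → Separated R → AllPairs Fin._<_ e →
      (∀ i {x} → R i x → map (M x) e ≡ 𝒜 i) → b ^ s ≤ copiesOn e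
    copiesOn-large {b} {e} R? lrg sep inc h = begin
      b ^ s ≤⟨ ∑Π-large b 1 s R? (λ i → ≤-trans (lrg i) (≤-reflexive (sym (*-identityˡ _)))) ⟩
      1 ^ s * ∑Π s R? (λ _ → 1) ≡⟨ trans (cong (_* ∑Π s R? (λ _ → 1)) (^-zeroˡ s)) (*-identityˡ _) ⟩
      ∑Π s R? (λ _ → 1) ≤⟨ ∑Π≤∑ℓ s R? (λ r q → ≤-reflexive (sym (𝟙-yes (copy? r e)
                (separated⇒increasing s sep r q , inc , ∈Π-map s h r q)))) ⟩
      copiesOn e ∎

    -- `c` lists columns in the order of picking, while a copy needs them increasing; hence `word`
    -- prescribes what a block shows after sorting. The classes of the words contain separated
    -- parts, and every choice of one row from each part gives a copy on the sorted block.
    shattered⇒copies : ∀ t {b} c → (∀ i → length (𝒜 i) ≡ t) → 0 < b →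
      length c ≡ s ^ s * t → AllPairs _≢_ c →
      (∀ u → length u ≡ length c → s * b ≤ # (λ r → List.≡-dec Bool._≟_ (map (M r) c) u)) →
      ∃[ e ] e ⊆ c × length e ≡ t × b ^ s ≤ copiesOn (sort′ e)
    shattered⇒copies t {b} c lt 0<b lc uniq h =
      e , block-⊆ t j c , block-length t j c lc ,
      copiesOn-large R? large separated (sort-increasing (⊆-AllPairs (block-⊆ t j c) uniq)) match
      where
      N = s ^ s
      w : Fin s → List Bool
      w i = word t N (λ k → 𝒜 (Fin.finToFun k i)) c
      P? : ∀ i → Decidable (λ r → map (M r) c ≡ w i)
      P? i r = List.≡-dec Bool._≟_ (map (M r) c) (w i)
      open OrderedChoice (orderedChoice s b 0 P? 0<b (λ i → ≤-trans
        (h (w i) (trans (word-length t N c (λ k → lt (Fin.finToFun k i)) lc) (sym lc)))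
        (#-mono _ _ (λ r p → p , z≤n))))
      -- The permutation is known only now. On the block coded by `ρ`, the part in position `i`
      -- consists of rows with word `τ i`, which shows row `ρ (τ i) = i`.
      j : Fin N
      j = Fin.funToFin ρ
      e = block t j c
      match : ∀ i {x} → R i x → map (M x) (sort′ e) ≡ 𝒜 i
      match i {x} q = trans (word-correct t N c (λ k → lt (Fin.finToFun k (τ i))) lc (M x) j (R⊆P i q))
                            (cong 𝒜 (trans (Fin.finToFun-funToFin ρ (τ i)) (ρ∘τ i)))

  -- Row types from few columns

  _≟𝔹_ : (u w : List Bool) → Dec (u ≡ w)
  _≟𝔹_ = List.≡-dec Bool._≟_

  ∑𝔹-zero : {X : Set} (κ : List X) → ∑𝔹 κ (λ _ → 0) ≡ 0
  ∑𝔹-zero [] = refl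
  ∑𝔹-zero (_ ∷ κ) = cong₂ _+_ (∑𝔹-zero κ) (∑𝔹-zero κ)

  ∑𝔹-cong : {X : Set} (κ : List X) {f g : List Bool → ℕ} → (∀ w → f w ≡ g w) → ∑𝔹 κ f ≡ ∑𝔹 κ g
  ∑𝔹-cong [] h = h []
  ∑𝔹-cong (_ ∷ κ) h = cong₂ _+_ (∑𝔹-cong κ (h ∘ (false ∷_))) (∑𝔹-cong κ (h ∘ (true ∷_)))

  ∑𝔹-δ : {X : Set} (κ : List X) (f : X → Bool) (h : List Bool → ℕ) →
         ∑𝔹 κ (λ w → 𝟙 (map f κ ≟𝔹 w) * h w) ≡ h (map f κ)
  ∑𝔹-δ [] f h = *-identityˡ (h [])
  ∑𝔹-δ (y ∷ κ) f h with f y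
  ... | false = trans (cong₂ _+_
        (trans (∑𝔹-cong κ (λ w → cong (_* h (false ∷ w)) (𝟙-cong ((false ∷ map f κ) ≟𝔹 (false ∷ w)) (map f κ ≟𝔹 w)
                                    List.∷-injectiveʳ (cong (false ∷_)))))
               (∑𝔹-δ κ f (h ∘ (false ∷_))))
        (trans (∑𝔹-cong κ (λ w → cong (_* h (true ∷ w)) (𝟙-no ((false ∷ map f κ) ≟𝔹 (true ∷ w)) (λ ())))) (∑𝔹-zero κ)))
        (+-identityʳ _)
  ... | true = cong₂ _+_
        (trans (∑𝔹-cong κ (λ w → cong (_* h (false ∷ w)) (𝟙-no ((true ∷ map f κ) ≟𝔹 (false ∷ w)) (λ ())))) (∑𝔹-zero κ))
        (trans (∑𝔹-cong κ (λ w → cong (_* h (true ∷ w)) (𝟙-cong ((true ∷ map f κ) ≟𝔹 (true ∷ w)) (map f κ ≟𝔹 w)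
                                    List.∷-injectiveʳ (cong (true ∷_)))))
               (∑𝔹-δ κ f (h ∘ (true ∷_))))

  -- The number of words in `P` that precede `w` lexicographically; it numbers the large classes by
  -- an initial segment.
  rank : {X : Set} (κ : List X) {P : List Bool → Set} → Decidable P → List Bool → ℕ
  rank [] P? w = 0
  rank (_ ∷ κ) P? [] = 0
  rank (_ ∷ κ) P? (false ∷ w) = rank κ (P? ∘ (false ∷_)) w
  rank (_ ∷ κ) P? (true ∷ w) = ∑𝔹 κ (𝟙 ∘ P? ∘ (false ∷_)) + rank κ (P? ∘ (true ∷_)) w

  rank-< : {X : Set} (κ : List X) {P : List Bool → Set} (P? : Decidable P) {w : List Bool} →
           length w ≡ length κ → P w → rank κ P? w < ∑𝔹 κ (𝟙 ∘ P?)
  rank-< [] P? {[]} _ p = ≤-reflexive (sym (𝟙-yes (P? []) p))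
  rank-< (_ ∷ κ) P? {false ∷ w} e p = ≤-trans (rank-< κ (P? ∘ (false ∷_)) (suc-injective e) p) (m≤m+n _ _)
  rank-< (_ ∷ κ) P? {true ∷ w} e p = +-monoʳ-< _ (rank-< κ (P? ∘ (true ∷_)) (suc-injective e) p)

  rank-injective : {X : Set} (κ : List X) {P : List Bool → Set} (P? : Decidable P) {u w : List Bool} →
    length u ≡ length κ → length w ≡ length κ → P u → P w → rank κ P? u ≡ rank κ P? w → u ≡ w
  rank-injective [] P? {[]} {[]} _ _ _ _ _ = refl
  rank-injective (_ ∷ κ) P? {false ∷ u} {false ∷ w} e f p q h =
    cong (false ∷_) (rank-injective κ (P? ∘ (false ∷_)) (suc-injective e) (suc-injective f) p q h)
  rank-injective (_ ∷ κ) P? {true ∷ u} {true ∷ w} e f p q h =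
    cong (true ∷_) (rank-injective κ (P? ∘ (true ∷_)) (suc-injective e) (suc-injective f) p q (+-cancelˡ-≡ _ _ _ h))
  rank-injective (_ ∷ κ) P? {false ∷ u} {true ∷ w} e f p q h =
    contradiction (rank-< κ (P? ∘ (false ∷_)) (suc-injective e) p) (≤⇒≯ (subst (_ ≤_) (sym h) (m≤m+n _ _)))
  rank-injective (_ ∷ κ) P? {true ∷ u} {false ∷ w} e f p q h =
    contradiction (rank-< κ (P? ∘ (false ∷_)) (suc-injective f) q) (≤⇒≯ (subst (_ ≤_) h (m≤m+n _ _)))

  record Types {n : ℕ} (M : Fin n → Fin n → Bool) (K Γ : ℕ) : Set₁ where
    field
      label : Fin n → Fin K
      Atypical : Fin n → Fin n → Set
      atypical? : ∀ r c → Dec (Atypical r c)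
      agree : ∀ {r r′ c} → label r ≡ label r′ → ¬ Atypical r c → ¬ Atypical r′ c → M r c ≡ M r′ c
      few : Γ * sum (λ r → sum (λ c → 𝟙 (atypical? r c))) ≤ 3 * (n * n)

  map-agree : ∀ {A B : Set} {f g : A → B} {x κ} → x ∈ κ → map f κ ≡ map g κ → f x ≡ g x
  map-agree (here refl) e = List.∷-injectiveˡ e
  map-agree (there x∈κ) e = map-agree x∈κ (List.∷-injectiveʳ e)

  -- Classes with fewer than s * b′ rows are dead. Λ bounds the number of losses of
  -- a row, 1 / Γ is the fraction of errors, and 1 / Δ that of unsuitable columns.
  module RowTypes {n s′ : ℕ} (M : Fin n → Fin n → Bool) (𝒜 : Fin (suc s′) → List Bool)
                  (t′ b′ Λ Γ Δ : ℕ) where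

    s t d b Q : ℕ
    s = suc s′
    t = suc t′
    d = s ^ s * t
    b = s * b′
    Q = suc (Γ * Λ)

    open ListCopies M 𝒜

    -- What shattering would produce, and hence what the picked columns must avoid.
    Many : List (Fin n) → Set
    Many c = b′ ^ s ≤ copiesOn (sort′ c)

    open Heaviness Δ Many (λ c → b′ ^ s ℕ.≤? copiesOn (sort′ c)) public

    pattern-of : List (Fin n) → Fin n → List Bool
    pattern-of κ r = map (M r) κ

    opaque
      size : List (Fin n) → List Bool → ℕ
      size κ w = # (λ r → pattern-of κ r ≟𝔹 w)

      size-def : ∀ κ w → size κ w ≡ sum (λ r → 𝟙 (pattern-of κ r ≟𝔹 w))
      size-def κ w = #-def _

      size≤n : ∀ κ w → size κ w ≤ n
      size≤n κ w = #≤n _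

      size-[] : size [] [] ≡ n
      size-[] = #-all _ (λ _ → refl)

      size-mono : ∀ {κ κ′ w w′} → (∀ r → pattern-of κ r ≡ w → pattern-of κ′ r ≡ w′) → size κ w ≤ size κ′ w′
      size-mono = #-mono _ _

      size-split : ∀ κ c {x y} w → x ≢ y → size (c ∷ κ) (x ∷ w) + size (c ∷ κ) (y ∷ w) ≤ size κ w
      size-split κ c {x} {y} w x≢y = ≤-trans (≤-reflexive (trans (cong₂ _+_ (#-def _) (#-def _)) (sym (sum-+ _ _))))
        (≤-trans (sum-mono pointwise) (≤-reflexive (sym (#-def _))))
        where
        pointwise : ∀ r → 𝟙 (pattern-of (c ∷ κ) r ≟𝔹 (x ∷ w)) + 𝟙 (pattern-of (c ∷ κ) r ≟𝔹 (y ∷ w)) ≤ 𝟙 (pattern-of κ r ≟𝔹 w)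
        pointwise r with pattern-of (c ∷ κ) r ≟𝔹 (x ∷ w) | pattern-of (c ∷ κ) r ≟𝔹 (y ∷ w)
        ... | yes p | yes q = contradiction (List.∷-injectiveˡ (trans (sym p) q)) x≢y
        ... | yes p | no _ = ≤-reflexive (sym (𝟙-yes (pattern-of κ r ≟𝔹 w) (List.∷-injectiveʳ p)))
        ... | no _ | yes q = ≤-reflexive (sym (𝟙-yes (pattern-of κ r ≟𝔹 w) (List.∷-injectiveʳ q)))
        ... | no _ | no _ = z≤n

    Alive : List (Fin n) → Fin n → Set
    Alive κ r = b ≤ size κ (pattern-of κ r)

    -- Not strict: in an even split both halves are minorities, so two rows of one class outside the
    -- minority have the same value at `c`.
    Minority : List (Fin n) → Fin n → Fin n → Set
    Minority κ c r = 2 * size (c ∷ κ) (pattern-of (c ∷ κ) r) ≤ size κ (pattern-of κ r)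

    alive? : ∀ κ → Decidable (Alive κ)
    alive? κ r = b ℕ.≤? size κ (pattern-of κ r)

    err? : ∀ κ c → Decidable (λ r → Alive κ r × Minority κ c r)
    err? κ c r = alive? κ r ×-dec 2 * size (c ∷ κ) (pattern-of (c ∷ κ) r) ℕ.≤? size κ (pattern-of κ r)

    err : List (Fin n) → Fin n → ℕ
    err κ c = # (err? κ c)

    -- A loss counts only while the class is large; this is what bounds the number of losses by `Λ`.
    losses : List (Fin n) → Fin n → ℕ
    losses [] r = 0
    losses (c ∷ κ) r = losses κ r + 𝟙 (err? κ c r)

    size-∷ : ∀ κ c x w → size (c ∷ κ) (x ∷ w) ≤ size κ w
    size-∷ κ c x w = size-mono (λ r → List.∷-injectiveʳ)

    -- Each loss at least halves the class of r.
    losses-halve : ∀ κ r → size κ (pattern-of κ r) * 2 ^ losses κ r ≤ n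
    losses-halve [] r = ≤-trans (≤-reflexive (*-identityʳ _)) (size≤n [] [])
    losses-halve (c ∷ κ) r with err? κ c r
    ... | yes (_ , min) = begin
      S′ * 2 ^ (losses κ r + 1) ≡⟨ cong (λ z → S′ * 2 ^ z) (+-comm (losses κ r) 1) ⟩
      S′ * (2 * 2 ^ losses κ r) ≡⟨ lemma S′ (2 ^ losses κ r) ⟩
      2 * S′ * 2 ^ losses κ r ≤⟨ *-monoˡ-≤ (2 ^ losses κ r) min ⟩
      size κ (pattern-of κ r) * 2 ^ losses κ r ≤⟨ losses-halve κ r ⟩
      n ∎
      where
      S′ = size (c ∷ κ) (pattern-of (c ∷ κ) r)
      lemma : ∀ a b → a * (2 * b) ≡ 2 * a * b
      lemma = solve-∀
    ... | no _ = begin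
      S′ * 2 ^ (losses κ r + 0) ≡⟨ cong (λ z → S′ * 2 ^ z) (+-identityʳ (losses κ r)) ⟩
      S′ * 2 ^ losses κ r ≤⟨ *-monoˡ-≤ (2 ^ losses κ r) (size-∷ κ c _ _) ⟩
      size κ (pattern-of κ r) * 2 ^ losses κ r ≤⟨ losses-halve κ r ⟩
      n ∎
      where
      S′ = size (c ∷ κ) (pattern-of (c ∷ κ) r)

    sum-by-pattern : ∀ κ (h : List Bool → ℕ) → sum (λ r → h (pattern-of κ r)) ≡ ∑𝔹 κ (λ w → size κ w * h w)
    sum-by-pattern κ h = begin-equality
      sum (λ r → h (pattern-of κ r)) ≡⟨ sum-cong (λ r → ∑𝔹-δ κ (M r) h) ⟨
      sum (λ r → ∑𝔹 κ (λ w → 𝟙 (pattern-of κ r ≟𝔹 w) * h w)) ≡⟨ sum-∑𝔹 κ _ ⟩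
      ∑𝔹 κ (λ w → sum (λ r → 𝟙 (pattern-of κ r ≟𝔹 w) * h w)) ≡⟨ ∑𝔹-cong κ (λ w → trans (cong (_* h w) (size-def κ w)) (sum-* (h w) _)) ⟨
      ∑𝔹 κ (λ w → size κ w * h w) ∎

    dead : List (Fin n) → ℕ
    dead κ = # (λ r → size κ (pattern-of κ r) ℕ.<? b)

    aliveCount : List (Fin n) → ℕ
    aliveCount κ = ∑𝔹 κ (λ w → 𝟙 (b ℕ.≤? size κ w))

    -- A row dies only when its large class splits, and each of the two parts that becomes too small
    -- contributes at most `b` rows. Classes that are dead already bring no new dead rows.
    dead-step : ∀ κ c → dead (c ∷ κ) ≤ dead κ + 2 * b * aliveCount κ
    dead-step κ c = begin
      dead (c ∷ κ)
        ≡⟨ dead-by-pattern (c ∷ κ) ⟩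
      ∑𝔹 κ (λ w → small (c ∷ κ) (false ∷ w)) + ∑𝔹 κ (λ w → small (c ∷ κ) (true ∷ w))
        ≡⟨ ∑𝔹-+ κ _ _ ⟨
      ∑𝔹 κ (λ w → small (c ∷ κ) (false ∷ w) + small (c ∷ κ) (true ∷ w))
        ≤⟨ ∑𝔹-mono κ pointwise ⟩
      ∑𝔹 κ (λ w → small κ w + 2 * b * 𝟙 (b ℕ.≤? size κ w))
        ≡⟨ ∑𝔹-+ κ _ _ ⟩
      ∑𝔹 κ (small κ) + ∑𝔹 κ (λ w → 2 * b * 𝟙 (b ℕ.≤? size κ w))
        ≡⟨ cong₂ _+_ (sym (dead-by-pattern κ)) (∑𝔹-* κ (2 * b) _) ⟩
      dead κ + 2 * b * aliveCount κ ∎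
      where
      small : List (Fin n) → List Bool → ℕ
      small κ w = size κ w * 𝟙 (size κ w ℕ.<? b)
      dead-by-pattern : ∀ κ → dead κ ≡ ∑𝔹 κ (small κ)
      dead-by-pattern κ = trans (#-def _) (sum-by-pattern κ (λ w → 𝟙 (size κ w ℕ.<? b)))
      small≤b : ∀ κ w → small κ w ≤ b
      small≤b κ w with size κ w ℕ.<? b
      ... | yes p = ≤-trans (≤-reflexive (*-identityʳ _)) (<⇒≤ p)
      ... | no _ = ≤-trans (≤-reflexive (*-zeroʳ (size κ w))) z≤n
      small≤size : ∀ κ w → small κ w ≤ size κ w
      small≤size κ w = ≤-trans (*-monoʳ-≤ (size κ w) (𝟙≤1 (size κ w ℕ.<? b))) (≤-reflexive (*-identityʳ _))
      pointwise : ∀ w → small (c ∷ κ) (false ∷ w) + small (c ∷ κ) (true ∷ w) ≤ small κ w + 2 * b * 𝟙 (b ℕ.≤? size κ w)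
      pointwise w with b ℕ.≤? size κ w
      ... | yes _ = ≤-trans (+-mono-≤ (small≤b (c ∷ κ) (false ∷ w)) (small≤b (c ∷ κ) (true ∷ w)))
                      (≤-trans (≤-reflexive (lemma b)) (m≤n+m _ (small κ w)))
        where lemma : ∀ b → b + b ≡ 2 * b * 1
              lemma = solve-∀
      ... | no b≰ = ≤-trans (+-mono-≤ (small≤size (c ∷ κ) (false ∷ w)) (small≤size (c ∷ κ) (true ∷ w)))
                      (≤-trans (size-split κ c w (λ ()))
                        (≤-trans (≤-reflexive (trans (sym (*-identityʳ _))
                                    (cong (size κ w *_) (sym (𝟙-yes (size κ w ℕ.<? b) (≰⇒> b≰))))))
                                 (m≤m+n _ _)))

    -- The case `k = 0` of `light` is the aim: no `t` of the picked columns carry many copies. The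
    -- cases `k > 0` are what makes most further columns harmless.
    record Good (κ : List (Fin n)) : Set where
      field
        unique : AllPairs _≢_ κ
        light : ∀ {c k} → c ⊆ κ → length c + k ≡ t → ¬ Heavy k c

    open Good

    good-tail : ∀ {c κ} → Good (c ∷ κ) → Good κ
    good-tail g = record
      { unique = case unique g of λ { (_ ∷ u) → u }
      ; light = λ σ → light g (_ ∷ʳ σ) }

    module _ (0<b′ : 0 < b′) (b≤n : b ≤ n) (n<b2^Λ : n < b * 2 ^ Λ)
             (lengths : ∀ i → length (𝒜 i) ≡ t) where

      0<b : 0 < b
      0<b = <-≤-trans 0<b′ (m≤m+n b′ _)

      0<n : 0 < n
      0<n = <-≤-trans 0<b b≤n

      -- A further loss needs a class of at least `b` rows; if it had been halved `Λ` times before,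
      -- there would be at least `b * 2 ^ Λ` rows.
      losses≤Λ : ∀ κ r → losses κ r ≤ Λ
      losses≤Λ [] r = z≤n
      losses≤Λ (c ∷ κ) r with err? κ c r
      ... | no _ = ≤-trans (≤-reflexive (+-identityʳ _)) (losses≤Λ κ r)
      ... | yes (alive , _) = ≤-trans (≤-reflexive (+-comm _ 1)) (≰⇒> λ Λ≤ → <⇒≱ n<b2^Λ (begin
        b * 2 ^ Λ ≤⟨ *-mono-≤ alive (^-monoʳ-≤ 2 Λ≤) ⟩
        size κ (pattern-of κ r) * 2 ^ losses κ r ≤⟨ losses-halve κ r ⟩
        n ∎))

      -- `t` of the shattered columns would carry many copies, which `light` forbids at `k = 0`.
      unshattered : ∀ {κ} → Good κ → ¬ (∃[ c ] c ⊆ κ × length c ≡ d × Shatters (λ w → b ≤ size κ w) κ c)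
      unshattered {κ} g (c , σ , lc , sh) =
        let e , ε , le , many = shattered⇒copies t c lengths 0<b′ lc (⊆-AllPairs σ (unique g)) large
        in light g (Sublist.⊆-trans ε σ) (trans (+-identityʳ _) le) many
        where
        large : ∀ u → length u ≡ length c → s * b′ ≤ # (λ r → map (M r) c ≟𝔹 u)
        large u l = let w , b≤ , restrict = sh u l in
          ≤-trans b≤ (≤-trans (≤-reflexive (trans (size-def κ w) (sym (#-def _))))
                              (#-mono (λ r → pattern-of κ r ≟𝔹 w) _ (λ r → restrict (M r))))

      aliveCount≤ : ∀ {κ} → Good κ → aliveCount κ ≤ suc (length κ) ^ d
      aliveCount≤ {κ} g = ≮⇒≥ λ h → unshattered g
        (sauer κ d (λ w → b ℕ.≤? size κ w) (≤-<-trans (sauerBound≤ (length κ) d) h))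

      dead≤ : ∀ κ → Good κ → dead κ ≤ length κ * (2 * b * suc (length κ) ^ d)
      dead≤ [] g = ≤-reflexive (#-none _ (λ r p → <⇒≱ p (≤-trans b≤n (≤-reflexive (sym size-[])))))
      dead≤ (c ∷ κ) g = begin
        dead (c ∷ κ) ≤⟨ dead-step κ c ⟩
        dead κ + 2 * b * aliveCount κ ≤⟨ +-mono-≤ (dead≤ κ (good-tail g)) (*-monoʳ-≤ (2 * b) (aliveCount≤ (good-tail g))) ⟩
        q * (2 * b * suc q ^ d) + 2 * b * suc q ^ d ≡⟨ +-comm (q * (2 * b * suc q ^ d)) _ ⟩
        suc q * (2 * b * suc q ^ d) ≤⟨ *-monoʳ-≤ (suc q) (*-monoʳ-≤ (2 * b) (^-monoˡ-≤ d (n≤1+n (suc q)))) ⟩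
        suc q * (2 * b * suc (suc q) ^ d) ∎
        where q = length κ

      -- A column picked before splits no class, so it puts no row of a nonempty class into a
      -- minority.
      err⇒fresh : ∀ {κ c} → 0 < err κ c → All (c ≢_) κ
      err⇒fresh {κ} {c} 0<err with #-∃ (err? κ c) 0<err
      ... | r , alive , min = All.tabulate λ y∈κ c≡y → <⇒≱ 0<b (≤-trans alive (stuck (subst (_∈ κ) (sym c≡y) y∈κ)))
        where
        stuck : c ∈ κ → size κ (pattern-of κ r) ≤ 0
        stuck c∈κ = +-cancelˡ-≤ S S 0 (begin
          S + S ≡⟨ cong (S +_) (+-identityʳ S) ⟨
          2 * S ≤⟨ *-monoʳ-≤ 2 unsplit ⟩
          2 * size (c ∷ κ) (pattern-of (c ∷ κ) r) ≤⟨ min ⟩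
          S ≡⟨ +-identityʳ S ⟨
          S + 0 ∎)
          where
          S = size κ (pattern-of κ r)
          unsplit : S ≤ size (c ∷ κ) (pattern-of (c ∷ κ) r)
          unsplit = size-mono (λ r′ e → cong₂ _∷_ (map-agree c∈κ e) e)

      module Extension (κ : List (Fin n)) (g : Good κ) where

        -- Counts the subsequences of length at most `i` that `x` makes heavy. The missing length
        -- `k` grows as the subsequence shrinks, so their sum is constant, and `x` may be picked
        -- when `bad t′ 0 x` vanishes.
        bad : ℕ → ℕ → Fin n → ℕ
        bad zero k x = ∑⊆ 0 κ (λ c → 𝟙 (Heavy? k (x ∷ c)))
        bad (suc i) k x = ∑⊆ (suc i) κ (λ c → 𝟙 (Heavy? k (x ∷ c))) + bad i (suc k) x

        bad-term : ∀ i k₀ {k c x} → c ⊆ κ → length c + k ≡ i + k₀ → length c ≤ i → 𝟙 (Heavy? k (x ∷ c)) ≤ bad i k₀ x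
        bad-term zero k₀ {k} {[]} σ refl _ = ≤-refl
        bad-term (suc i) k₀ {k} {c} {x} σ e l = go (m≤n⇒m<n∨m≡n l)
          where
          go : length c < suc i ⊎ length c ≡ suc i → 𝟙 (Heavy? k (x ∷ c)) ≤ bad (suc i) k₀ x
          go (inj₁ l′) = ≤-trans (bad-term i (suc k₀) σ (trans e (sym (+-suc i k₀))) (s≤s⁻¹ l′)) (m≤n+m _ _)
          go (inj₂ l≡) = ≤-trans
            (subst₂ (λ j k₀ → 𝟙 (Heavy? k (x ∷ c)) ≤ ∑⊆ j κ (λ c → 𝟙 (Heavy? k₀ (x ∷ c)))) l≡
              (+-cancelˡ-≡ (suc i) k k₀ (trans (cong (_+ k) (sym l≡)) e))
              (∑⊆-term (λ c → 𝟙 (Heavy? k (x ∷ c))) σ)) (m≤m+n _ _)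

        -- No subsequence `c` of the right length is heavy itself, so fewer than `n / Δ` columns `x`
        -- make `x ∷ c` heavy; it remains to count the subsequences.
        level : ∀ i k → i + k ≡ t′ → Δ * sum (λ x → ∑⊆ i κ (λ c → 𝟙 (Heavy? k (x ∷ c)))) ≤ suc (length κ) ^ t′ * n
        level i k e = begin
          Δ * sum (λ x → ∑⊆ i κ (λ c → 𝟙 (Heavy? k (x ∷ c)))) ≡⟨ cong (Δ *_) (trans (sum-∑⊆ i κ _) (∑⊆-cong i κ (λ c → sym (#-def _)))) ⟩
          Δ * ∑⊆ i κ (λ c → # (λ x → Heavy? k (x ∷ c))) ≡⟨ ∑⊆-* i Δ κ _ ⟩
          ∑⊆ i κ (λ c → Δ * # (λ x → Heavy? k (x ∷ c))) ≤⟨ ∑⊆-bound i κ (λ {c} σ l → <⇒≤ (≰⇒> (light g {c} {suc k} σ (trans (cong (_+ suc k) l) (trans (+-suc i k) (cong suc e)))))) ⟩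
          suc (length κ) ^ i * n ≤⟨ *-monoˡ-≤ n (^-monoʳ-≤ (suc (length κ)) (≤-trans (m≤m+n i k) (≤-reflexive e))) ⟩
          suc (length κ) ^ t′ * n ∎

        bad-few : ∀ i k → i + k ≡ t′ → Δ * sum (bad i k) ≤ suc i * (suc (length κ) ^ t′ * n)
        bad-few zero k e = ≤-trans (level zero k e) (m≤m+n _ 0)
        bad-few (suc i) k e = begin
          Δ * sum (bad (suc i) k) ≡⟨ cong (Δ *_) (sum-+ _ _) ⟩
          Δ * (sum (λ x → ∑⊆ (suc i) κ (λ c → 𝟙 (Heavy? k (x ∷ c)))) + sum (bad i (suc k))) ≡⟨ *-distribˡ-+ Δ _ _ ⟩
          Δ * sum (λ x → ∑⊆ (suc i) κ (λ c → 𝟙 (Heavy? k (x ∷ c)))) + Δ * sum (bad i (suc k)) ≤⟨ +-mono-≤ (level (suc i) k e) (bad-few i (suc k) (trans (+-suc i k) e)) ⟩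
          suc (suc i) * (suc (length κ) ^ t′ * n) ∎

        -- One pigeonhole gives both properties. The sum of `n + Γ * n * bad t′ 0 x` over all `x` is
        -- at most `2 * (n * n)`, so some `Γ * err κ x` exceeds its term. As `Γ * err κ x` is at
        -- most `Γ * n`, not even one subsequence can be bad for this `x`.
        extend : Γ * (t * suc (length κ) ^ t′) ≤ Δ → 2 * (n * n) < Γ * sum (err κ) →
                 ∃[ x ] Good (x ∷ κ) × n < Γ * err κ x
        extend ΓΔ big with sum-< (λ x → n + Γ * n * bad t′ 0 x) (λ x → Γ * err κ x) (begin-strict
          sum (λ x → n + Γ * n * bad t′ 0 x) ≡⟨ sum-+ _ _ ⟩
          sum {n} (λ _ → n) + sum (λ x → Γ * n * bad t′ 0 x) ≡⟨ cong₂ _+_ (sum-const n n) (sym (*-sum (Γ * n) _)) ⟩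
          n * n + Γ * n * sum (bad t′ 0) ≡⟨ cong (n * n +_) (*-xy∙z≈y∙xz Γ n _) ⟩
          n * n + n * (Γ * sum (bad t′ 0)) ≤⟨ +-monoʳ-≤ (n * n) (*-monoʳ-≤ n Γbad≤n) ⟩
          n * n + n * n ≡⟨ cong (n * n +_) (+-identityʳ _) ⟨
          2 * (n * n) <⟨ big ⟩
          Γ * sum (err κ) ≡⟨ *-sum Γ _ ⟩
          sum (λ x → Γ * err κ x) ∎)
          where
          W = t * suc (length κ) ^ t′
          instance
            W≢0 : NonZero W
            W≢0 = m*n≢0 t (suc (length κ) ^ t′) {{_}} {{m^n≢0 (suc (length κ)) t′}}
          Γbad≤n : Γ * sum (bad t′ 0) ≤ n
          Γbad≤n = *-cancelˡ-≤ W (begin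
            W * (Γ * sum (bad t′ 0)) ≡⟨ *-assoc W Γ _ ⟨
            W * Γ * sum (bad t′ 0) ≡⟨ cong (_* sum (bad t′ 0)) (*-comm W Γ) ⟩
            Γ * W * sum (bad t′ 0) ≤⟨ *-monoˡ-≤ (sum (bad t′ 0)) ΓΔ ⟩
            Δ * sum (bad t′ 0) ≤⟨ bad-few t′ 0 (+-identityʳ t′) ⟩
            t * (suc (length κ) ^ t′ * n) ≡⟨ *-assoc t (suc (length κ) ^ t′) n ⟨
            W * n ∎)
        ... | x , lt = x , record { unique = err⇒fresh (*-pos Γ _ (<-≤-trans 0<n (<⇒≤ n<Γerr))) ∷ unique g ; light = light′ } , n<Γerr
          where
          n<Γerr : n < Γ * err κ x
          n<Γerr = ≤-<-trans (m≤m+n n _) lt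
          *-pos : ∀ a b → 0 < a * b → 0 < b
          *-pos a (suc b) _ = s≤s z≤n
          *-pos a zero h = contradiction (subst (0 <_) (*-zeroʳ a) h) (λ ())
          bad≡0 : bad t′ 0 x ≡ 0
          bad≡0 = n<1⇒n≡0 (≰⇒> λ 1≤bad → ≤⇒≯ (begin
            Γ * err κ x ≤⟨ *-monoʳ-≤ Γ (#≤n (err? κ x)) ⟩
            Γ * n ≡⟨ *-identityʳ (Γ * n) ⟨
            Γ * n * 1 ≤⟨ *-monoʳ-≤ (Γ * n) 1≤bad ⟩
            Γ * n * bad t′ 0 x ≤⟨ m≤n+m _ n ⟩
            n + Γ * n * bad t′ 0 x ∎) lt)
          light′ : ∀ {c k} → c ⊆ x ∷ κ → length c + k ≡ t → ¬ Heavy k c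
          light′ (.x ∷ʳ σ) e h = light g σ e h
          light′ {x ∷ c} {k} (refl ∷ σ) e h = contradiction
            (≤-trans (≤-reflexive (sym (𝟙-yes (Heavy? k (x ∷ c)) h)))
              (≤-trans (bad-term t′ 0 σ (trans (suc-injective e) (sym (+-identityʳ t′)))
                         (≤-trans (m≤m+n _ k) (≤-reflexive (suc-injective e))))
                       (≤-reflexive bad≡0)))
            λ ()

      -- `progress` bounds the number of steps: each picked column causes at least `n / Γ` losses,
      -- and a row suffers at most `Λ`.
      record Stage (κ : List (Fin n)) : Set where
        field
          good : Good κ
          progress : length κ * n ≤ Γ * sum (losses κ)

      stage-length : ∀ {κ} → Stage κ → length κ ≤ Γ * Λ
      stage-length {κ} st = *-cancelʳ-≤ (length κ) (Γ * Λ) n {{>-nonZero 0<n}} (begin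
        length κ * n ≤⟨ Stage.progress st ⟩
        Γ * sum (losses κ) ≤⟨ *-monoʳ-≤ Γ (sum-bound (losses≤Λ κ)) ⟩
        Γ * (n * Λ) ≡⟨ *-x∙yz≈xz∙y Γ n Λ ⟩
        Γ * Λ * n ∎)

      Stage-∷ : ∀ {κ x} → Stage κ → Good (x ∷ κ) → n < Γ * err κ x → Stage (x ∷ κ)
      Stage-∷ {κ} {x} st good lt = record { good = good ; progress = begin
        n + length κ * n ≤⟨ +-mono-≤ (<⇒≤ lt) (Stage.progress st) ⟩
        Γ * err κ x + Γ * sum (losses κ) ≡⟨ *-distribˡ-+ Γ _ _ ⟨
        Γ * (err κ x + sum (losses κ)) ≡⟨ cong (Γ *_) (+-comm (err κ x) _) ⟩
        Γ * (sum (losses κ) + err κ x) ≡⟨ cong (λ z → Γ * (sum (losses κ) + z)) (#-def (err? κ x)) ⟩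
        Γ * (sum (losses κ) + sum (λ r → 𝟙 (err? κ x r))) ≡⟨ cong (Γ *_) (sum-+ _ _) ⟨
        Γ * sum (losses (x ∷ κ)) ∎ }

      grow : Γ * (t * Q ^ t′) ≤ Δ → ∀ m {κ} → Stage κ → m + length κ ≡ Q →
             ∃[ κ ] Stage κ × Γ * sum (err κ) ≤ 2 * (n * n)
      -- Here `κ` would have `Q = suc (Γ * Λ)` columns, one more than the losses allow.
      grow ΓΔ zero st e = contradiction (stage-length st) (<⇒≱ (≤-reflexive (sym e)))
      grow ΓΔ (suc m) {κ} st e = go (≤-<-connex (Γ * sum (err κ)) (2 * (n * n)))
        where
        go : Γ * sum (err κ) ≤ 2 * (n * n) ⊎ 2 * (n * n) < Γ * sum (err κ) →
             ∃[ κ ] Stage κ × Γ * sum (err κ) ≤ 2 * (n * n)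
        go (inj₁ p) = κ , st , p
        go (inj₂ p) =
          let x , good′ , lt = Extension.extend κ (Stage.good st)
                                 (≤-trans (*-monoʳ-≤ Γ (*-monoʳ-≤ t (^-monoˡ-≤ t′ (s≤s (stage-length st))))) ΓΔ) p
          in grow ΓΔ m (Stage-∷ st good′ lt) (trans (+-suc m _) e)

      module FromStage {κ} (st : Stage κ) (errs : Γ * sum (err κ) ≤ 2 * (n * n)) {K}
                       (Γn : Γ * (Q * (2 * b * Q ^ d)) ≤ n) (Q≤K : Q ^ d ≤ K) (0<K : 0 < K) where

        open Stage st

        lenκ : suc (length κ) ≤ Q
        lenκ = s≤s (stage-length st)

        big? : Decidable (λ w → b ≤ size κ w)
        big? w = b ℕ.≤? size κ w

        rank<K : ∀ r → Alive κ r → rank κ big? (pattern-of κ r) < K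
        rank<K r al = <-≤-trans (rank-< κ big? (List.length-map (M r) κ) al)
          (≤-trans (aliveCount≤ good) (≤-trans (^-monoˡ-≤ d lenκ) Q≤K))

        label : Fin n → Fin K
        label r with alive? κ r
        ... | yes al = fromℕ< (rank<K r al)
        -- A default for dead rows, harmless because all their entries are atypical.
        ... | no _ = fromℕ< 0<K

        toℕ-label : ∀ r → Alive κ r → toℕ (label r) ≡ rank κ big? (pattern-of κ r)
        toℕ-label r al with alive? κ r
        ... | yes al′ = Fin.toℕ-fromℕ< (rank<K r al′)
        ... | no ¬al = contradiction al ¬al

        Atypical : Fin n → Fin n → Set
        Atypical r c = size κ (pattern-of κ r) < b ⊎ Minority κ c r

        atypical? : ∀ r c → Dec (Atypical r c)
        atypical? r c = size κ (pattern-of κ r) ℕ.<? b ⊎-dec (_ ℕ.≤? _)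

        -- Both values are strict majorities in the same class; two different ones would need more
        -- rows than the class has.
        agree : ∀ {r r′ c} → label r ≡ label r′ → ¬ Atypical r c → ¬ Atypical r′ c → M r c ≡ M r′ c
        agree {r} {r′} {c} e ¬x ¬x′ with M r c Bool.≟ M r′ c
        ... | yes p = p
        ... | no ¬p = contradiction (size-split κ c (pattern-of κ r) ¬p) (<⇒≱ (*-cancelˡ-< 2 _ _ (begin-strict
          2 * S ≡⟨ cong (S +_) (+-identityʳ S) ⟩
          S + S <⟨ +-mono-< (≰⇒> (¬x ∘ inj₂)) majority′ ⟩
          2 * S₁ + 2 * S₂ ≡⟨ *-distribˡ-+ 2 S₁ S₂ ⟨
          2 * (S₁ + S₂) ∎)))
          where
          al = ≮⇒≥ (¬x ∘ inj₁)
          al′ = ≮⇒≥ (¬x′ ∘ inj₁)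
          same : pattern-of κ r ≡ pattern-of κ r′
          same = rank-injective κ big? (List.length-map (M r) κ) (List.length-map (M r′) κ) al al′
            (trans (sym (toℕ-label r al)) (trans (cong toℕ e) (toℕ-label r′ al′)))
          S = size κ (pattern-of κ r)
          S₁ = size (c ∷ κ) (M r c ∷ pattern-of κ r)
          S₂ = size (c ∷ κ) (M r′ c ∷ pattern-of κ r)
          majority′ : S < 2 * S₂
          majority′ = subst (λ w → size κ w < 2 * size (c ∷ κ) (M r′ c ∷ w)) (sym same) (≰⇒> (¬x′ ∘ inj₂))

        dead-few : Γ * dead κ ≤ n
        dead-few = ≤-trans (*-monoʳ-≤ Γ (≤-trans (dead≤ κ good)
          (*-mono-≤ (≤-trans (n≤1+n _) lenκ) (*-monoʳ-≤ (2 * b) (^-monoˡ-≤ d lenκ))))) Γn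

        -- The dead rows contribute `n * n`, the minority entries of alive rows `2 * (n * n)`.
        few : Γ * sum (λ r → sum (λ c → 𝟙 (atypical? r c))) ≤ 3 * (n * n)
        few = begin
          Γ * sum (λ r → sum (λ c → 𝟙 (atypical? r c)))
            ≤⟨ *-monoʳ-≤ Γ (sum-mono (λ r → sum-mono (λ c → 𝟙-∪ (atypical? r c) (_ ℕ.<? b) (err? κ c r) (split r c)))) ⟩
          Γ * sum (λ r → sum {n} (λ c → 𝟙 (size κ (pattern-of κ r) ℕ.<? b) + 𝟙 (err? κ c r)))
            ≡⟨ cong (Γ *_) (trans (sum-cong (λ r → trans (sum-+ _ _) (cong (_+ sum (λ c → 𝟙 (err? κ c r))) (sum-const n _)))) (sum-+ _ _)) ⟩
          Γ * (sum (λ r → n * 𝟙 (size κ (pattern-of κ r) ℕ.<? b)) + sum (λ r → sum (λ c → 𝟙 (err? κ c r))))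
            ≡⟨ cong (Γ *_) (cong₂ _+_ (trans (sym (*-sum n _)) (cong (n *_) (sym (#-def _)))) (trans (sum-comm _) (sum-cong (λ c → sym (#-def (err? κ c)))))) ⟩
          Γ * (n * dead κ + sum (err κ))
            ≡⟨ lemma Γ n (dead κ) (sum (err κ)) ⟩
          n * (Γ * dead κ) + Γ * sum (err κ)
            ≤⟨ +-mono-≤ (*-monoʳ-≤ n dead-few) errs ⟩
          n * n + 2 * (n * n) ∎
          where
          lemma : ∀ a b c d → a * (b * c + d) ≡ b * (a * c) + a * d
          lemma = solve-∀
          split : ∀ r c → Atypical r c → size κ (pattern-of κ r) < b ⊎ (Alive κ r × Minority κ c r)
          split r c (inj₁ p) = inj₁ p
          split r c (inj₂ m) = [ inj₂ ∘ (_, m) , inj₁ ]′ (≤-<-connex b _)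

        types : Types M K Γ
        types = record { label = label ; Atypical = Atypical ; atypical? = atypical? ; agree = agree ; few = few }

      rowTypes : ∀ {K} → Γ * (t * Q ^ t′) ≤ Δ → Γ * (Q * (2 * b * Q ^ d)) ≤ n → Q ^ d ≤ K → 0 < K →
                 ¬ Heavy t [] → Types M K Γ
      rowTypes ΓΔ Γn Q≤K 0<K notHeavy =
        let κ , st , errs = grow ΓΔ Q {[]} (record { good = record { unique = [] ; light = light₀ } ; progress = z≤n }) (+-identityʳ Q)
        in FromStage.types st errs Γn Q≤K 0<K
        where
        light₀ : ∀ {c k} → c ⊆ [] → length c + k ≡ t → ¬ Heavy k c
        light₀ [] refl = notHeavy

  -- Block structure

  sum-by-label : ∀ {n k} (α : Fin n → Fin k) (h : Fin k → ℕ) →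
                 sum (λ r → h (α r)) ≡ sum (λ P → # (λ r → α r Fin.≟ P) * h P)
  sum-by-label α h = trans (sum-fibres α (h ∘ α)) (sum-cong λ P → trans
    (sum-cong (λ r → same P r))
    (trans (sym (sum-* (h P) _)) (cong (_* h P) (sym (#-def _)))))
    where
    same : ∀ P r → 𝟙 (α r Fin.≟ P) * h (α r) ≡ 𝟙 (α r Fin.≟ P) * h P
    same P r with α r Fin.≟ P
    ... | yes refl = refl
    ... | no _ = refl

  inBlock : ∀ {n k l} (α : Fin n → Fin k) (β : Fin n → Fin l) → (Fin n → Fin n → ℕ) → Fin k → Fin l → ℕ
  inBlock α β f P Q = sum (λ r → 𝟙 (α r Fin.≟ P) * sum (λ c → 𝟙 (β c Fin.≟ Q) * f r c))

  sum-inBlock : ∀ {n k l} (α : Fin n → Fin k) (β : Fin n → Fin l) (f : Fin n → Fin n → ℕ) →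
                sum (λ P → sum (λ Q → inBlock α β f P Q)) ≡ sum (λ r → sum (λ c → f r c))
  sum-inBlock α β f = begin-equality
    sum (λ P → sum (λ Q → inBlock α β f P Q)) ≡⟨ sum-comm _ ⟩
    sum (λ Q → sum (λ P → inBlock α β f P Q)) ≡⟨ sum-cong (λ Q → sym (sum-fibres α _)) ⟩
    sum (λ Q → sum (λ r → sum (λ c → 𝟙 (β c Fin.≟ Q) * f r c))) ≡⟨ sum-comm _ ⟩
    sum (λ r → sum (λ Q → sum (λ c → 𝟙 (β c Fin.≟ Q) * f r c))) ≡⟨ sum-cong (λ r → sym (sum-fibres β (f r))) ⟩
    sum (λ r → sum (λ c → f r c)) ∎

  below-average : ∀ {n} {P : Fin n → Set} (P? : Decidable P) (g : Fin n → ℕ) → ∃ P →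
                  ∃[ r ] P r × # P? * g r ≤ sum (λ x → 𝟙 (P? x) * g x)
  below-average {n} {P} P? g (r₀ , p₀) with Fin.any? (λ r → P? r ×-dec # P? * g r ℕ.≤? sum (λ x → 𝟙 (P? x) * g x))
  ... | yes found = found
  ... | no none = contradiction (*-cancelˡ-≤ (# P?) {{>-nonZero (#-pos P? p₀)}} (begin
    # P? * suc S ≡⟨ cong (_* suc S) (#-def P?) ⟩
    sum (λ x → 𝟙 (P? x)) * suc S ≡⟨ sum-* (suc S) _ ⟩
    sum (λ x → 𝟙 (P? x) * suc S) ≤⟨ sum-mono (λ x → 𝟙-*-mono (P? x) (λ p → ≰⇒> (λ q → none (x , p , q)))) ⟩
    sum (λ x → 𝟙 (P? x) * (# P? * g x)) ≡⟨ sum-cong (λ x → *-x∙yz≈y∙xz (𝟙 (P? x)) (# P?) (g x)) ⟩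
    sum (λ x → # P? * (𝟙 (P? x) * g x)) ≡⟨ *-sum (# P?) _ ⟨
    # P? * S ∎)) 1+n≰n
    where
    S = sum (λ x → 𝟙 (P? x) * g x)

  record Blocks {n : ℕ} (M : Fin n → Fin n → Bool) (K Γ : ℕ) : Set₁ where
    field
      rowLabel colLabel : Fin n → Fin K
      Error : Fin n → Fin n → Set
      error? : ∀ r c → Dec (Error r c)
      agree : ∀ {r r′ c c′} → rowLabel r ≡ rowLabel r′ → colLabel c ≡ colLabel c′ →
               ¬ Error r c → ¬ Error r′ c′ → M r c ≡ M r′ c′
      few : Γ * sum (λ r → sum (λ c → 𝟙 (error? r c))) ≤ 12 * (n * n)

  module Combine {n K Γ : ℕ} (M : Fin n → Fin n → Bool)
                 (rows : Types M K Γ) (cols : Types (λ c r → M r c) K Γ) where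

    private
      module R = Types rows
      module C = Types cols

    Bad : Fin n → Fin n → Set
    Bad r c = R.Atypical r c ⊎ C.Atypical c r

    bad? : ∀ r c → Dec (Bad r c)
    bad? r c = R.atypical? r c ⊎-dec C.atypical? c r

    onRow : Fin K → Fin n → ℕ
    onRow Q r = sum (λ c → 𝟙 (C.label c Fin.≟ Q) * 𝟙 (bad? r c))

    bads : Fin K → Fin K → ℕ
    bads = inBlock R.label C.label (λ r c → 𝟙 (bad? r c))

    class : Fin K → ℕ
    class P = # (λ r → R.label r Fin.≟ P)

    -- Good entries of one row of a block agree, and so do good entries of one
    -- column. Hence off the bad entries, and off the columns in which the pivot row
    -- is bad, every entry of the block equals the good entries of the pivot row.
    IsPivot : Fin K → Fin K → Fin n → Set
    IsPivot P Q r = R.label r ≡ P × class P * onRow Q r ≤ bads P Q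

    pivot? : ∀ P Q → Dec (∃ (IsPivot P Q))
    pivot? P Q = Fin.any? λ r → R.label r Fin.≟ P ×-dec class P * onRow Q r ℕ.≤? bads P Q

    PivotBad : ∀ {P Q} → Dec (∃ (IsPivot P Q)) → Fin n → Set
    PivotBad (yes (r , _)) c = Bad r c
    -- By averaging, a pivot is missing only for an empty class of rows, so this case never turns an
    -- entry into an error.
    PivotBad (no _) c = ⊤

    pivotBad? : ∀ {P Q} (d : Dec (∃ (IsPivot P Q))) c → Dec (PivotBad d c)
    pivotBad? (yes (r , _)) c = bad? r c
    pivotBad? (no _) c = yes tt

    Error : Fin n → Fin n → Set
    Error r c = Bad r c ⊎ PivotBad (pivot? (R.label r) (C.label c)) c

    error? : ∀ r c → Dec (Error r c)
    error? r c = bad? r c ⊎-dec pivotBad? (pivot? (R.label r) (C.label c)) c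

    agree-via-pivot : ∀ {P Q r r′ c c′} (d : Dec (∃ (IsPivot P Q))) →
      R.label r ≡ P → R.label r′ ≡ P → C.label c ≡ C.label c′ → ¬ Bad r c → ¬ Bad r′ c′ →
      ¬ PivotBad d c → ¬ PivotBad d c′ → M r c ≡ M r′ c′
    agree-via-pivot (no _) _ _ _ _ _ ¬p _ = contradiction tt ¬p
    agree-via-pivot {r = r} {r′} {c} {c′} (yes (r₀ , e₀ , _)) e e′ f ¬b ¬b′ ¬p ¬p′ =
      trans (R.agree (trans e (sym e₀)) (¬b ∘ inj₁) (¬p ∘ inj₁))
        (trans (C.agree f (¬p ∘ inj₂) (¬p′ ∘ inj₂)) (R.agree (trans e₀ (sym e′)) (¬p′ ∘ inj₁) (¬b′ ∘ inj₁)))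

    agree : ∀ {r r′ c c′} → R.label r ≡ R.label r′ → C.label c ≡ C.label c′ →
            ¬ Error r c → ¬ Error r′ c′ → M r c ≡ M r′ c′
    agree {r} {r′} {c} {c′} e f ¬x ¬x′ = agree-via-pivot (pivot? (R.label r) (C.label c)) refl (sym e) f
      (¬x ∘ inj₁) (¬x′ ∘ inj₁) (¬x ∘ inj₂)
      (subst₂ (λ P Q → ¬ PivotBad (pivot? P Q) c′) (sym e) (sym f) (¬x′ ∘ inj₂))

    pivotOnRow : ∀ {P Q} → Dec (∃ (IsPivot P Q)) → ℕ
    pivotOnRow {P} {Q} d = sum (λ c → 𝟙 (C.label c Fin.≟ Q) * 𝟙 (pivotBad? d c))

    pivotOnRow≤ : ∀ {P Q} (d : Dec (∃ (IsPivot P Q))) → class P * pivotOnRow d ≤ bads P Q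
    pivotOnRow≤ (yes (r , _ , q)) = q
    pivotOnRow≤ {P} {Q} (no none) = ≤-trans (≤-reflexive (cong (_* pivotOnRow {P} {Q} (no none))
      (#-none (λ r → R.label r Fin.≟ P) (λ r e → none (below-average (λ r → R.label r Fin.≟ P) (onRow Q) (r , e)))))) z≤n

    -- The pivot row has at most the average number of bad entries in its block, so repeating it
    -- over all rows of the class yields no more than the bad entries of the block.
    pivotBads : sum (λ r → sum (λ c → 𝟙 (pivotBad? (pivot? (R.label r) (C.label c)) c))) ≤ sum (λ r → sum (λ c → 𝟙 (bad? r c)))
    pivotBads = begin
      sum (λ r → sum (λ c → 𝟙 (pivotBad? (pivot? (R.label r) (C.label c)) c)))
        ≡⟨ sum-cong (λ r → sum-fibres C.label _) ⟩
      sum (λ r → sum (λ Q → sum (λ c → 𝟙 (C.label c Fin.≟ Q) * 𝟙 (pivotBad? (pivot? (R.label r) (C.label c)) c))))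
        ≡⟨ sum-cong (λ r → sum-cong (λ Q → sum-cong (λ c → fix r Q c))) ⟩
      sum (λ r → sum (λ Q → pivotOnRow (pivot? (R.label r) Q)))
        ≡⟨ sum-by-label R.label (λ P → sum (λ Q → pivotOnRow (pivot? P Q))) ⟩
      sum (λ P → class P * sum (λ Q → pivotOnRow (pivot? P Q)))
        ≡⟨ sum-cong (λ P → *-sum (class P) _) ⟩
      sum (λ P → sum (λ Q → class P * pivotOnRow (pivot? P Q)))
        ≤⟨ sum-mono (λ P → sum-mono (λ Q → pivotOnRow≤ (pivot? P Q))) ⟩
      sum (λ P → sum (λ Q → bads P Q))
        ≡⟨ sum-inBlock R.label C.label (λ r c → 𝟙 (bad? r c)) ⟩
      sum (λ r → sum (λ c → 𝟙 (bad? r c))) ∎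
      where
      fix : ∀ r Q c → 𝟙 (C.label c Fin.≟ Q) * 𝟙 (pivotBad? (pivot? (R.label r) (C.label c)) c) ≡
                      𝟙 (C.label c Fin.≟ Q) * 𝟙 (pivotBad? (pivot? (R.label r) Q) c)
      fix r Q c = go (C.label c Fin.≟ Q)
        where
        go : (d : Dec (C.label c ≡ Q)) → 𝟙 d * 𝟙 (pivotBad? (pivot? (R.label r) (C.label c)) c) ≡
                𝟙 d * 𝟙 (pivotBad? (pivot? (R.label r) Q) c)
        go (yes refl) = refl
        go (no _) = refl

    -- The pivots at most double the bad entries, and row and column types contribute `3 * (n * n)`
    -- of these each.
    few : Γ * sum (λ r → sum (λ c → 𝟙 (error? r c))) ≤ 12 * (n * n)
    few = begin
      Γ * sum (λ r → sum (λ c → 𝟙 (error? r c)))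
        ≤⟨ *-monoʳ-≤ Γ (sum-mono (λ r → sum-mono (λ c → 𝟙-∪ (error? r c) (bad? r c) (pivotBad? (pivot? (R.label r) (C.label c)) c) id))) ⟩
      Γ * sum (λ r → sum (λ c → 𝟙 (bad? r c) + 𝟙 (pivotBad? (pivot? (R.label r) (C.label c)) c)))
        ≡⟨ cong (Γ *_) (trans (sum-cong (λ r → sum-+ _ _)) (sum-+ _ _)) ⟩
      Γ * (S + sum (λ r → sum (λ c → 𝟙 (pivotBad? (pivot? (R.label r) (C.label c)) c))))
        ≤⟨ *-monoʳ-≤ Γ (+-monoʳ-≤ S pivotBads) ⟩
      Γ * (S + S)
        ≡⟨ lemma Γ S ⟩
      2 * (Γ * S)
        ≤⟨ *-monoʳ-≤ 2 (*-monoʳ-≤ Γ (sum-mono (λ r → sum-mono (λ c → 𝟙-∪ (bad? r c) (R.atypical? r c) (C.atypical? c r) id)))) ⟩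
      2 * (Γ * sum (λ r → sum (λ c → 𝟙 (R.atypical? r c) + 𝟙 (C.atypical? c r))))
        ≡⟨ cong (λ z → 2 * (Γ * z)) (trans (sum-cong (λ r → sum-+ _ _)) (trans (sum-+ _ _) (cong (X +_) (sum-comm _)))) ⟩
      2 * (Γ * (X + Y))
        ≡⟨ cong (2 *_) (*-distribˡ-+ Γ X Y) ⟩
      2 * (Γ * X + Γ * Y)
        ≤⟨ *-monoʳ-≤ 2 (+-mono-≤ R.few C.few) ⟩
      2 * (3 * (n * n) + 3 * (n * n))
        ≡⟨ lemma′ (n * n) ⟩
      12 * (n * n) ∎
      where
      S = sum (λ r → sum (λ c → 𝟙 (bad? r c)))
      X = sum (λ r → sum (λ c → 𝟙 (R.atypical? r c)))
      Y = sum (λ c → sum (λ r → 𝟙 (C.atypical? c r)))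
      lemma : ∀ a b → a * (b + b) ≡ 2 * (a * b)
      lemma = solve-∀
      lemma′ : ∀ a → 2 * (3 * a + 3 * a) ≡ 12 * a
      lemma′ = solve-∀

    blocks : Blocks M K Γ
    blocks = record { rowLabel = R.label ; colLabel = C.label ; Error = Error ; error? = error? ; agree = agree ; few = few }

  module Density {n k l : ℕ} (α : Fin n → Fin k) (β : Fin n → Fin l)
                 {E : Fin n → Fin n → Set} (E? : ∀ r c → Dec (E r c)) (den : ℕ) where

    area : Fin k → Fin l → ℕ
    area P Q = # (λ r → α r Fin.≟ P) * # (λ c → β c Fin.≟ Q)

    errors : Fin k → Fin l → ℕ
    errors = inBlock α β (λ r c → 𝟙 (E? r c))

    dense? : ∀ r c → Dec (area (α r) (β c) < den * errors (α r) (β c))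
    dense? r c = area (α r) (β c) ℕ.<? den * errors (α r) (β c)

    -- The area of a dense cell is paid for by `den` times its own errors.
    dense-few : sum (λ r → sum (λ c → 𝟙 (dense? r c))) ≤ den * sum (λ r → sum (λ c → 𝟙 (E? r c)))
    dense-few = begin
      sum (λ r → sum (λ c → δ (α r) (β c))) ≡⟨ sum-cong (λ r → sum-by-label β (δ (α r))) ⟩
      sum (λ r → sum (λ Q → # (λ c → β c Fin.≟ Q) * δ (α r) Q)) ≡⟨ sum-by-label α (λ P → sum (λ Q → # (λ c → β c Fin.≟ Q) * δ P Q)) ⟩
      sum (λ P → # (λ r → α r Fin.≟ P) * sum (λ Q → # (λ c → β c Fin.≟ Q) * δ P Q)) ≡⟨ sum-cong (λ P → *-sum (# (λ r → α r Fin.≟ P)) _) ⟩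
      sum (λ P → sum (λ Q → # (λ r → α r Fin.≟ P) * (# (λ c → β c Fin.≟ Q) * δ P Q))) ≤⟨ sum-mono (λ P → sum-mono (λ Q → bound P Q)) ⟩
      sum (λ P → sum (λ Q → den * errors P Q)) ≡⟨ sum-cong (λ P → *-sum den _) ⟨
      sum (λ P → den * sum (λ Q → errors P Q)) ≡⟨ *-sum den _ ⟨
      den * sum (λ P → sum (λ Q → errors P Q)) ≡⟨ cong (den *_) (sum-inBlock α β _) ⟩
      den * sum (λ r → sum (λ c → 𝟙 (E? r c))) ∎
      where
      δ : Fin k → Fin l → ℕ
      δ P Q = 𝟙 (area P Q ℕ.<? den * errors P Q)
      bound : ∀ P Q → # (λ r → α r Fin.≟ P) * (# (λ c → β c Fin.≟ Q) * δ P Q) ≤ den * errors P Q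
      bound P Q = go (area P Q ℕ.<? den * errors P Q)
        where
        go : (d : Dec (area P Q < den * errors P Q)) → # (λ r → α r Fin.≟ P) * (# (λ c → β c Fin.≟ Q) * 𝟙 d) ≤ den * errors P Q
        go (yes p) = ≤-trans (≤-reflexive (cong (# (λ r → α r Fin.≟ P) *_) (*-identityʳ _))) (<⇒≤ p)
        go (no _) = ≤-trans (≤-reflexive (trans (cong (# (λ r → α r Fin.≟ P) *_) (*-zeroʳ (# (λ c → β c Fin.≟ Q)))) (*-zeroʳ (# (λ r → α r Fin.≟ P))))) z≤n

  -- The tree of row intervals

  sum-except : ∀ {k} (j : Fin (suc k)) {f : Fin (suc k) → ℕ} {X} → f j ≡ 0 → (∀ i → f i ≤ X) → sum f ≤ k * X
  sum-except {k} j {f} {X} fj≡0 f≤X = +-cancelʳ-≤ X _ _ (begin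
    sum f + X ≡⟨ cong (sum f +_) (sum-δ j (λ _ → X)) ⟨
    sum f + sum (λ i → 𝟙 (j Fin.≟ i) * X) ≡⟨ sum-+ f _ ⟨
    sum (λ i → f i + 𝟙 (j Fin.≟ i) * X) ≤⟨ sum-bound bound ⟩
    suc k * X ≡⟨ +-comm X (k * X) ⟩
    k * X + X ∎)
    where
    bound : ∀ i → f i + 𝟙 (j Fin.≟ i) * X ≤ X
    bound i with j Fin.≟ i
    ... | yes refl = ≤-reflexive (trans (cong (_+ 1 * X) fj≡0) (*-identityˡ X))
    ... | no _ = ≤-trans (≤-reflexive (+-identityʳ (f i))) (f≤X i)

  quotient-of-child : ∀ B′ i (j : Fin (suc B′)) → (i * suc B′ + toℕ j) / suc B′ ≡ i
  quotient-of-child B′ i j = begin-equality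
    (i * B + toℕ j) / B ≡⟨ cong (_/ B) (+-comm (i * B) (toℕ j)) ⟩
    (toℕ j + i * B) / B ≡⟨ +-distrib-/-∣ʳ (toℕ j) (divides i refl) ⟩
    toℕ j / B + i * B / B ≡⟨ cong₂ _+_ (m<n⇒m/n≡0 (Fin.toℕ<n j)) (m*n/n≡m i B) ⟩
    i ∎
    where B = suc B′

  children-indicator : ∀ B′ x i → 𝟙 (x / suc B′ ℕ.≟ i) ≡ sum (λ (j : Fin (suc B′)) → 𝟙 (x ℕ.≟ i * suc B′ + toℕ j))
  children-indicator B′ x i with x / suc B′ ℕ.≟ i
  ... | yes refl = sym (trans
    (sum-cong (λ j → trans (𝟙-cong (x ℕ.≟ x / B * B + toℕ j) (j₀ Fin.≟ j) (to j) (from j)) (sym (*-identityʳ _))))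
    (sum-δ j₀ (λ _ → 1)))
    where
    B = suc B′
    j₀ : Fin B
    j₀ = fromℕ< (m%n<n x B)
    decompose : x ≡ x / B * B + x % B
    decompose = trans (m≡m%n+[m/n]*n x B) (+-comm (x % B) _)
    to : ∀ j → x ≡ x / B * B + toℕ j → j₀ ≡ j
    to j e = Fin.toℕ-injective (trans (Fin.toℕ-fromℕ< (m%n<n x B)) (+-cancelˡ-≡ (x / B * B) _ _ (trans (sym decompose) e)))
    from : ∀ j → j₀ ≡ j → x ≡ x / B * B + toℕ j
    from j e = trans decompose (cong (x / B * B +_) (trans (sym (Fin.toℕ-fromℕ< (m%n<n x B))) (cong toℕ e)))
  ... | no ne = sym (trans (sum-cong (λ j → 𝟙-no (x ℕ.≟ i * suc B′ + toℕ j)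
          (λ e → ne (trans (cong (_/ suc B′) e) (quotient-of-child B′ i j)))))
        (trans (sum-const (suc B′) 0) (*-zeroʳ (suc B′))))

  module Tree {n K : ℕ} (B′ : ℕ) (a : Fin n → Fin K) where

    B : ℕ
    B = suc B′

    -- The number of the interval of height `h` that contains `r`: height `0` means single rows, and
    -- each step merges `B` neighbours.
    idx : ℕ → Fin n → ℕ
    idx zero r = toℕ r
    idx (suc h) r = idx h r / B

    idx≤toℕ : ∀ h r → idx h r ≤ toℕ r
    idx≤toℕ zero r = ≤-refl
    idx≤toℕ (suc h) r = ≤-trans (m/n≤m (idx h r) B) (idx≤toℕ h r)

    idx-mono : ∀ h {r r′} → toℕ r ≤ toℕ r′ → idx h r ≤ idx h r′
    idx-mono zero p = p
    idx-mono (suc h) p = /-monoˡ-≤ B (idx-mono h p)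

    idx-< : ∀ h k r → toℕ r < B ^ (k + h) → idx h r < B ^ k
    idx-< zero k r p = subst (λ z → toℕ r < B ^ z) (+-identityʳ k) p
    idx-< (suc h) k r p = m<n*o⇒m/o<n (subst (idx h r <_) (*-comm B (B ^ k))
      (idx-< h (suc k) r (subst (λ z → toℕ r < B ^ z) (+-suc k h) p)))

    node? : ∀ h P i r → Dec (a r ≡ P × idx h r ≡ i)
    node? h P i r = a r Fin.≟ P ×-dec idx h r ℕ.≟ i

    opaque
      weight : ℕ → Fin K → ℕ → (Fin n → ℕ) → ℕ
      weight h P i ψ = sum (λ r → 𝟙 (node? h P i r) * ψ r)

      weight-mono : ∀ h P i {ψ φ} → (∀ r → a r ≡ P → idx h r ≡ i → ψ r ≤ φ r) → weight h P i ψ ≤ weight h P i φ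
      weight-mono h P i k = sum-mono (λ r → 𝟙-*-mono (node? h P i r) (λ (e , f) → k r e f))

      weight-+ : ∀ h P i ψ φ → weight h P i (λ r → ψ r + φ r) ≡ weight h P i ψ + weight h P i φ
      weight-+ h P i ψ φ = trans (sum-cong (λ r → *-distribˡ-+ (𝟙 (node? h P i r)) (ψ r) (φ r))) (sum-+ _ _)

      weight-* : ∀ h P i x ψ → weight h P i (λ r → ψ r * x) ≡ weight h P i ψ * x
      weight-* h P i x ψ = trans (sum-cong (λ r → sym (*-assoc (𝟙 (node? h P i r)) (ψ r) x))) (sym (sum-* x _))

      weight-children : ∀ h P i ψ → weight (suc h) P i ψ ≡ sum (λ (j : Fin B) → weight h P (i * B + toℕ j) ψ)
      weight-children h P i ψ = trans (sum-cong pointwise) (sum-comm (λ r j → 𝟙 (node? h P (i * B + toℕ j) r) * ψ r))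
        where
        pointwise : ∀ r → 𝟙 (node? (suc h) P i r) * ψ r ≡ sum (λ (j : Fin B) → 𝟙 (node? h P (i * B + toℕ j) r) * ψ r)
        pointwise r = trans (cong (_* ψ r) (begin-equality
          𝟙 (node? (suc h) P i r) ≡⟨ 𝟙-× (a r Fin.≟ P) _ ⟩
          𝟙 (a r Fin.≟ P) * 𝟙 (idx h r / B ℕ.≟ i) ≡⟨ cong (𝟙 (a r Fin.≟ P) *_) (children-indicator B′ (idx h r) i) ⟩
          𝟙 (a r Fin.≟ P) * sum (λ (j : Fin B) → 𝟙 (idx h r ℕ.≟ i * B + toℕ j)) ≡⟨ *-sum (𝟙 (a r Fin.≟ P)) _ ⟩
          sum (λ (j : Fin B) → 𝟙 (a r Fin.≟ P) * 𝟙 (idx h r ℕ.≟ i * B + toℕ j)) ≡⟨ sum-cong (λ j → 𝟙-× (a r Fin.≟ P) _) ⟨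
          sum (λ (j : Fin B) → 𝟙 (node? h P (i * B + toℕ j) r)) ∎)) (sum-* (ψ r) _)

      weight-# : ∀ h P i → weight h P i (λ _ → 1) ≡ # (node? h P i)
      weight-# h P i = trans (sum-cong (λ r → *-identityʳ _)) (sym (#-def _))

      weight-roots : ∀ h ψ → (∀ r → idx h r ≡ 0) → sum ψ ≡ sum (λ P → weight h P 0 ψ)
      weight-roots h ψ e = trans (sum-fibres a ψ) (sum-cong (λ P → sum-cong (λ r → cong (_* ψ r)
        (𝟙-cong (a r Fin.≟ P) (node? h P 0 r) (_, e r) proj₁))))

    N : ℕ → Fin K → ℕ → ℕ
    N h P i = weight h P i (λ _ → 1)

    weight≤N : ∀ h P i {ψ} → (∀ r → a r ≡ P → idx h r ≡ i → ψ r ≤ 1) → weight h P i ψ ≤ N h P i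
    weight≤N h P i = weight-mono h P i

    weight-zero : ∀ h P i {ψ} → (∀ r → a r ≡ P → idx h r ≡ i → ψ r ≡ 0) → weight h P i ψ ≡ 0
    weight-zero h P i {ψ} z = n≤0⇒n≡0 (begin
      weight h P i ψ ≤⟨ weight-mono h P i (λ r e f → ≤-reflexive (z r e f)) ⟩
      weight h P i (λ _ → 0) ≡⟨ weight-* h P i 0 (λ _ → 0) ⟩
      weight h P i (λ _ → 0) * 0 ≡⟨ *-zeroʳ (weight h P i (λ _ → 0)) ⟩
      0 ∎)

    N≤width : ∀ h P i → N h P i ≤ B ^ h
    N≤width zero P i = ≤-trans (≤-reflexive (weight-# 0 P i)) (≤-trans (#-mono (node? 0 P i) (λ r → toℕ r ℕ.≟ i) (λ r → proj₂)) (single n i))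
    N≤width (suc h) P i = ≤-trans (≤-reflexive (weight-children h P i _)) (sum-bound (λ j → N≤width h P (i * B + toℕ j)))

    module Levels (κ k h₀ : ℕ) where

      -- The type of r is much rarer in the interval of r than in its parent.
      Light : ℕ → Fin n → Set
      Light h r = κ * N h (a r) (idx h r) < N (suc h) (a r) (idx (suc h) r)

      light? : ∀ h r → Dec (Light h r)
      light? h r = κ * N h (a r) (idx h r) ℕ.<? N (suc h) (a r) (idx (suc h) r)

      -- Unlike `Light`, a property of the node: some child, not necessarily the one containing a
      -- given row, has almost nothing of type `P`. At a node that is not bad every child offers
      -- replacements.
      Bad : ℕ → Fin K → ℕ → Set
      Bad h P i = ∃[ j ] κ * N h P (i * B + toℕ {B} j) < N (suc h) P i

      bad? : ∀ h P i → Dec (Bad h P i)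
      bad? h P i = Fin.any? λ j → κ * N h P (i * B + toℕ {B} j) ℕ.<? N (suc h) P i

      badAt? : ∀ h r → Dec (Bad h (a r) (idx (suc h) r))
      badAt? h r = bad? h (a r) (idx (suc h) r)

      -- Both count over the `d` heights starting at `h₀`.
      lights bads : ℕ → Fin n → ℕ
      lights zero r = 0
      lights (suc d) r = 𝟙 (light? (d + h₀) r) + lights d r
      bads zero r = 0
      bads (suc d) r = 𝟙 (badAt? (d + h₀) r) + bads d r

      at-child : ∀ h i j r → idx h r ≡ i * B + toℕ {B} j → idx (suc h) r ≡ i
      at-child h i j r e = trans (cong (_/ B) e) (quotient-of-child B′ i j)

      light-child : ∀ h P i (j : Fin B) r → a r ≡ P → idx h r ≡ i * B + toℕ j →
                    Light h r → κ * N h P (i * B + toℕ j) < N (suc h) P i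
      light-child h P i j r refl f l =
        subst₂ (λ x y → κ * N h P x < N (suc h) P y) f (at-child h i j r f) l

      -- A light child holds less than a `1 / κ` part of what its parent has of the type, so one
      -- level makes at most a `B / κ` part light.
      lights-few : ∀ d P i → κ * weight (d + h₀) P i (lights d) ≤ d * B * N (d + h₀) P i
      lights-few zero P i = ≤-reflexive (trans (cong (κ *_) (weight-zero h₀ P i (λ _ _ _ → refl))) (*-zeroʳ κ))
      lights-few (suc d) P i = begin
        κ * weight (suc h) P i (lights (suc d))
          ≡⟨ cong (κ *_) (weight-children h P i _) ⟩
        κ * sum (λ j → weight h P (child j) (lights (suc d)))
          ≡⟨ *-sum κ _ ⟩
        sum (λ j → κ * weight h P (child j) (lights (suc d)))
          ≡⟨ sum-cong (λ j → trans (cong (κ *_) (weight-+ h P (child j) _ _)) (*-distribˡ-+ κ _ _)) ⟩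
        sum (λ j → κ * weight h P (child j) (λ r → 𝟙 (light? h r)) + κ * weight h P (child j) (lights d))
          ≤⟨ sum-mono (λ j → +-mono-≤ (here-few j) (lights-few d P (child j))) ⟩
        sum (λ j → N (suc h) P i + d * B * N h P (child j))
          ≡⟨ trans (sum-+ _ _) (cong₂ _+_ (sum-const B _) (sym (*-sum (d * B) _))) ⟩
        B * N (suc h) P i + d * B * sum (λ j → N h P (child j))
          ≡⟨ cong (λ z → B * N (suc h) P i + d * B * z) (weight-children h P i _) ⟨
        B * N (suc h) P i + d * B * N (suc h) P i
          ≡⟨ *-distribʳ-+ (N (suc h) P i) B (d * B) ⟨
        suc d * B * N (suc h) P i ∎
        where
        h = d + h₀
        child : Fin B → ℕ
        child j = i * B + toℕ j
        here-few : ∀ j → κ * weight h P (child j) (λ r → 𝟙 (light? h r)) ≤ N (suc h) P i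
        here-few j with ≤-<-connex (N (suc h) P i) (κ * N h P (child j))
        ... | inj₁ heavy = ≤-trans (≤-reflexive (trans (cong (κ *_) (weight-zero h P (child j)
                (λ r e f → 𝟙-no (light? h r) (λ l → <⇒≱ (light-child h P i j r e f l) heavy)))) (*-zeroʳ κ))) z≤n
        ... | inj₂ light = ≤-trans (*-monoʳ-≤ κ (weight≤N h P (child j) (λ r _ _ → 𝟙≤1 (light? h r)))) (<⇒≤ light)

      survivor? : ∀ d k r → Dec (lights d r ≡ 0 × k ≤ bads d r)
      survivor? d k r = lights d r ℕ.≟ 0 ×-dec k ℕ.≤? bads d r

      survivors : ℕ → ℕ → Fin n → ℕ
      survivors d k r = 𝟙 (survivor? d k r)

      -- At a bad node a light child has no survivors, so only B′ of the B children count.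
      survivors-few : ∀ d k P i → B ^ k * weight (d + h₀) P i (survivors d k) ≤ B′ ^ k * B ^ (d + h₀)
      survivors-few d zero P i = begin
        1 * weight (d + h₀) P i (survivors d 0) ≡⟨ *-identityˡ _ ⟩
        weight (d + h₀) P i (survivors d 0) ≤⟨ weight≤N (d + h₀) P i (λ r _ _ → 𝟙≤1 (survivor? d 0 r)) ⟩
        N (d + h₀) P i ≤⟨ N≤width (d + h₀) P i ⟩
        B ^ (d + h₀) ≡⟨ *-identityˡ _ ⟨
        1 * B ^ (d + h₀) ∎
      survivors-few zero (suc k) P i = ≤-trans (≤-reflexive (trans (cong (B ^ suc k *_)
        (weight-zero h₀ P i (λ r _ _ → 𝟙-no (survivor? 0 (suc k) r) (λ { (_ , ()) })))) (*-zeroʳ (B ^ suc k)))) z≤n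
      survivors-few (suc d) (suc k) P i = go (bad? h P i)
        where
        h = d + h₀
        child : Fin B → ℕ
        child j = i * B + toℕ j
        here? : ∀ j r → a r ≡ P → idx h r ≡ child j → Bad h (a r) (idx (suc h) r) → Bad h P i
        here? j r refl f b = subst (Bad h P) (at-child h i j r f) b
        go : Dec (Bad h P i) → B ^ suc k * weight (suc h) P i (survivors (suc d) (suc k)) ≤ B′ ^ suc k * B ^ suc h
        go (no good) = begin
          B ^ suc k * weight (suc h) P i (survivors (suc d) (suc k))
            ≡⟨ cong (B ^ suc k *_) (weight-children h P i _) ⟩
          B ^ suc k * sum (λ j → weight h P (child j) (survivors (suc d) (suc k)))
            ≤⟨ *-monoʳ-≤ (B ^ suc k) (sum-mono (λ j → weight-mono h P (child j) (still j))) ⟩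
          B ^ suc k * sum (λ j → weight h P (child j) (survivors d (suc k)))
            ≡⟨ *-sum (B ^ suc k) _ ⟩
          sum (λ j → B ^ suc k * weight h P (child j) (survivors d (suc k)))
            ≤⟨ sum-bound (λ j → survivors-few d (suc k) P (child j)) ⟩
          B * (B′ ^ suc k * B ^ h)
            ≡⟨ *-x∙yz≈y∙xz B (B′ ^ suc k) (B ^ h) ⟩
          B′ ^ suc k * B ^ suc h ∎
          where
          still : ∀ j r → a r ≡ P → idx h r ≡ child j → survivors (suc d) (suc k) r ≤ survivors d (suc k) r
          still j r e f = 𝟙-mono (survivor? (suc d) (suc k) r) (survivor? d (suc k) r) λ (l , b) →
            m+n≡0⇒n≡0 (𝟙 (light? h r)) l ,
            subst (suc k ≤_) (cong (_+ bads d r) (𝟙-no (badAt? h r) (good ∘ here? j r e f))) b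
        go (yes (j₀ , light)) = begin
          B ^ suc k * weight (suc h) P i (survivors (suc d) (suc k))
            ≡⟨ cong (B ^ suc k *_) (weight-children h P i _) ⟩
          B ^ suc k * sum (λ j → weight h P (child j) (survivors (suc d) (suc k)))
            ≡⟨ trans (*-assoc B (B ^ k) _) (cong (B *_) (*-sum (B ^ k) _)) ⟩
          B * sum (λ j → B ^ k * weight h P (child j) (survivors (suc d) (suc k)))
            ≤⟨ *-monoʳ-≤ B (sum-except j₀ (trans (cong (B ^ k *_) (weight-zero h P (child j₀) none)) (*-zeroʳ (B ^ k)))
                 (λ j → ≤-trans (*-monoʳ-≤ (B ^ k) (weight-mono h P (child j) (λ r _ _ → fewer r))) (survivors-few d k P (child j)))) ⟩
          B * (B′ * (B′ ^ k * B ^ h))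
            ≡⟨ lemma B B′ (B′ ^ k) (B ^ h) ⟩
          B′ ^ suc k * B ^ suc h ∎
          where
          lemma : ∀ x y z w → x * (y * (z * w)) ≡ y * z * (x * w)
          lemma = solve-∀
          fewer : ∀ r → survivors (suc d) (suc k) r ≤ survivors d k r
          fewer r = 𝟙-mono (survivor? (suc d) (suc k) r) (survivor? d k r) λ (l , b) →
            m+n≡0⇒n≡0 (𝟙 (light? h r)) l ,
            s≤s⁻¹ (≤-trans b (+-monoˡ-≤ (bads d r) (𝟙≤1 (badAt? h r))))
          is-light : ∀ r → a r ≡ P → idx h r ≡ child j₀ → Light h r
          is-light r refl f = subst₂ (λ x y → κ * N h P x < N (suc h) P y) (sym f) (sym (at-child h i j₀ r f)) light
          none : ∀ r → a r ≡ P → idx h r ≡ child j₀ → survivors (suc d) (suc k) r ≡ 0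
          none r e f = 𝟙-no (survivor? (suc d) (suc k) r) λ (l , _) →
            1+n≢0 (trans (cong (_+ lights d r) (sym (𝟙-yes (light? h r) (is-light r e f)))) l)

      module Leaves (θ : ℕ) where

        small? : ∀ r → Dec (N h₀ (a r) (idx h₀ r) * θ < n)
        small? r = N h₀ (a r) (idx h₀ r) * θ ℕ.<? n

        -- There are `B ^ d` leaf intervals below the node, and each holds fewer than `n / θ` small
        -- rows of type `P`.
        small-few : ∀ d P i → θ * weight (d + h₀) P i (λ r → 𝟙 (small? r)) ≤ B ^ d * n
        small-few zero P i with ≤-<-connex n (N h₀ P i * θ)
        ... | inj₁ big = ≤-trans (≤-reflexive (trans (cong (θ *_) (weight-zero h₀ P i
                (λ { r refl refl → 𝟙-no (small? r) (≤⇒≯ big) }))) (*-zeroʳ θ))) z≤n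
        ... | inj₂ sm = ≤-trans (*-monoʳ-≤ θ (weight≤N h₀ P i (λ r _ _ → 𝟙≤1 (small? r))))
                (≤-trans (≤-reflexive (*-comm θ _)) (≤-trans (<⇒≤ sm) (≤-reflexive (sym (*-identityˡ n)))))
        small-few (suc d) P i = begin
          θ * weight (suc d + h₀) P i _ ≡⟨ cong (θ *_) (weight-children (d + h₀) P i _) ⟩
          θ * sum (λ j → weight (d + h₀) P (i * B + toℕ {B} j) _) ≡⟨ *-sum θ _ ⟩
          sum (λ j → θ * weight (d + h₀) P (i * B + toℕ {B} j) _) ≤⟨ sum-bound (λ j → small-few d P (i * B + toℕ j)) ⟩
          B * (B ^ d * n) ≡⟨ *-assoc B (B ^ d) n ⟨
          B ^ suc d * n ∎

  cancel-scale : ∀ {U c κ S X} → .{{NonZero c}} → U * c ≤ κ → κ * S ≤ c * X → U * S ≤ X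
  cancel-scale {U} {c} {κ} {S} {X} Uc≤κ κS≤cX = *-cancelˡ-≤ c (begin
    c * (U * S) ≡⟨ *-x∙yz≈yx∙z c U S ⟩
    U * c * S ≤⟨ *-monoˡ-≤ S Uc≤κ ⟩
    κ * S ≤⟨ κS≤cX ⟩
    c * X ∎)

  -- Exceptional rows and a common good level.

  module Exclusion {n K : ℕ} (B′ : ℕ) (a : Fin n → Fin K) (κ k h₀ θ D : ℕ) where

    open Tree B′ a public
    open Levels κ k h₀ public
    open Leaves θ public

    H : ℕ
    H = D + h₀

    -- The rows that remain have no light level, fewer than `k` bad levels and a populous leaf. The
    -- second case may assume `lights D r ≡ 0`, as `survivors-few` requires, because the first case
    -- covers the rest.
    Excluded : Fin n → Set
    Excluded r = 0 < lights D r ⊎ (lights D r ≡ 0 × k ≤ bads D r) ⊎ N h₀ (a r) (idx h₀ r) * θ < n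

    excluded? : Decidable Excluded
    excluded? r = 0 ℕ.<? lights D r ⊎-dec (survivor? D k r ⊎-dec small? r)

    -- Each of the three kinds costs at most `n / U`. The factor `K` sums over the types; `B` beside
    -- `B′ ^ k` is there because the tree may have up to `B * n` places; and `K * B ^ D` counts
    -- pairs of a type and a leaf.
    excluded-few : ∀ U .{{_ : NonZero K}} .{{_ : NonZero D}} .{{_ : NonZero B′}} →
      n ≤ B ^ H → B ^ H ≤ B * n → U * (D * B) ≤ κ → U * (K * (B′ ^ k * B)) ≤ B ^ k → U * (K * B ^ D) ≤ θ →
      U * # excluded? ≤ 3 * n
    excluded-few U {{K≢0}} n≤ ≤Bn Uκ Uk Uθ = begin
      U * # excluded?
        ≡⟨ cong (U *_) (#-def _) ⟩
      U * sum (λ r → 𝟙 (excluded? r))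
        ≤⟨ *-monoʳ-≤ U (sum-mono pointwise) ⟩
      U * sum (λ r → lights D r + (survivors D k r + 𝟙 (small? r)))
        ≡⟨ cong (U *_) (trans (sum-+ _ _) (cong (sum (lights D) +_) (sum-+ _ _))) ⟩
      U * (sum (lights D) + (sum (survivors D k) + sum (λ r → 𝟙 (small? r))))
        ≡⟨ trans (*-distribˡ-+ U _ _) (cong (U * sum (lights D) +_) (*-distribˡ-+ U _ _)) ⟩
      U * sum (lights D) + (U * sum (survivors D k) + U * sum (λ r → 𝟙 (small? r)))
        ≤⟨ +-mono-≤ part₁ (+-mono-≤ part₂ part₃) ⟩
      n + (n + n)
        ≡⟨ cong (λ z → n + (n + z)) (+-identityʳ n) ⟨
      3 * n ∎
      where
      pointwise : ∀ r → 𝟙 (excluded? r) ≤ lights D r + (survivors D k r + 𝟙 (small? r))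
      pointwise r = ≤-trans (𝟙-∪ (excluded? r) (0 ℕ.<? lights D r) (survivor? D k r ⊎-dec small? r) id)
        (+-mono-≤ (pos (lights D r)) (𝟙-∪ (survivor? D k r ⊎-dec small? r) (survivor? D k r) (small? r) id))
        where
        pos : ∀ m → 𝟙 (0 ℕ.<? m) ≤ m
        pos zero = z≤n
        pos (suc m) = s≤s z≤n
      roots : ∀ ψ → sum ψ ≡ sum (λ P → weight H P 0 ψ)
      roots ψ = weight-roots H ψ (λ r → n<1⇒n≡0 (idx-< H 0 r (<-≤-trans (Fin.toℕ<n r) n≤)))
      part₁ : U * sum (lights D) ≤ n
      part₁ = cancel-scale {U = U} {c = D * B} {{m*n≢0 D B}} Uκ (begin
        κ * sum (lights D) ≡⟨ cong (κ *_) (roots (lights D)) ⟩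
        κ * sum (λ P → weight H P 0 (lights D)) ≡⟨ *-sum κ _ ⟩
        sum (λ P → κ * weight H P 0 (lights D)) ≤⟨ sum-mono (λ P → lights-few D P 0) ⟩
        sum (λ P → D * B * N H P 0) ≡⟨ *-sum (D * B) _ ⟨
        D * B * sum (λ P → N H P 0) ≡⟨ cong (D * B *_) (roots (λ _ → 1)) ⟨
        D * B * sum {n} (λ _ → 1) ≡⟨ cong (D * B *_) (trans (sum-const n 1) (*-identityʳ n)) ⟩
        D * B * n ∎)
      part₂ : U * sum (survivors D k) ≤ n
      part₂ = cancel-scale {U = U} {c = K * (B′ ^ k * B)} {{m*n≢0 K (B′ ^ k * B) {{K≢0}} {{m*n≢0 (B′ ^ k) B {{m^n≢0 B′ k}}}}}} Uk (begin
        B ^ k * sum (survivors D k) ≡⟨ cong (B ^ k *_) (roots (survivors D k)) ⟩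
        B ^ k * sum (λ P → weight H P 0 (survivors D k)) ≡⟨ *-sum (B ^ k) _ ⟩
        sum (λ P → B ^ k * weight H P 0 (survivors D k)) ≤⟨ sum-bound (λ P → survivors-few D k P 0) ⟩
        K * (B′ ^ k * B ^ H) ≤⟨ *-monoʳ-≤ K (*-monoʳ-≤ (B′ ^ k) ≤Bn) ⟩
        K * (B′ ^ k * (B * n)) ≡⟨ lemma K (B′ ^ k) B n ⟩
        K * (B′ ^ k * B) * n ∎)
        where
        lemma : ∀ x y z w → x * (y * (z * w)) ≡ x * (y * z) * w
        lemma = solve-∀
      part₃ : U * sum (λ r → 𝟙 (small? r)) ≤ n
      part₃ = cancel-scale {U = U} {c = K * B ^ D} {{m*n≢0 K (B ^ D) {{K≢0}} {{m^n≢0 B D}}}} Uθ (begin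
        θ * sum (λ r → 𝟙 (small? r)) ≡⟨ cong (θ *_) (roots _) ⟩
        θ * sum (λ P → weight H P 0 (λ r → 𝟙 (small? r))) ≡⟨ *-sum θ _ ⟩
        sum (λ P → θ * weight H P 0 (λ r → 𝟙 (small? r))) ≤⟨ sum-bound (λ P → small-few D P 0) ⟩
        K * (B ^ D * n) ≡⟨ *-assoc K (B ^ D) n ⟨
        K * B ^ D * n ∎)

    nodeSize : ℕ → Fin n → ℕ
    nodeSize h r = # (node? h (a r) (idx h r))

    record Selection {s} (r : Fin s → Fin n) : Set₁ where
      field
        level : Fin D
        R : Fin s → Fin n → Set
        R? : ∀ i → Decidable (R i)
        separated : Separated R
        R⊆block : ∀ i {x} → R i x → a x ≡ a (r i) × idx (suc (toℕ level + h₀)) x ≡ idx (suc (toℕ level + h₀)) (r i)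
        R-large : ∀ i → nodeSize (suc (toℕ level + h₀)) (r i) ≤ κ * # (R? i)
        large : ∀ i → n ≤ nodeSize (suc (toℕ level + h₀)) (r i) * θ

    -- Otherwise each of the `d` levels would be bad for one of the rows, giving at least `d` bad
    -- levels in total.
    common-level : ∀ {s} (r : Fin s → Fin n) d → sum (λ i → bads d (r i)) < d →
                   ∃[ e ] e < d × (∀ i → ¬ Bad (e + h₀) (a (r i)) (idx (suc (e + h₀)) (r i)))
    common-level r (suc d) lt = go (Fin.all? (λ i → ¬? (badAt? (d + h₀) (r i))))
      where
      X = sum (λ i → 𝟙 (badAt? (d + h₀) (r i)))
      go : Dec (∀ i → ¬ Bad (d + h₀) (a (r i)) (idx (suc (d + h₀)) (r i))) → _
      go (yes good) = d , ≤-refl , good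
      go (no ¬good) =
        let i , ¬¬b = Fin.¬∀⟶∃¬ _ _ (λ i → ¬? (badAt? (d + h₀) (r i))) ¬good
            1≤X : 1 ≤ X
            1≤X = ≤-trans (≤-reflexive (sym (𝟙-yes (badAt? (d + h₀) (r i)) (decidable-stable (badAt? (d + h₀) (r i)) ¬¬b))))
                          (term≤sum (λ i → 𝟙 (badAt? (d + h₀) (r i))) i)
            e , e<d , good = common-level r d (≤-trans (+-monoˡ-≤ (sum (λ i → bads d (r i))) 1≤X)
                               (s≤s⁻¹ (≤-<-trans (≤-reflexive (sym (sum-+ _ _))) lt)))
        in e , m<n⇒m<1+n e<d , good

    coarser : ∀ h d {x y} → idx h x ≡ idx h y → idx (d + h) x ≡ idx (d + h) y
    coarser h zero e = e
    coarser h (suc d) e = cong (_/ B) (coarser h d e)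

    -- Each row has at most `k - 1` bad levels, so all of them together have fewer than `s * k` and
    -- hence fewer than `D`. At a level that is good for all, every child of the nodes above the
    -- rows is populous.
    select : ∀ {s} (r : Fin s → Fin n) → .{{NonZero k}} → .{{NonZero s}} → s * k ≤ D → s ≤ B →
             (∀ {i j} → i Fin.< j → r i Fin.< r j) → (∀ i → ¬ Excluded (r i)) → Selection r
    select {s} r sk≤D s≤B inc ok = record
      { level = fromℕ< e<D ; R = R ; R? = R? ; separated = λ {i} {j} → sep {i} {j} ; R⊆block = R⊆block ; R-large = R-large ; large = large }
      where
      bads<k : ∀ i → bads D (r i) < k
      bads<k i = ≰⇒> λ k≤ → ok i (inj₂ (inj₁ (n≤0⇒n≡0 (≮⇒≥ (ok i ∘ inj₁)) , k≤)))
      total : sum (λ i → bads D (r i)) < D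
      total = begin-strict
        sum (λ i → bads D (r i)) ≤⟨ sum-bound (λ i → s≤s⁻¹ (≤-trans (bads<k i) (≤-reflexive (sym (suc-pred k))))) ⟩
        s * pred k <⟨ *-monoʳ-< s (≤-reflexive (suc-pred k)) ⟩
        s * k ≤⟨ sk≤D ⟩
        D ∎
      found = common-level r D total
      e = proj₁ found
      e<D : e < D
      e<D = proj₁ (proj₂ found)
      e≡ : toℕ (fromℕ< e<D) ≡ e
      e≡ = Fin.toℕ-fromℕ< e<D
      h = toℕ (fromℕ< e<D) + h₀
      good : ∀ i → ¬ Bad h (a (r i)) (idx (suc h) (r i))
      good = subst (λ e → ∀ i → ¬ Bad (e + h₀) (a (r i)) (idx (suc (e + h₀)) (r i))) (sym e≡) (proj₂ (proj₂ found))
      child : Fin s → Fin B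
      child i = Fin.inject≤ i s≤B
      -- The `i`-th child, wherever `r i` itself lies: choices in different nodes are ordered by the
      -- nodes, choices in the same node by the numbers of the children.
      R : Fin s → Fin n → Set
      R i x = a x ≡ a (r i) × idx h x ≡ idx (suc h) (r i) * B + toℕ (child i)
      R? : ∀ i → Decidable (R i)
      R? i = node? h (a (r i)) (idx (suc h) (r i) * B + toℕ (child i))
      sep : ∀ {i j x y} → i Fin.< j → R i x → R j y → x Fin.< y
      sep {i} {j} {x} {y} i<j (_ , p) (_ , q) = ≰⇒> λ y≤x → <⇒≱ (begin-strict
        idx h x ≡⟨ p ⟩
        idx (suc h) (r i) * B + toℕ (child i) <⟨ +-mono-≤-< (*-monoˡ-≤ B (idx-mono (suc h) (<⇒≤ (inc i<j))))
                (subst₂ _<_ (sym (Fin.toℕ-inject≤ i s≤B)) (sym (Fin.toℕ-inject≤ j s≤B)) i<j) ⟩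
        idx (suc h) (r j) * B + toℕ (child j) ≡⟨ q ⟨
        idx h y ∎) (idx-mono h y≤x)
      R⊆block : ∀ i {x} → R i x → a x ≡ a (r i) × idx (suc h) x ≡ idx (suc h) (r i)
      R⊆block i {x} (p , q) = p , at-child h _ (child i) x q
      R-large : ∀ i → nodeSize (suc h) (r i) ≤ κ * # (R? i)
      R-large i = begin
        nodeSize (suc h) (r i) ≡⟨ weight-# (suc h) _ _ ⟨
        N (suc h) (a (r i)) (idx (suc h) (r i)) ≤⟨ ≮⇒≥ (λ lt → good i (child i , lt)) ⟩
        κ * N h (a (r i)) (idx (suc h) (r i) * B + toℕ (child i)) ≡⟨ cong (κ *_) (weight-# h _ _) ⟩
        κ * # (R? i) ∎
      large : ∀ i → n ≤ nodeSize (suc h) (r i) * θ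
      large i = begin
        n ≤⟨ ≮⇒≥ (ok i ∘ inj₂ ∘ inj₂) ⟩
        N h₀ (a (r i)) (idx h₀ (r i)) * θ ≡⟨ cong (_* θ) (weight-# h₀ _ _) ⟩
        # (node? h₀ (a (r i)) (idx h₀ (r i))) * θ ≤⟨ *-monoˡ-≤ θ (#-mono (node? h₀ _ _) (node? (suc h) _ _)
                (λ x (p , q) → p , coarser h₀ (suc (toℕ (fromℕ< e<D))) q)) ⟩
        nodeSize (suc h) (r i) * θ ∎

  -- Counting copies

  ∑L : ∀ {A : Set} → List A → (A → ℕ) → ℕ
  ∑L [] g = 0
  ∑L (x ∷ v) g = g x + ∑L v g

  ∑Π-cong : ∀ {n} s {P : Fin s → Fin n → Set} (P? : ∀ i → Decidable (P i)) {f g : List (Fin n) → ℕ} →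
            (∀ r → f r ≡ g r) → ∑Π s P? f ≡ ∑Π s P? g
  ∑Π-cong zero P? h = h []
  ∑Π-cong (suc s) P? h = sum-cong (λ x → cong (𝟙 (P? zero x) *_) (∑Π-cong s (P? ∘ suc) (λ r → h (x ∷ r))))

  ∑Π-mono : ∀ {n} s {P : Fin s → Fin n → Set} (P? : ∀ i → Decidable (P i)) {f g : List (Fin n) → ℕ} →
            (∀ r → r ∈Π P → f r ≤ g r) → ∑Π s P? f ≤ ∑Π s P? g
  ∑Π-mono zero P? h = h [] tt
  ∑Π-mono (suc s) P? h = sum-mono (λ x → 𝟙-*-mono (P? zero x) (λ p → ∑Π-mono s (P? ∘ suc) (λ r q → h (x ∷ r) (p , q))))

  ∑Π-+ : ∀ {n} s {P : Fin s → Fin n → Set} (P? : ∀ i → Decidable (P i)) (f g : List (Fin n) → ℕ) →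
         ∑Π s P? (λ r → f r + g r) ≡ ∑Π s P? f + ∑Π s P? g
  ∑Π-+ zero P? f g = refl
  ∑Π-+ (suc s) P? f g = trans (sum-cong (λ x → trans (cong (𝟙 (P? zero x) *_) (∑Π-+ s (P? ∘ suc) _ _))
                (*-distribˡ-+ (𝟙 (P? zero x)) _ _))) (sum-+ _ _)

  ∑Π-* : ∀ {n} s {P : Fin s → Fin n → Set} (P? : ∀ i → Decidable (P i)) k (f : List (Fin n) → ℕ) →
         ∑Π s P? (λ r → k * f r) ≡ k * ∑Π s P? f
  ∑Π-* zero P? k f = refl
  ∑Π-* (suc s) P? k f = trans (sum-cong (λ x → trans (cong (𝟙 (P? zero x) *_) (∑Π-* s (P? ∘ suc) k _))
                (*-x∙yz≈y∙xz (𝟙 (P? zero x)) k _))) (sym (*-sum k _))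

  ∑Π-sum : ∀ {n m} s {P : Fin s → Fin n → Set} (P? : ∀ i → Decidable (P i)) (f : Fin m → List (Fin n) → ℕ) →
           ∑Π s P? (λ r → sum (λ x → f x r)) ≡ sum (λ x → ∑Π s P? (f x))
  ∑Π-sum zero P? f = refl
  ∑Π-sum (suc s) P? f = trans
    (sum-cong (λ y → trans (cong (𝟙 (P? zero y) *_) (∑Π-sum s (P? ∘ suc) (λ x → f x ∘ (y ∷_)))) (*-sum (𝟙 (P? zero y)) _)))
    (sum-comm _)

  ∑L-sum : ∀ {A : Set} {m} (v : List A) (f : Fin m → A → ℕ) → sum (λ x → ∑L v (f x)) ≡ ∑L v (λ y → sum (λ x → f x y))
  ∑L-sum {m = m} [] f = trans (sum-const m 0) (*-zeroʳ m)
  ∑L-sum (y ∷ v) f = trans (sum-+ _ _) (cong (sum (λ x → f x y) +_) (∑L-sum v f))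

  ∑L-* : ∀ {A : Set} k (v : List A) (f : A → ℕ) → ∑L v (λ y → k * f y) ≡ k * ∑L v f
  ∑L-* k [] f = sym (*-zeroʳ k)
  ∑L-* k (y ∷ v) f = trans (cong (k * f y +_) (∑L-* k v f)) (sym (*-distribˡ-+ k _ _))

  -- Linearity of expectation: each coordinate has average at most `G / m`, so a sum over `s`
  -- coordinates has average at most `s * G / m`.
  union-bound : ∀ {n} m G s {P : Fin s → Fin n → Set} (P? : ∀ i → Decidable (P i)) (g : Fin n → ℕ) →
                (∀ i → m * sum (λ x → 𝟙 (P? i x) * g x) ≤ # (P? i) * G) →
                m * ∑Π s P? (λ r → ∑L r g) ≤ s * G * ∑Π s P? (λ _ → 1)
  union-bound m G zero P? g h = ≤-reflexive (*-zeroʳ m)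
  union-bound m G (suc s) P? g h = begin
    m * sum (λ x → 𝟙 (P? zero x) * ∑Π s (P? ∘ suc) (λ r → g x + ∑L r g))
      ≡⟨ cong (m *_) (sum-cong (λ x → cong (𝟙 (P? zero x) *_) (trans (∑Π-+ s (P? ∘ suc) (λ _ → g x) _)
           (cong (_+ Y) (trans (∑Π-cong s (P? ∘ suc) (λ _ → sym (*-identityʳ (g x)))) (∑Π-* s (P? ∘ suc) (g x) _)))))) ⟩
    m * sum (λ x → 𝟙 (P? zero x) * (g x * T + Y))
      ≡⟨ cong (m *_) (trans (sum-cong (λ x → expand (𝟙 (P? zero x)) (g x) T Y)) (sum-+ _ _)) ⟩
    m * (sum (λ x → 𝟙 (P? zero x) * g x * T) + sum (λ x → 𝟙 (P? zero x) * Y))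
      ≡⟨ cong (m *_) (cong₂ _+_ (sym (sum-* T _)) (trans (sym (sum-* Y _)) (cong (_* Y) (sym (#-def (P? zero)))))) ⟩
    m * (S * T + p * Y)
      ≡⟨ regroup m S T p Y ⟩
    m * S * T + p * (m * Y)
      ≤⟨ +-mono-≤ (*-monoˡ-≤ T (h zero)) (*-monoʳ-≤ p (union-bound m G s (P? ∘ suc) g (h ∘ suc))) ⟩
    p * G * T + p * (s * G * T)
      ≡⟨ finish p G T s ⟩
    suc s * G * (p * T)
      ≡⟨ cong (suc s * G *_) (trans (cong (_* T) (#-def (P? zero))) (sum-* T _)) ⟩
    suc s * G * sum (λ x → 𝟙 (P? zero x) * T) ∎
    where
    T = ∑Π s (P? ∘ suc) (λ _ → 1)
    Y = ∑Π s (P? ∘ suc) (λ r → ∑L r g)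
    S = sum (λ x → 𝟙 (P? zero x) * g x)
    p = # (P? zero)
    expand : ∀ a b c d → a * (b * c + d) ≡ a * b * c + a * d
    expand = solve-∀
    regroup : ∀ m S T p Y → m * (S * T + p * Y) ≡ m * S * T + p * (m * Y)
    regroup = solve-∀
    finish : ∀ p G T s → p * G * T + p * (s * G * T) ≡ (G + s * G) * (p * T)
    finish = solve-∀

  module ProductCount {n s t : ℕ} .{{_ : NonZero s}} .{{_ : NonZero t}}
    (M : Fin n → Fin n → Bool) (𝒜 : Fin s → Fin t → Bool)
    {E : Fin n → Fin n → Set} (E? : ∀ r c → Dec (E r c))
    {R : Fin s → Fin n → Set} (R? : ∀ i → Decidable (R i)) (R-separated : Separated R)
    {C : Fin t → Fin n → Set} (C? : ∀ j → Decidable (C j)) (C-separated : Separated C)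
    (value : ∀ i j {x y} → R i x → C j y → ¬ E x y → M x y ≡ 𝒜 i j)
    (few : ∀ i j → 2 * (s * t) * sum (λ x → 𝟙 (R? i x) * sum (λ y → 𝟙 (C? j y) * 𝟙 (E? x y))) ≤ # (R? i) * # (C? j))
    where

    open ListCopies M (List.tabulate ∘ 𝒜)

    errors : List (Fin n) → List (Fin n) → ℕ
    errors ρ γ = ∑L ρ (λ x → ∑L γ (λ y → 𝟙 (E? x y)))

    ΠR ΠC : ℕ
    ΠR = ∑Π s R? (λ _ → 1)
    ΠC = ∑Π t C? (λ _ → 1)

    row-correct : ∀ {x} t {C : Fin t → Fin n → Set} (f : Fin t → Bool) →
      (∀ j {y} → C j y → ¬ E x y → M x y ≡ f j) →
      ∀ γ → γ ∈Π C → ∑L γ (λ y → 𝟙 (E? x y)) ≡ 0 → map (M x) γ ≡ List.tabulate f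
    row-correct zero f h [] _ _ = refl
    row-correct {x} (suc t) f h (y ∷ γ) (q , qs) e = cong₂ _∷_
      (h zero q (λ err → 1+n≢0 (trans (cong (_+ ∑L γ (λ y → 𝟙 (E? x y))) (sym (𝟙-yes (E? x y) err))) e)))
      (row-correct t (f ∘ suc) (h ∘ suc) γ qs (m+n≡0⇒n≡0 (𝟙 (E? x y)) e))

    copy-rows : ∀ s {R : Fin s → Fin n → Set} (g : Fin s → List Bool) {γ} →
      (∀ i {x} → R i x → ∑L γ (λ y → 𝟙 (E? x y)) ≡ 0 → map (M x) γ ≡ g i) →
      ∀ ρ → ρ ∈Π R → errors ρ γ ≡ 0 → map (λ x → map (M x) γ) ρ ≡ List.tabulate g
    copy-rows zero g h [] _ _ = refl
    copy-rows (suc s) g {γ} h (x ∷ ρ) (p , ps) e = cong₂ _∷_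
      (h zero p (m+n≡0⇒m≡0 (∑L γ (λ y → 𝟙 (E? x y))) e))
      (copy-rows s (g ∘ suc) (h ∘ suc) ρ ps (m+n≡0⇒n≡0 (∑L γ (λ y → 𝟙 (E? x y))) e))

    -- A random pair of tuples meets an error at each of the `s * t` positions with probability at
    -- most `1 / (2 * (s * t))`, hence half an error on average.
    errors-few : 2 * ∑Π s R? (λ ρ → ∑Π t C? (errors ρ)) ≤ ΠR * ΠC
    errors-few = *-cancelˡ-≤ (s * t) {{m*n≢0 s t}} (begin
      s * t * (2 * ∑Π s R? (λ ρ → ∑Π t C? (errors ρ))) ≡⟨ *-x∙yz≈yx∙z (s * t) 2 _ ⟩
      m * ∑Π s R? (λ ρ → ∑Π t C? (errors ρ)) ≡⟨ cong (m *_) (∑Π-cong s R? (λ ρ → pull ρ)) ⟩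
      m * ∑Π s R? (λ ρ → ∑L ρ g) ≤⟨ union-bound m (t * ΠC) s R? g outer ⟩
      s * (t * ΠC) * ΠR ≡⟨ finish s t ΠC ΠR ⟩
      s * t * (ΠR * ΠC) ∎)
      where
      m = 2 * (s * t)
      g : Fin n → ℕ
      g x = ∑Π t C? (λ γ → ∑L γ (λ y → 𝟙 (E? x y)))
      finish : ∀ s t c r → s * (t * c) * r ≡ s * t * (r * c)
      finish = solve-∀
      pull : ∀ ρ → ∑Π t C? (errors ρ) ≡ ∑L ρ g
      pull [] = trans (∑Π-* t C? 0 (λ _ → 1)) refl
      pull (x ∷ ρ) = trans (∑Π-+ t C? _ _) (cong (g x +_) (pull ρ))
      outer : ∀ i → m * sum (λ x → 𝟙 (R? i x) * g x) ≤ # (R? i) * (t * ΠC)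
      outer i = begin
        m * sum (λ x → 𝟙 (R? i x) * g x)
          ≡⟨ cong (m *_) (sum-cong (λ x → trans (sym (∑Π-* t C? (𝟙 (R? i x)) _)) (∑Π-cong t C? (λ γ → sym (∑L-* (𝟙 (R? i x)) γ _))))) ⟩
        m * sum (λ x → ∑Π t C? (λ γ → ∑L γ (λ y → 𝟙 (R? i x) * 𝟙 (E? x y))))
          ≡⟨ cong (m *_) (trans (sym (∑Π-sum t C? (λ x γ → ∑L γ (λ y → 𝟙 (R? i x) * 𝟙 (E? x y))))) (∑Π-cong t C? (λ γ → ∑L-sum γ _))) ⟩
        m * ∑Π t C? (λ γ → ∑L γ (λ y → sum (λ x → 𝟙 (R? i x) * 𝟙 (E? x y))))
          ≤⟨ union-bound m (# (R? i)) t C? (λ y → sum (λ x → 𝟙 (R? i x) * 𝟙 (E? x y))) inner ⟩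
        t * # (R? i) * ΠC
          ≡⟨ *-xy∙z≈y∙xz t (# (R? i)) ΠC ⟩
        # (R? i) * (t * ΠC) ∎
        where
        inner : ∀ j → m * sum (λ y → 𝟙 (C? j y) * sum (λ x → 𝟙 (R? i x) * 𝟙 (E? x y))) ≤ # (C? j) * # (R? i)
        inner j = begin
          m * sum (λ y → 𝟙 (C? j y) * sum (λ x → 𝟙 (R? i x) * 𝟙 (E? x y)))
            ≡⟨ cong (m *_) (trans (sum-cong (λ y → *-sum (𝟙 (C? j y)) _)) (sum-comm _)) ⟩
          m * sum (λ x → sum (λ y → 𝟙 (C? j y) * (𝟙 (R? i x) * 𝟙 (E? x y))))
            ≡⟨ cong (m *_) (sum-cong (λ x → trans (sum-cong (λ y → *-x∙yz≈y∙xz (𝟙 (C? j y)) (𝟙 (R? i x)) _)) (sym (*-sum (𝟙 (R? i x)) _)))) ⟩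
          m * sum (λ x → 𝟙 (R? i x) * sum (λ y → 𝟙 (C? j y) * 𝟙 (E? x y)))
            ≤⟨ few i j ⟩
          # (R? i) * # (C? j)
            ≡⟨ *-comm (# (R? i)) _ ⟩
          # (C? j) * # (R? i) ∎

    -- A pair without errors is a copy, and by Markov's inequality at least half of the pairs have
    -- none.
    product-count : ΠR * ΠC ≤ 2 * ∑ℓ s (λ ρ → ∑ℓ t (λ γ → 𝟙 (copy? ρ γ)))
    product-count = +-cancelʳ-≤ (ΠR * ΠC) _ _ (begin
      ΠR * ΠC + ΠR * ΠC
        ≡⟨ double (ΠR * ΠC) ⟩
      2 * (ΠR * ΠC)
        ≡⟨ cong (2 *_) total ⟩
      2 * ∑Π s R? (λ ρ → ∑Π t C? (λ γ → 1))
        ≤⟨ *-monoʳ-≤ 2 (∑Π-mono s R? (λ ρ _ → ∑Π-mono t C? (λ γ _ → ok-or-error (errors ρ γ)))) ⟩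
      2 * ∑Π s R? (λ ρ → ∑Π t C? (λ γ → 𝟙 (errors ρ γ ℕ.≟ 0) + errors ρ γ))
        ≡⟨ cong (2 *_) (trans (∑Π-cong s R? (λ ρ → ∑Π-+ t C? _ _)) (∑Π-+ s R? _ _)) ⟩
      2 * (∑Π s R? (λ ρ → ∑Π t C? (λ γ → 𝟙 (errors ρ γ ℕ.≟ 0))) + ∑Π s R? (λ ρ → ∑Π t C? (errors ρ)))
        ≡⟨ *-distribˡ-+ 2 (∑Π s R? (λ ρ → ∑Π t C? (λ γ → 𝟙 (errors ρ γ ℕ.≟ 0)))) _ ⟩
      2 * ∑Π s R? (λ ρ → ∑Π t C? (λ γ → 𝟙 (errors ρ γ ℕ.≟ 0))) + 2 * ∑Π s R? (λ ρ → ∑Π t C? (errors ρ))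
        ≤⟨ +-mono-≤ (*-monoʳ-≤ 2 (∑Π≤∑ℓ s R? (λ ρ p → ∑Π≤∑ℓ t C? (λ γ q → 𝟙-mono (errors ρ γ ℕ.≟ 0) (copy? ρ γ) (good ρ γ p q))))) errors-few ⟩
      2 * ∑ℓ s (λ ρ → ∑ℓ t (λ γ → 𝟙 (copy? ρ γ))) + ΠR * ΠC ∎)
      where
      double : ∀ x → x + x ≡ 2 * x
      double = solve-∀
      total : ΠR * ΠC ≡ ∑Π s R? (λ ρ → ΠC)
      total = trans (*-comm ΠR ΠC) (trans (sym (∑Π-* s R? ΠC (λ _ → 1))) (∑Π-cong s R? (λ _ → *-identityʳ ΠC)))
      ok-or-error : ∀ e → 1 ≤ 𝟙 (e ℕ.≟ 0) + e
      ok-or-error zero = ≤-refl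
      ok-or-error (suc e) = s≤s z≤n
      good : ∀ ρ γ → ρ ∈Π R → γ ∈Π C → errors ρ γ ≡ 0 → Copy ρ γ
      good ρ γ p q e = separated⇒increasing s R-separated ρ p , separated⇒increasing t C-separated γ q ,
        copy-rows s (List.tabulate ∘ 𝒜) (λ i {x} r → row-correct t (𝒜 i) (λ j c → value i j r c) γ q) ρ p e

  -- From counted locations to sums over tuples.

  bit : Fin 2 → Bool
  bit zero = false
  bit (suc _) = true

  bit-injective : ∀ {x y} → bit x ≡ bit y → x ≡ y
  bit-injective {zero} {zero} _ = refl
  bit-injective {suc zero} {suc zero} _ = refl

  ∑L-++ : ∀ {A : Set} (u v : List A) (f : A → ℕ) → ∑L (u ++ v) f ≡ ∑L u f + ∑L v f
  ∑L-++ [] v f = refl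
  ∑L-++ (x ∷ u) v f = trans (cong (f x +_) (∑L-++ u v f)) (sym (+-assoc (f x) _ _))

  ∑L-map : ∀ {A B : Set} (h : A → B) (v : List A) (f : B → ℕ) → ∑L (map h v) f ≡ ∑L v (f ∘ h)
  ∑L-map h [] f = refl
  ∑L-map h (x ∷ v) f = cong (f (h x) +_) (∑L-map h v f)

  ∑L-cartesian : ∀ {A B C : Set} (h : A → B → C) (u : List A) (v : List B) (f : C → ℕ) →
                 ∑L (cartesianProductWith h u v) f ≡ ∑L u (λ x → ∑L v (λ y → f (h x y)))
  ∑L-cartesian h [] v f = refl
  ∑L-cartesian h (x ∷ u) v f = trans (∑L-++ (map (h x) v) _ f) (cong₂ _+_ (∑L-map (h x) v f) (∑L-cartesian h u v f))

  ∑L-mono : ∀ {A : Set} (v : List A) {f g : A → ℕ} → (∀ {x} → x ∈ v → f x ≤ g x) → ∑L v f ≤ ∑L v g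
  ∑L-mono [] h = z≤n
  ∑L-mono (x ∷ v) h = +-mono-≤ (h (here refl)) (∑L-mono v (h ∘ there))

  ∑L-cong : ∀ {A : Set} (v : List A) {f g : A → ℕ} → (∀ x → f x ≡ g x) → ∑L v f ≡ ∑L v g
  ∑L-cong [] h = refl
  ∑L-cong (x ∷ v) h = cong₂ _+_ (h x) (∑L-cong v h)

  ∑L-zero : ∀ {A : Set} (v : List A) → ∑L v (λ _ → 0) ≡ 0
  ∑L-zero [] = refl
  ∑L-zero (x ∷ v) = ∑L-zero v

  ∑L-+ : ∀ {A : Set} (v : List A) (f g : A → ℕ) → ∑L v (λ x → f x + g x) ≡ ∑L v f + ∑L v g
  ∑L-+ [] f g = refl
  ∑L-+ (x ∷ v) f g = trans (cong (f x + g x +_) (∑L-+ v f g)) (lemma (f x) (g x) (∑L v f) (∑L v g))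
    where lemma : ∀ a b c d → a + b + (c + d) ≡ a + c + (b + d)
          lemma = solve-∀

  ∑L-comm : ∀ {A B : Set} (u : List A) (v : List B) (f : A → B → ℕ) →
            ∑L u (λ x → ∑L v (f x)) ≡ ∑L v (λ y → ∑L u (λ x → f x y))
  ∑L-comm [] v f = sym (∑L-zero v)
  ∑L-comm (x ∷ u) v f = trans (cong (∑L v (f x) +_) (∑L-comm u v f)) (sym (∑L-+ v (f x) _))

  ∑L-tabulate : ∀ {A : Set} {n} (h : Fin n → A) (f : A → ℕ) → ∑L (List.tabulate h) f ≡ sum (f ∘ h)
  ∑L-tabulate {n = zero} h f = sym (n≤0⇒n≡0 (sum-bound {k = 0} λ ()))
  ∑L-tabulate {n = suc n} h f = trans (cong (f (h zero) +_) (∑L-tabulate (h ∘ suc) f)) (sym (sum-suc (f ∘ h)))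

  ∑L-allVecs : ∀ {n} s (f : List (Fin n) → ℕ) → ∑L (allVecs n s) (f ∘ toList) ≡ ∑ℓ s f
  ∑L-allVecs zero f = +-identityʳ (f [])
  ∑L-allVecs {n} (suc s) f = trans (∑L-cartesian _∷_ (allFin n) (allVecs n s) (f ∘ toList))
    (trans (∑L-cong (allFin n) (λ x → ∑L-allVecs s (f ∘ (x ∷_)))) (∑L-tabulate id _))

  length-filter : ∀ {A : Set} {P : A → Set} (P? : Decidable P) (v : List A) → length (filter P? v) ≡ ∑L v (𝟙 ∘ P?)
  length-filter P? [] = refl
  length-filter P? (x ∷ v) with P? x
  ... | yes _ = cong suc (length-filter P? v)
  ... | no _ = length-filter P? v

  numberOfCopies-∑ : ∀ {s t m n} (A : BinaryMatrix s t) (M : BinaryMatrix m n) →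
    numberOfCopies A M ≡ ∑L (allVecs m s) (λ r → ∑L (allVecs n t) (λ c → 𝟙 (isCopy? A M (r , c))))
  numberOfCopies-∑ {s} {t} {m} {n} A M = trans (length-filter (isCopy? A M) (cartesianProduct (allVecs m s) (allVecs n t)))
    (∑L-cartesian _,_ (allVecs m s) (allVecs n t) (λ P → 𝟙 (isCopy? A M P)))

  transpose : ∀ {s t} → BinaryMatrix s t → BinaryMatrix t s
  transpose A i j = A j i

  numberOfCopies-transpose : ∀ {s t m n} (A : BinaryMatrix s t) (M : BinaryMatrix m n) →
    numberOfCopies (transpose A) (transpose M) ≤ numberOfCopies A M
  numberOfCopies-transpose {s} {t} {m} {n} A M = begin
    numberOfCopies (transpose A) (transpose M)
      ≡⟨ numberOfCopies-∑ (transpose A) (transpose M) ⟩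
    ∑L (allVecs n t) (λ c → ∑L (allVecs m s) (λ r → 𝟙 (isCopy? (transpose A) (transpose M) (c , r))))
      ≡⟨ ∑L-comm (allVecs n t) (allVecs m s) _ ⟩
    ∑L (allVecs m s) (λ r → ∑L (allVecs n t) (λ c → 𝟙 (isCopy? (transpose A) (transpose M) (c , r))))
      ≤⟨ ∑L-mono (allVecs m s) (λ {r} _ → ∑L-mono (allVecs n t) (λ {c} _ → 𝟙-mono (isCopy? (transpose A) (transpose M) (c , r)) (isCopy? A M (r , c))
           (λ (ic , ir , e) → ir , ic , λ i j → e j i))) ⟩
    ∑L (allVecs m s) (λ r → ∑L (allVecs n t) (λ c → 𝟙 (isCopy? A M (r , c))))
      ≡⟨ numberOfCopies-∑ A M ⟨
    numberOfCopies A M ∎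

  AllPairs-lookup : ∀ {A : Set} {R : A → A → Set} {s} (v : Vec A s) → AllPairs R (toList v) →
                    ∀ i j → i Fin.< j → R (lookup v i) (lookup v j)
  AllPairs-lookup (x ∷ v) (p ∷ ps) zero (suc j) _ = All-lookup v p j
    where
    All-lookup : ∀ {A : Set} {P : A → Set} {s} (v : Vec A s) → All P (toList v) → ∀ i → P (lookup v i)
    All-lookup (x ∷ v) (p ∷ ps) zero = p
    All-lookup (x ∷ v) (p ∷ ps) (suc i) = All-lookup v ps i
  AllPairs-lookup (x ∷ v) (p ∷ ps) (suc i) (suc j) (s≤s i<j) = AllPairs-lookup v ps i j i<j

  map-lookup : ∀ {A B : Set} {s} (v : Vec A s) {f : A → B} {g : Fin s → B} →
               map f (toList v) ≡ List.tabulate g → ∀ i → f (lookup v i) ≡ g i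
  map-lookup (x ∷ v) e zero = List.∷-injectiveˡ e
  map-lookup (x ∷ v) e (suc i) = map-lookup v (List.∷-injectiveʳ e) i

  bits : ∀ {m n} → BinaryMatrix m n → Fin m → Fin n → Bool
  bits A i j = bit (A i j)

  rowsOf : ∀ {s t} → BinaryMatrix s t → Fin s → List Bool
  rowsOf A i = List.tabulate (bits A i)

  ∑Copies≤ : ∀ {s t n} (A : BinaryMatrix s t) (M : BinaryMatrix n n) → let open ListCopies (bits M) (rowsOf A) in
             ∑ℓ s (λ ρ → ∑ℓ t (λ γ → 𝟙 (copy? ρ γ))) ≤ numberOfCopies A M
  ∑Copies≤ {s} {t} {n} A M = begin
    ∑ℓ s (λ ρ → ∑ℓ t (λ γ → 𝟙 (copy? ρ γ)))
      ≡⟨ ∑L-allVecs s (λ ρ → ∑ℓ t (λ γ → 𝟙 (copy? ρ γ))) ⟨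
    ∑L (allVecs n s) (λ r → ∑ℓ t (λ γ → 𝟙 (copy? (toList r) γ)))
      ≡⟨ ∑L-cong (allVecs n s) (λ r → ∑L-allVecs t (λ γ → 𝟙 (copy? (toList r) γ))) ⟨
    ∑L (allVecs n s) (λ r → ∑L (allVecs n t) (λ c → 𝟙 (copy? (toList r) (toList c))))
      ≤⟨ ∑L-mono (allVecs n s) (λ {r} _ → ∑L-mono (allVecs n t) (λ {c} _ → 𝟙-mono (copy? (toList r) (toList c)) (isCopy? A M (r , c)) (isCopy r c))) ⟩
    ∑L (allVecs n s) (λ r → ∑L (allVecs n t) (λ c → 𝟙 (isCopy? A M (r , c))))
      ≡⟨ numberOfCopies-∑ A M ⟨
    numberOfCopies A M ∎
    where
    open ListCopies (bits M) (rowsOf A)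
    isCopy : ∀ r c → Copy (toList r) (toList c) → IsCopy A M (r , c)
    isCopy r c (ir , ic , e) = AllPairs-lookup r ir , AllPairs-lookup c ic ,
      λ i j → bit-injective (map-lookup c (map-lookup r e i) j)

  sum-∑ℓ : ∀ {m n} t (f : Fin m → List (Fin n) → ℕ) → sum (λ x → ∑ℓ t (f x)) ≡ ∑ℓ t (λ v → sum (λ x → f x v))
  sum-∑ℓ zero f = refl
  sum-∑ℓ (suc t) f = trans (sum-comm _) (sum-cong (λ y → sum-∑ℓ t (λ x → f x ∘ (y ∷_))))

  ∑ℓ-comm : ∀ {m n} s t (f : List (Fin m) → List (Fin n) → ℕ) →
            ∑ℓ s (λ u → ∑ℓ t (f u)) ≡ ∑ℓ t (λ v → ∑ℓ s (λ u → f u v))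
  ∑ℓ-comm zero t f = refl
  ∑ℓ-comm (suc s) t f = trans (sum-cong (λ x → ∑ℓ-comm s t (f ∘ (x ∷_)))) (sum-∑ℓ t _)

  -- Each list counted by `Heavy⇒many` carries `b′ ^ s` copies on its sorted columns, and sorting
  -- merges at most `t !` lists into one.
  heavy⇒copies : ∀ {s′ t′ n} b′ Λ Γ Δ (A : BinaryMatrix (suc s′) (suc t′)) (M : BinaryMatrix n n) →
    RowTypes.Heavy (bits M) (rowsOf A) t′ b′ Λ Γ Δ (suc t′) [] →
    n ^ suc t′ * b′ ^ suc s′ ≤ Δ ^ suc t′ * suc t′ ! * numberOfCopies A M
  heavy⇒copies {s′} {t′} {n} b′ Λ Γ Δ A M heavy = begin
    n ^ t * b′ ^ s
      ≤⟨ *-monoˡ-≤ (b′ ^ s) (Heavy⇒many t [] heavy) ⟩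
    Δ ^ t * ∑ℓ t (λ v → 𝟙 (many? (v ++ []))) * b′ ^ s
      ≡⟨ *-assoc (Δ ^ t) _ _ ⟩
    Δ ^ t * (∑ℓ t (λ v → 𝟙 (many? (v ++ []))) * b′ ^ s)
      ≡⟨ cong (Δ ^ t *_) (trans (*-comm _ (b′ ^ s)) (sym (∑ℓ-* t (b′ ^ s) (λ v → 𝟙 (many? (v ++ [])))))) ⟩
    Δ ^ t * ∑ℓ t (λ v → b′ ^ s * 𝟙 (many? (v ++ [])))
      ≤⟨ *-monoʳ-≤ (Δ ^ t) (∑ℓ-mono t (λ v _ → counted v)) ⟩
    Δ ^ t * ∑ℓ t (λ v → copiesOn (sort′ v))
      ≤⟨ *-monoʳ-≤ (Δ ^ t) (∑ℓ-sort t copiesOn) ⟩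
    Δ ^ t * (t ! * ∑ℓ t copiesOn)
      ≤⟨ *-monoʳ-≤ (Δ ^ t) (*-monoʳ-≤ (t !) (≤-trans (≤-reflexive (∑ℓ-comm t s (λ γ ρ → 𝟙 (copy? ρ γ)))) (∑Copies≤ A M))) ⟩
    Δ ^ t * (t ! * numberOfCopies A M)
      ≡⟨ *-assoc (Δ ^ t) (t !) _ ⟨
    Δ ^ t * t ! * numberOfCopies A M ∎
    where
    s = suc s′
    t = suc t′
    open ListCopies (bits M) (rowsOf A)
    open RowTypes (bits M) (rowsOf A) t′ b′ Λ Γ Δ using (Heavy⇒many)
    many? : ∀ c → Dec (b′ ^ s ≤ copiesOn (sort′ c))
    many? c = b′ ^ s ℕ.≤? copiesOn (sort′ c)
    counted : ∀ v → b′ ^ s * 𝟙 (many? (v ++ [])) ≤ copiesOn (sort′ v)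
    counted v rewrite List.++-identityʳ v with b′ ^ s ℕ.≤? copiesOn (sort′ v)
    ... | yes p = ≤-trans (≤-reflexive (*-identityʳ _)) p
    ... | no _ = ≤-trans (≤-reflexive (*-zeroʳ (b′ ^ s))) z≤n

  at-most-one : ∀ {A : Set} {L : List A} {P : A → Set} (P? : Decidable P) → Unique L →
                (∀ {x y} → x ∈ L → y ∈ L → P x → P y → x ≡ y) → ∑L L (𝟙 ∘ P?) ≤ 1
  at-most-one {L = []} P? _ h = z≤n
  at-most-one {L = x ∷ L} P? (x≢ ∷ u) h with P? x
  ... | no _ = at-most-one P? u (λ p q → h (there p) (there q))
  ... | yes p = s≤s (≤-trans (∑L-mono L (λ {y} y∈ → ≤-reflexive (𝟙-no (P? y) (λ q →
                  All.lookup x≢ y∈ (h (here refl) (there y∈) p q))))) (≤-reflexive (∑L-zero L)))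

  covers? : ∀ {s t m n} (P : Location s t m n) x y → Dec (Covers P x y)
  covers? (r , c) x y = Vec.any? (x Fin.≟_) r ×-dec Vec.any? (y Fin.≟_) c

  -- An entry lies in at most one copy of `L`, so hitting all of them would take at least `length L`
  -- deleted entries.
  undeleted-copy : ∀ {s t m n} {Del : Fin m → Fin n → Set} (del? : ∀ x y → Dec (Del x y)) (L : List (Location s t m n)) →
    Unique L → PairwiseDisjoint L → sum (λ x → sum (λ y → 𝟙 (del? x y))) < length L →
    ∃[ P ] P ∈ L × (∀ i j → ¬ Del (lookup (proj₁ P) i) (lookup (proj₂ P) j))
  undeleted-copy {Del = Del} del? L uniq disj lt with Any.any? (λ P → Fin.all? λ i → Fin.all? λ j → ¬? (del? (lookup (proj₁ P) i) (lookup (proj₂ P) j))) L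
  ... | yes found = find found
  ... | no none = contradiction (begin
    length L
      ≡⟨ length-∑L L ⟩
    ∑L L (λ _ → 1)
      ≤⟨ ∑L-mono L hit ⟩
    ∑L L (λ P → sum (λ x → sum (λ y → 𝟙 (del? x y) * 𝟙 (covers? P x y))))
      ≡⟨ ∑L-sum L _ ⟨
    sum (λ x → ∑L L (λ P → sum (λ y → 𝟙 (del? x y) * 𝟙 (covers? P x y))))
      ≡⟨ sum-cong (λ x → trans (sym (∑L-sum L _)) (sum-cong (λ y → ∑L-* (𝟙 (del? x y)) L _))) ⟩
    sum (λ x → sum (λ y → 𝟙 (del? x y) * ∑L L (λ P → 𝟙 (covers? P x y))))
      ≤⟨ sum-mono (λ x → sum-mono (λ y → *-monoʳ-≤ (𝟙 (del? x y)) (at-most-one (λ P → covers? P x y) uniq (disj x y)))) ⟩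
    sum (λ x → sum (λ y → 𝟙 (del? x y) * 1))
      ≡⟨ sum-cong (λ x → sum-cong (λ y → *-identityʳ _)) ⟩
    sum (λ x → sum (λ y → 𝟙 (del? x y))) ∎) (<⇒≱ lt)
    where
    length-∑L : ∀ {A : Set} (v : List A) → length v ≡ ∑L v (λ _ → 1)
    length-∑L [] = refl
    length-∑L (x ∷ v) = cong suc (length-∑L v)
    hit : ∀ {P} → P ∈ L → 1 ≤ sum (λ x → sum (λ y → 𝟙 (del? x y) * 𝟙 (covers? P x y)))
    hit {P@(r , c)} P∈ =
      let i , ¬i = Fin.¬∀⟶∃¬ _ _ (λ i → Fin.all? λ j → ¬? (del? (lookup r i) (lookup c j)))
                     (λ all → none (Any.map (λ { refl → all }) P∈))
          j , ¬j = Fin.¬∀⟶∃¬ _ _ (λ j → ¬? (del? (lookup r i) (lookup c j))) ¬i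
          x = lookup r i
          y = lookup c j
      in begin
        1 ≡⟨ cong₂ _*_ (𝟙-yes (del? x y) (decidable-stable (del? x y) ¬j))
                (𝟙-yes (covers? P x y) (Vec.∈-lookup i r , Vec.∈-lookup j c)) ⟨
        𝟙 (del? x y) * 𝟙 (covers? P x y) ≤⟨ term≤sum (λ y → 𝟙 (del? x y) * 𝟙 (covers? P x y)) y ⟩
        sum (λ y → 𝟙 (del? x y) * 𝟙 (covers? P x y)) ≤⟨ term≤sum (λ x → sum (λ y → 𝟙 (del? x y) * 𝟙 (covers? P x y))) x ⟩
        sum (λ x → sum (λ y → 𝟙 (del? x y) * 𝟙 (covers? P x y))) ∎

  𝟙-∃ : ∀ {D} {P : Fin D → Set} (P? : Decidable P) → 𝟙 (Fin.any? P?) ≤ sum (λ e → 𝟙 (P? e))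
  𝟙-∃ P? with Fin.any? P?
  ... | yes (e , p) = ≤-trans (≤-reflexive (sym (𝟙-yes (P? e) p))) (term≤sum (𝟙 ∘ P?) e)
  ... | no _ = z≤n

  -- If the empty list of columns is heavy, copies abound already; if not, the greedy picking can
  -- start from it.
  typesOrCopies : ∀ {s′ t′ n} (A : BinaryMatrix (suc s′) (suc t′)) (M : BinaryMatrix n n) → ∀ {K} b′ Λ Γ Δ →
    let s = suc s′; t = suc t′; d = s ^ s * t; Q = suc (Γ * Λ) in
    0 < b′ → s * b′ ≤ n → n < b′ * 2 ^ Λ → Γ * (t * Q ^ t′) ≤ Δ →
    Γ * (Q * (2 * (s * b′) * Q ^ d)) ≤ n → Q ^ d ≤ K → 0 < K →
    Types (bits M) K Γ ⊎ n ^ t * b′ ^ s ≤ Δ ^ t * t ! * numberOfCopies A M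
  typesOrCopies {s′} {t′} {n} A M {K} b′ Λ Γ Δ 0<b′ sb′≤n n< ΓΔ Γn Q≤K 0<K = go (Heavy? (suc t′) [])
    where
    open RowTypes (bits M) (rowsOf A) t′ b′ Λ Γ Δ
    n<′ : n < suc s′ * b′ * 2 ^ Λ
    n<′ = <-≤-trans n< (*-monoˡ-≤ (2 ^ Λ) (m≤m+n b′ (s′ * b′)))
    go : Dec (Heavy (suc t′) []) → _
    go (yes heavy) = inj₂ (heavy⇒copies b′ Λ Γ Δ A M heavy)
    go (no light) = inj₁ (rowTypes 0<b′ sb′≤n n<′ (λ i → List.length-tabulate (bits A i)) ΓΔ Γn Q≤K 0<K light)

  -- From a block structure and disjoint copies to many copies.

  module BlocksToCopies {s′ t′ n K Γ : ℕ} (A : BinaryMatrix (suc s′) (suc t′)) (M : BinaryMatrix n n)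
                        (bl : Blocks (bits M) K Γ) (κ k h₀ θ D Z : ℕ) where

    s t B′ B U den H : ℕ
    s = suc s′
    t = suc t′
    B′ = s′ + t
    B = suc B′
    -- The deletions will amount to at most `7 / U` of the matrix, just below the share `1 / Z` of
    -- the given copies.
    U = 8 * Z
    -- Passing to a part with a share of at least `1 / κ` on each side raises the error density by
    -- at most `κ * κ`, to `1 / (2 * (s * t))`.
    den = 2 * (s * t) * (κ * κ)
    H = D + h₀

    open Blocks bl

    module R = Exclusion B′ rowLabel κ k h₀ θ D
    module C = Exclusion B′ colLabel κ k h₀ θ D

    module Cells (a : Fin n → Fin K) where
      open Exclusion B′ a κ k h₀ θ D using (idx; idx≤toℕ; node?; nodeSize)

      lvl : Fin D → ℕ
      lvl e = suc (toℕ e + h₀)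

      -- Type and interval as one label, so that `Density` applies. The number of an interval never
      -- exceeds that of a row in it, so `n` values suffice.
      cell : Fin D → Fin n → Fin (K * n)
      cell e r = combine (a r) (fromℕ< (≤-<-trans (idx≤toℕ (lvl e) r) (Fin.toℕ<n r)))

      cell-cong : ∀ e {x r} → a x ≡ a r → idx (lvl e) x ≡ idx (lvl e) r → cell e x ≡ cell e r
      cell-cong e p q = cong₂ combine p (Fin.fromℕ<-cong _ _ q _ _)

      cell-injective : ∀ e {x r} → cell e x ≡ cell e r → a x ≡ a r × idx (lvl e) x ≡ idx (lvl e) r
      cell-injective e {x} {r} p with Fin.combine-injective (a x) _ (a r) _ p
      ... | q , q′ = q , Fin.fromℕ<-injective _ _ _ _ q′

      cell-size : ∀ e r → # (λ x → cell e x Fin.≟ cell e r) ≡ nodeSize (lvl e) r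
      cell-size e r = #-cong (λ x → cell e x Fin.≟ cell e r) (node? (lvl e) (a r) (idx (lvl e) r))
        (λ x → cell-injective e) (λ x (p , q) → cell-cong e p q)

    module RC = Cells rowLabel
    module CC = Cells colLabel

    module _ (e f : Fin D) where
      open Density (RC.cell e) (CC.cell f) error? den public

    -- The levels for rows and for columns are found separately, may differ, and are known only
    -- after a copy has survived. Hence dense cells are deleted for all `D * D` pairs of levels in
    -- advance.
    DenseSomewhere : Fin n → Fin n → Set
    DenseSomewhere r c = ∃[ e ] ∃[ f ] area e f (RC.cell e r) (CC.cell f c) < den * errors e f (RC.cell e r) (CC.cell f c)

    denseSomewhere? : ∀ r c → Dec (DenseSomewhere r c)
    denseSomewhere? r c = Fin.any? λ e → Fin.any? λ f → dense? e f r c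

    Deleted : Fin n → Fin n → Set
    Deleted r c = R.Excluded r ⊎ C.Excluded c ⊎ Error r c ⊎ DenseSomewhere r c

    deleted? : ∀ r c → Dec (Deleted r c)
    deleted? r c = R.excluded? r ⊎-dec (C.excluded? c ⊎-dec (error? r c ⊎-dec denseSomewhere? r c))

    errorCount : ℕ
    errorCount = sum (λ r → sum (λ c → 𝟙 (error? r c)))

    denseSomewhere-few : sum (λ r → sum (λ c → 𝟙 (denseSomewhere? r c))) ≤ D * (D * (den * errorCount))
    denseSomewhere-few = begin
      sum (λ r → sum (λ c → 𝟙 (denseSomewhere? r c)))
        ≤⟨ sum-mono (λ r → sum-mono (λ c → ≤-trans (𝟙-∃ (λ e → Fin.any? (λ f → dense? e f r c))) (sum-mono (λ e → 𝟙-∃ (λ f → dense? e f r c))))) ⟩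
      sum (λ r → sum (λ c → sum (λ e → sum (λ f → 𝟙 (dense? e f r c)))))
        ≡⟨ trans (sum-cong (λ r → sum-comm _)) (sum-comm _) ⟩
      sum (λ e → sum (λ r → sum (λ c → sum (λ f → 𝟙 (dense? e f r c)))))
        ≡⟨ sum-cong (λ e → trans (sum-cong (λ r → sum-comm _)) (sum-comm _)) ⟩
      sum (λ e → sum (λ f → sum (λ r → sum (λ c → 𝟙 (dense? e f r c)))))
        ≤⟨ sum-bound (λ e → sum-bound (λ f → dense-few e f)) ⟩
      D * (D * (den * errorCount)) ∎

    module _ .{{K≢0 : NonZero K}} .{{D≢0 : NonZero D}} .{{κ≢0 : NonZero κ}} .{{k≢0 : NonZero k}}
             (n≤ : n ≤ B ^ H) (≤Bn : B ^ H ≤ B * n) (Uκ : U * (D * B) ≤ κ)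
             (Uk : U * (K * (B′ ^ k * B)) ≤ B ^ k) (Uθ : U * (K * B ^ D) ≤ θ)
             (UΓ : U * (1 + D * (D * den)) * 12 ≤ Γ) (sk≤D : s * k ≤ D) (tk≤D : t * k ≤ D) where

      B′≢0 : NonZero B′
      B′≢0 = >-nonZero (≤-trans (s≤s z≤n) (m≤n+m t s′))

      -- Excluded rows and excluded columns cost `3` each; by the size of `Γ`, errors and dense
      -- cells together cost `1`.
      deleted-few : U * sum (λ r → sum (λ c → 𝟙 (deleted? r c))) ≤ 7 * (n * n)
      deleted-few = begin
        U * sum (λ r → sum (λ c → 𝟙 (deleted? r c)))
          ≤⟨ *-monoʳ-≤ U (sum-mono (λ r → sum-mono (λ c → pointwise r c))) ⟩
        U * sum (λ r → sum (λ c → 𝟙 (R.excluded? r) + (𝟙 (C.excluded? c) + (𝟙 (error? r c) + 𝟙 (denseSomewhere? r c)))))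
          ≡⟨ cong (U *_) (trans (sum-cong (λ r → trans (sum-+ _ _) (cong₂ _+_ (sum-const n _)
               (trans (sum-+ _ _) (cong₂ _+_ (sym (#-def C.excluded?)) (sum-+ _ _)))))) (trans (sum-+ _ _)
               (cong₂ _+_ (trans (sym (*-sum n _)) (cong (n *_) (sym (#-def R.excluded?))))
                 (trans (sum-+ _ _) (cong₂ _+_ (sum-const n _) (sum-+ _ _)))))) ⟩
        U * (n * # R.excluded? + (n * # C.excluded? + (errorCount + sum (λ r → sum (λ c → 𝟙 (denseSomewhere? r c))))))
          ≤⟨ *-monoʳ-≤ U (+-monoʳ-≤ (n * # R.excluded?) (+-monoʳ-≤ (n * # C.excluded?) (+-monoʳ-≤ errorCount denseSomewhere-few))) ⟩
        U * (n * # R.excluded? + (n * # C.excluded? + (errorCount + D * (D * (den * errorCount)))))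
          ≡⟨ regroup U n (# R.excluded?) (# C.excluded?) errorCount D den ⟩
        n * (U * # R.excluded?) + (n * (U * # C.excluded?) + U * (1 + D * (D * den)) * errorCount)
          ≤⟨ +-mono-≤ (*-monoʳ-≤ n (R.excluded-few U {{K≢0}} {{D≢0}} {{B′≢0}} n≤ ≤Bn Uκ Uk Uθ))
               (+-mono-≤ (*-monoʳ-≤ n (C.excluded-few U {{K≢0}} {{D≢0}} {{B′≢0}} n≤ ≤Bn Uκ Uk Uθ))
                 (cancel-scale {U = U * (1 + D * (D * den))} {c = 12} UΓ few)) ⟩
        n * (3 * n) + (n * (3 * n) + n * n)
          ≡⟨ seven n ⟩
        7 * (n * n) ∎
        where
        regroup : ∀ U n x y e D den → U * (n * x + (n * y + (e + D * (D * (den * e))))) ≡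
                  n * (U * x) + (n * (U * y) + U * (1 + D * (D * den)) * e)
        regroup = solve-∀
        seven : ∀ n → n * (3 * n) + (n * (3 * n) + n * n) ≡ 7 * (n * n)
        seven = solve-∀
        pointwise : ∀ r c → 𝟙 (deleted? r c) ≤ 𝟙 (R.excluded? r) + (𝟙 (C.excluded? c) + (𝟙 (error? r c) + 𝟙 (denseSomewhere? r c)))
        pointwise r c = ≤-trans (𝟙-∪ (deleted? r c) (R.excluded? r) (C.excluded? c ⊎-dec (error? r c ⊎-dec denseSomewhere? r c)) id)
          (+-monoʳ-≤ (𝟙 (R.excluded? r)) (≤-trans (𝟙-∪ (C.excluded? c ⊎-dec (error? r c ⊎-dec denseSomewhere? r c)) (C.excluded? c) (error? r c ⊎-dec denseSomewhere? r c) id)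
            (+-monoʳ-≤ (𝟙 (C.excluded? c)) (𝟙-∪ (error? r c ⊎-dec denseSomewhere? r c) (error? r c) (denseSomewhere? r c) id))))

      module Moved (r : Vec (Fin n) s) (c : Vec (Fin n) t) (copy : IsCopy A M (r , c))
                   (kept : ∀ i j → ¬ Deleted (lookup r i) (lookup c j)) where

        rowSel : R.Selection (lookup r)
        rowSel = R.select (lookup r) sk≤D (s≤s (m≤m+n s′ t)) (λ {i} {j} → proj₁ copy i j) (λ i → kept i zero ∘ inj₁)

        colSel : C.Selection (lookup c)
        colSel = C.select (lookup c) tk≤D (m≤n+m t (suc s′)) (λ {i} {j} → proj₁ (proj₂ copy) i j) (λ j → kept zero j ∘ inj₂ ∘ inj₁)

        module RS = R.Selection rowSel
        module CS = C.Selection colSel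

        value : ∀ i j {x y} → RS.R i x → CS.R j y → ¬ Error x y → bits M x y ≡ bits A i j
        value i j p q ok = trans (agree (proj₁ (RS.R⊆block i p)) (proj₁ (CS.R⊆block j q)) ok (kept i j ∘ inj₂ ∘ inj₂ ∘ inj₁))
                                 (cong bit (proj₂ (proj₂ copy) i j))

        sparse : ∀ i j → 2 * (s * t) * sum (λ x → 𝟙 (RS.R? i x) * sum (λ y → 𝟙 (CS.R? j y) * 𝟙 (error? x y))) ≤ # (RS.R? i) * # (CS.R? j)
        sparse i j = *-cancelˡ-≤ (κ * κ) {{m*n≢0 κ κ}} (begin
          κ * κ * (2 * (s * t) * X)
            ≡⟨ *-x∙yz≈yx∙z (κ * κ) (2 * (s * t)) X ⟩
          den * X
            ≤⟨ *-monoʳ-≤ den (sum-mono (λ x → *-mono-≤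
                 (𝟙-mono (RS.R? i x) (RC.cell e x Fin.≟ RC.cell e r₀) (λ p → RC.cell-cong e (proj₁ (RS.R⊆block i p)) (proj₂ (RS.R⊆block i p))))
                 (sum-mono (λ y → *-monoˡ-≤ (𝟙 (error? x y))
                   (𝟙-mono (CS.R? j y) (CC.cell f y Fin.≟ CC.cell f c₀) (λ p → CC.cell-cong f (proj₁ (CS.R⊆block j p)) (proj₂ (CS.R⊆block j p)))))))) ⟩
          den * errors e f (RC.cell e r₀) (CC.cell f c₀)
            ≤⟨ ≮⇒≥ (λ dense → kept i j (inj₂ (inj₂ (inj₂ (e , f , dense))))) ⟩
          area e f (RC.cell e r₀) (CC.cell f c₀)
            ≡⟨ cong₂ _*_ (RC.cell-size e r₀) (CC.cell-size f c₀) ⟩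
          R.nodeSize (RC.lvl e) r₀ * C.nodeSize (CC.lvl f) c₀
            ≤⟨ *-mono-≤ (RS.R-large i) (CS.R-large j) ⟩
          κ * # (RS.R? i) * (κ * # (CS.R? j))
            ≡⟨ lemma′ κ (# (RS.R? i)) (# (CS.R? j)) ⟩
          κ * κ * (# (RS.R? i) * # (CS.R? j)) ∎)
          where
          e = RS.level
          f = CS.level
          r₀ = lookup r i
          c₀ = lookup c j
          X = sum (λ x → 𝟙 (RS.R? i x) * sum (λ y → 𝟙 (CS.R? j y) * 𝟙 (error? x y)))
          lemma′ : ∀ a b c → a * b * (a * c) ≡ a * a * (b * c)
          lemma′ = solve-∀

        open ProductCount (bits M) (bits A) error? RS.R? (λ {i} {j} → RS.separated {i} {j})
                          CS.R? (λ {i} {j} → CS.separated {i} {j}) value sparse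

        rows-large : ∀ i → n ≤ κ * θ * # (RS.R? i)
        rows-large i = ≤-trans (RS.large i) (≤-trans (*-monoˡ-≤ θ (RS.R-large i)) (≤-reflexive (*-xy∙z≈xz∙y κ (# (RS.R? i)) θ)))

        cols-large : ∀ j → n ≤ κ * θ * # (CS.R? j)
        cols-large j = ≤-trans (CS.large j) (≤-trans (*-monoˡ-≤ θ (CS.R-large j)) (≤-reflexive (*-xy∙z≈xz∙y κ (# (CS.R? j)) θ)))

        many : n ^ (s + t) ≤ 2 * (κ * θ) ^ (s + t) * numberOfCopies A M
        many = begin
          n ^ (s + t) ≡⟨ ^-distribˡ-+-* n s t ⟩
          n ^ s * n ^ t ≤⟨ *-mono-≤ (∑Π-large n F s RS.R? rows-large) (∑Π-large n F t CS.R? cols-large) ⟩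
          F ^ s * ΠR * (F ^ t * ΠC) ≡⟨ *-interchange (F ^ s) ΠR (F ^ t) ΠC ⟩
          F ^ s * F ^ t * (ΠR * ΠC) ≡⟨ cong (_* (ΠR * ΠC)) (^-distribˡ-+-* F s t) ⟨
          F ^ (s + t) * (ΠR * ΠC) ≤⟨ *-monoʳ-≤ (F ^ (s + t)) (≤-trans product-count (*-monoʳ-≤ 2 (∑Copies≤ A M))) ⟩
          F ^ (s + t) * (2 * numberOfCopies A M) ≡⟨ *-x∙yz≈yx∙z (F ^ (s + t)) 2 (numberOfCopies A M) ⟩
          2 * F ^ (s + t) * numberOfCopies A M ∎
          where
          F = κ * θ

      blocks⇒copies : 0 < n → (L : List (Location s t n n)) → Unique L → All (IsCopy A M) L → PairwiseDisjoint L →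
                      n * n ≤ Z * length L → n ^ (s + t) ≤ 2 * (κ * θ) ^ (s + t) * numberOfCopies A M
      blocks⇒copies 0<n L uniq allCopies disj n²≤ =
        let (r , c) , P∈ , kept = undeleted-copy deleted? L uniq disj fewer
        in Moved.many r c (All.lookup allCopies P∈) kept
        where
        fewer : sum (λ r → sum (λ c → 𝟙 (deleted? r c))) < length L
        fewer = *-cancelˡ-< U _ _ (begin-strict
          U * sum (λ r → sum (λ c → 𝟙 (deleted? r c))) ≤⟨ deleted-few ⟩
          7 * (n * n) <⟨ *-monoˡ-< (n * n) {{m*n≢0 n n {{>-nonZero 0<n}} {{>-nonZero 0<n}}}} {7} {8} ≤-refl ⟩
          8 * (n * n) ≤⟨ *-monoʳ-≤ 8 n²≤ ⟩
          8 * (Z * length L) ≡⟨ *-assoc 8 Z (length L) ⟨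
          U * length L ∎)

  -- Parameters

  n≤2^n : ∀ n → n ≤ 2 ^ n
  n≤2^n zero = z≤n
  n≤2^n (suc n) = begin
    suc n ≤⟨ +-mono-≤ (m^n>0 2 n) (n≤2^n n) ⟩
    2 ^ n + 2 ^ n ≡⟨ cong (2 ^ n +_) (+-identityʳ (2 ^ n)) ⟨
    2 ^ suc n ∎

  m≤m*g : ∀ m {g} → 1 ≤ g → m ≤ m * g
  m≤m*g m 1≤g = ≤-trans (≤-reflexive (sym (*-identityʳ m))) (*-monoʳ-≤ m 1≤g)

  Dominated : ℕ → Set
  Dominated a = ∃[ C ] 1 ≤ C × (∀ g → 1 ≤ g → 2 ^ (a * g) * (C * g) ^ a ≤ 2 ^ (C * g))

  -- With `C = 2 ^ e` the left side is at most `2 ^ (a * (e + 2) * g)`; for the `e` chosen, linear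
  -- in `a`, the quadratic `a * (e + 2)` is below `2 ^ e`.
  exponential-dominates : ∀ a → Dominated a
  exponential-dominates a = C , m^n>0 2 e , λ g 1≤g → begin
    2 ^ (a * g) * (C * g) ^ a ≤⟨ *-monoʳ-≤ (2 ^ (a * g)) (^-monoˡ-≤ a (*-monoʳ-≤ C (n≤2^n g))) ⟩
    2 ^ (a * g) * (2 ^ e * 2 ^ g) ^ a ≡⟨ cong (λ z → 2 ^ (a * g) * z ^ a) (^-distribˡ-+-* 2 e g) ⟨
    2 ^ (a * g) * (2 ^ (e + g)) ^ a ≡⟨ cong (2 ^ (a * g) *_) (^-*-assoc 2 (e + g) a) ⟩
    2 ^ (a * g) * 2 ^ ((e + g) * a) ≡⟨ ^-distribˡ-+-* 2 (a * g) _ ⟨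
    2 ^ (a * g + (e + g) * a) ≤⟨ ^-monoʳ-≤ 2 (≤-trans (+-monoʳ-≤ (a * g) (*-monoˡ-≤ a (+-monoˡ-≤ g (m≤m*g e 1≤g)))) (≤-reflexive (lemma a g e))) ⟩
    2 ^ (a * (e + 2) * g) ≤⟨ ^-monoʳ-≤ 2 (*-monoˡ-≤ g a[e+2]≤C) ⟩
    2 ^ (C * g) ∎
    where
    e = a + (a + 4)
    C = 2 ^ e
    lemma : ∀ a g e → a * g + (e * g + g) * a ≡ a * (e + 2) * g
    lemma = solve-∀
    a[e+2]≤C : a * (e + 2) ≤ 2 ^ e
    a[e+2]≤C = begin
      a * (e + 2) ≡⟨ cong (a *_) (lemma₁ a) ⟩
      a * (2 * a + 6) ≤⟨ *-mono-≤ (n≤2^n a) (+-mono-≤ (*-monoʳ-≤ 2 (n≤2^n a)) (m≤m+n 6 8)) ⟩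
      2 ^ a * (2 * 2 ^ a + 14) ≤⟨ *-monoʳ-≤ (2 ^ a) (+-monoʳ-≤ (2 * 2 ^ a) (*-monoʳ-≤ 14 (m^n>0 2 a))) ⟩
      2 ^ a * (2 * 2 ^ a + 14 * 2 ^ a) ≡⟨ cong (2 ^ a *_) (lemma₂ (2 ^ a)) ⟩
      2 ^ a * (2 ^ a * 2 ^ 4) ≡⟨ cong (2 ^ a *_) (^-distribˡ-+-* 2 a 4) ⟨
      2 ^ a * 2 ^ (a + 4) ≡⟨ ^-distribˡ-+-* 2 a (a + 4) ⟨
      2 ^ e ∎
      where
      lemma₁ : ∀ a → a + (a + 4) + 2 ≡ 2 * a + 6
      lemma₁ = solve-∀
      lemma₂ : ∀ x → 2 * x + 14 * x ≡ x * 16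
      lemma₂ = solve-∀

  -- `ExpLinear` means polynomially bounded in `2 ^ g`. The restriction to `1 ≤ g` lets additive
  -- constants be absorbed.
  Linear ExpLinear : (ℕ → ℕ) → Set
  Linear f = ∃[ C ] ∀ g → 1 ≤ g → f g ≤ C * g
  ExpLinear f = ∃[ C ] ∀ g → 1 ≤ g → f g ≤ 2 ^ (C * g)

  lin-id : Linear id
  lin-id = 1 , λ g _ → ≤-reflexive (sym (*-identityˡ g))

  lin-const : ∀ k → Linear (λ _ → k)
  lin-const k = k , λ g → m≤m*g k

  lin-+ : ∀ {f h} → Linear f → Linear h → Linear (λ g → f g + h g)
  lin-+ (C , p) (C′ , q) = C + C′ , λ g 1≤g → ≤-trans (+-mono-≤ (p g 1≤g) (q g 1≤g)) (≤-reflexive (sym (*-distribʳ-+ g C C′)))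

  lin-* : ∀ k {f} → Linear f → Linear (λ g → k * f g)
  lin-* k (C , p) = k * C , λ g 1≤g → ≤-trans (*-monoʳ-≤ k (p g 1≤g)) (≤-reflexive (sym (*-assoc k C g)))

  exp-^ : ∀ b {f} → Linear f → ExpLinear (λ g → b ^ f g)
  exp-^ b {f} (C , p) = b * C , λ g 1≤g → begin
    b ^ f g ≤⟨ ^-monoˡ-≤ (f g) (n≤2^n b) ⟩
    (2 ^ b) ^ f g ≡⟨ ^-*-assoc 2 b (f g) ⟩
    2 ^ (b * f g) ≤⟨ ^-monoʳ-≤ 2 (*-monoʳ-≤ b (p g 1≤g)) ⟩
    2 ^ (b * (C * g)) ≡⟨ cong (2 ^_) (*-assoc b C g) ⟨
    2 ^ (b * C * g) ∎

  exp-lin : ∀ {f} → Linear f → ExpLinear f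
  exp-lin {f} l = let C , p = exp-^ 2 l in C , λ g 1≤g → ≤-trans (n≤2^n (f g)) (p g 1≤g)

  exp-const : ∀ k → ExpLinear (λ _ → k)
  exp-const k = exp-lin (lin-const k)

  exp-* : ∀ {f h} → ExpLinear f → ExpLinear h → ExpLinear (λ g → f g * h g)
  exp-* (C , p) (C′ , q) = C + C′ , λ g 1≤g → ≤-trans (*-mono-≤ (p g 1≤g) (q g 1≤g))
    (≤-reflexive (trans (sym (^-distribˡ-+-* 2 (C * g) (C′ * g))) (cong (2 ^_) (sym (*-distribʳ-+ g C C′)))))

  exp-+ : ∀ {f h} → ExpLinear f → ExpLinear h → ExpLinear (λ g → f g + h g)
  exp-+ {f} {h} (C , p) (C′ , q) = 1 + (C + C′) , λ g 1≤g → begin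
    f g + h g ≤⟨ +-mono-≤ (p g 1≤g) (q g 1≤g) ⟩
    2 ^ (C * g) + 2 ^ (C′ * g) ≤⟨ +-mono-≤ (^-monoʳ-≤ 2 (*-monoˡ-≤ g (m≤m+n C C′))) (^-monoʳ-≤ 2 (*-monoˡ-≤ g (m≤n+m C′ C))) ⟩
    2 ^ ((C + C′) * g) + 2 ^ ((C + C′) * g) ≡⟨ cong (2 ^ ((C + C′) * g) +_) (+-identityʳ _) ⟨
    2 ^ (1 + (C + C′) * g) ≤⟨ ^-monoʳ-≤ 2 (+-monoˡ-≤ ((C + C′) * g) 1≤g) ⟩
    2 ^ ((1 + (C + C′)) * g) ∎

  exp-power : ∀ k {f} → ExpLinear f → ExpLinear (λ g → f g ^ k)
  exp-power k {f} (C , p) = C * k , λ g 1≤g → begin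
    f g ^ k ≤⟨ ^-monoˡ-≤ k (p g 1≤g) ⟩
    (2 ^ (C * g)) ^ k ≡⟨ ^-*-assoc 2 (C * g) k ⟩
    2 ^ (C * g * k) ≡⟨ cong (2 ^_) (*-xy∙z≈xz∙y C g k) ⟩
    2 ^ (C * k * g) ∎

  allVecs-complete : ∀ {n s} (v : Vec (Fin n) s) → v ∈ allVecs n s
  allVecs-complete [] = here refl
  allVecs-complete (x ∷ v) = ∈-cartesianProductWith⁺ _∷_ (∈-allFin x) (allVecs-complete v)

  copy⇒positive : ∀ {s t m n} (A : BinaryMatrix s t) (M : BinaryMatrix m n) {P} → IsCopy A M P → 1 ≤ numberOfCopies A M
  copy⇒positive A M {r , c} p = ∈-length (∈-filter⁺ (isCopy? A M) (∈-cartesianProduct⁺ (allVecs-complete r) (allVecs-complete c)) p)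

  some-copy : ∀ {s t n} (A : BinaryMatrix s t) (M : BinaryMatrix n n) Z (L : List (Location s t n n)) → All (IsCopy A M) L →
              n * n ≤ Z * length L → 0 < n → 1 ≤ numberOfCopies A M
  some-copy A M Z [] _ n²≤ 0<n = contradiction
    (≤-trans n²≤ (≤-reflexive (*-zeroʳ Z))) (<⇒≱ (*-mono-≤ 0<n 0<n))
  some-copy A M Z (P ∷ L) (p ∷ _) _ _ = copy⇒positive A M {P} p

  -- The first two terms of the binomial expansion are both `n ^ n`.
  2n^n≤[1+n]^n : ∀ n .{{_ : NonZero n}} → 2 * n ^ n ≤ suc n ^ n
  2n^n≤[1+n]^n n@(suc m) = ≤-trans (≤-reflexive (lemma (n ^ n))) (≤-trans (+-monoʳ-≤ (n ^ n) (≤-refl {n * n ^ m})) (bernoulli m))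
    where
    lemma : ∀ x → 2 * x ≡ x + x
    lemma = solve-∀
    bernoulli : ∀ j → n ^ suc j + suc j * n ^ j ≤ suc n ^ suc j
    bernoulli zero = ≤-reflexive (solve₁ n)
      where solve₁ : ∀ n → n * 1 + 1 * 1 ≡ suc n * 1
            solve₁ = solve-∀
    bernoulli (suc j) = begin
      n * (n * n ^ j) + suc (suc j) * (n * n ^ j) ≤⟨ m≤m+n _ (suc j * n ^ j) ⟩
      n * (n * n ^ j) + suc (suc j) * (n * n ^ j) + suc j * n ^ j ≡⟨ solve₂ n (n ^ j) j ⟩
      suc n * (n * n ^ j + suc j * n ^ j) ≤⟨ *-monoʳ-≤ (suc n) (bernoulli j) ⟩
      suc n ^ suc (suc j) ∎
      where
      solve₂ : ∀ n x j → n * (n * x) + suc (suc j) * (n * x) + suc j * x ≡ suc n * (n * x + suc j * x)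
      solve₂ = solve-∀

  -- Only the top `D` levels of the tree are used, so the height that depends on `n` goes into the
  -- leaves. Stopping at the first sufficient height overshoots `n` by at most a factor `B`.
  height : ∀ B D n → 2 ≤ B → 0 < n → B ^ D ≤ n → ∃[ h ] n ≤ B ^ (D + h) × B ^ (D + h) ≤ B * n
  height B D n 2≤B 0<n B^D≤n = go n (≤-trans (n≤2^n n) (≤-trans (^-monoˡ-≤ n 2≤B) (^-monoʳ-≤ B {{>-nonZero (<-≤-trans (s≤s z≤n) 2≤B)}} (m≤n+m n D))))
    where
    go : ∀ h → n ≤ B ^ (D + h) → ∃[ h ] n ≤ B ^ (D + h) × B ^ (D + h) ≤ B * n
    go zero p = 0 , p , ≤-trans (≤-reflexive (cong (B ^_) (+-identityʳ D))) (≤-trans B^D≤n (m≤n*m n B {{>-nonZero (<-≤-trans (s≤s z≤n) 2≤B)}}))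
    go (suc h) p with ≤-<-connex n (B ^ (D + h))
    ... | inj₁ q = go h q
    ... | inj₂ q = suc h , p , ≤-trans (≤-reflexive (cong (B ^_) (+-suc D h))) (*-monoʳ-≤ B (<⇒≤ q))

  ≤-sum₁ : ∀ a b c d → a ≤ a + b + c + d
  ≤-sum₁ a b c d = ≤-trans (m≤m+n a b) (≤-trans (m≤m+n (a + b) c) (m≤m+n (a + b + c) d))

  ≤-sum₂ : ∀ a b c d → b ≤ a + b + c + d
  ≤-sum₂ a b c d = ≤-trans (m≤n+m b a) (≤-trans (m≤m+n (a + b) c) (m≤m+n (a + b + c) d))

  ≤-sum₃ : ∀ a b c d → c ≤ a + b + c + d
  ≤-sum₃ a b c d = ≤-trans (m≤n+m c (a + b)) (m≤m+n (a + b + c) d)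

  ^-distribʳ-* : ∀ p m n → (m * n) ^ p ≡ m ^ p * n ^ p
  ^-distribʳ-* zero m n = refl
  ^-distribʳ-* (suc p) m n = trans (cong (m * n *_) (^-distribʳ-* p m n)) (*-interchange m n (m ^ p) (n ^ p))

  threshold-bound : ∀ {n m b′ Γ s Q Qᵈ} .{{_ : NonZero m}} → b′ * m ≤ 2 * n → 4 * (s * (Γ * (Q * Qᵈ))) ≤ m →
                    Γ * (Q * (2 * (s * b′) * Qᵈ)) ≤ n
  threshold-bound {n} {m} {b′} {Γ} {s} {Q} {Qᵈ} bm≤2n h = *-cancelˡ-≤ m (begin
    m * (Γ * (Q * (2 * (s * b′) * Qᵈ))) ≡⟨ lemma₁ m Γ Q s b′ Qᵈ ⟩
    2 * (s * (Γ * (Q * Qᵈ))) * (b′ * m) ≤⟨ *-monoʳ-≤ (2 * (s * (Γ * (Q * Qᵈ)))) bm≤2n ⟩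
    2 * (s * (Γ * (Q * Qᵈ))) * (2 * n) ≡⟨ lemma₂ (s * (Γ * (Q * Qᵈ))) n ⟩
    4 * (s * (Γ * (Q * Qᵈ))) * n ≤⟨ *-monoˡ-≤ n h ⟩
    m * n ∎)
    where
    lemma₁ : ∀ m Γ Q s b q → m * (Γ * (Q * (2 * (s * b) * q))) ≡ 2 * (s * (Γ * (Q * q))) * (b * m)
    lemma₁ = solve-∀
    lemma₂ : ∀ x n → 2 * x * (2 * n) ≡ 4 * x * n
    lemma₂ = solve-∀

  module _ {s′ t′ : ℕ} (Z Λ Γ k D : ℕ) .{{Γ≢0 : NonZero Γ}} .{{D≢0 : NonZero D}} .{{k≢0 : NonZero k}} .{{Z≢0 : NonZero Z}} where

    private
      s t B B′ K Q U κ θ Δ₁ Δ₂ small : ℕ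
      s = suc s′
      t = suc t′
      B′ = s′ + t
      B = suc B′
      K = 2 ^ Λ
      Q = suc (Γ * Λ)
      U = 8 * Z
      κ = U * (D * B)
      θ = U * (K * B ^ D)
      Δ₁ = Γ * (t * Q ^ t′)
      Δ₂ = Γ * (s * Q ^ s′)
      small = K + B ^ D

    -- One summand for each way the argument can end: `n` below `small`, a heavy empty list of
    -- columns, a heavy empty list of rows, or a block structure.
    copyFactor : ℕ
    copyFactor = small ^ (s + t) + K ^ s * (Δ₁ ^ t * t !) + K ^ t * (Δ₂ ^ s * s !) + 2 * (κ * θ) ^ (s + t)

    module _ (h₁ : 4 * (s * (Γ * (Q * Q ^ (s ^ s * t)))) ≤ K) (h₂ : 4 * (t * (Γ * (Q * Q ^ (t ^ t * s)))) ≤ K)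
             (h₃ : U * (K * (B′ ^ k * B)) ≤ B ^ k) (h₄ : U * (1 + D * (D * (2 * (s * t) * (κ * κ)))) * 12 ≤ Γ)
             (sk≤D : s * k ≤ D) (tk≤D : t * k ≤ D)
             {n} (A : BinaryMatrix s t) (M : BinaryMatrix n n) (L : List (Location s t n n))
             (uniq : Unique L) (allCopies : All (IsCopy A M) L) (disj : PairwiseDisjoint L)
             (n²≤ : n * n ≤ Z * length L) where

      private
        instance
          K≢0 : NonZero K
          K≢0 = m^n≢0 2 Λ

        Result : Set
        Result = n ^ (s + t) ≤ copyFactor * numberOfCopies A M

        module Large (0<n : 0 < n) (K≤n : K ≤ n) (B^D≤n : B ^ D ≤ n) where

          b′ : ℕ
          -- Just above `n / K`, so that `Λ` halvings exhaust any class, and still at most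
          -- `2 * n / K` because `K ≤ n`.
          b′ = suc (n / K)

          n<b′K : n < b′ * K
          n<b′K = ≤-trans (≤-reflexive (cong suc (m≡m%n+[m/n]*n n K))) (+-monoˡ-≤ (n / K * K) (m%n<n n K))

          b′K≤2n : b′ * K ≤ 2 * n
          b′K≤2n = ≤-trans (+-mono-≤ K≤n (m/n*n≤m n K)) (≤-reflexive (cong (n +_) (sym (+-identityʳ n))))

          fits : ∀ {s Qᵈ} .{{_ : NonZero Qᵈ}} → Γ * (Q * (2 * (s * b′) * Qᵈ)) ≤ n → s * b′ ≤ n
          fits {s} {Qᵈ} h = begin
            s * b′ ≤⟨ m≤n*m (s * b′) 2 ⟩
            2 * (s * b′) ≤⟨ m≤m*n (2 * (s * b′)) Qᵈ ⟩
            2 * (s * b′) * Qᵈ ≤⟨ m≤n*m _ Q ⟩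
            Q * (2 * (s * b′) * Qᵈ) ≤⟨ m≤n*m _ Γ ⟩
            Γ * (Q * (2 * (s * b′) * Qᵈ)) ≤⟨ h ⟩
            n ∎

          power≤K : ∀ {s Qᵈ} .{{_ : NonZero s}} → 4 * (s * (Γ * (Q * Qᵈ))) ≤ K → Qᵈ ≤ K
          power≤K {s} {Qᵈ} h = begin
            Qᵈ ≤⟨ m≤n*m Qᵈ Q ⟩
            Q * Qᵈ ≤⟨ m≤n*m _ Γ ⟩
            Γ * (Q * Qᵈ) ≤⟨ m≤n*m _ s ⟩
            s * (Γ * (Q * Qᵈ)) ≤⟨ m≤n*m _ 4 ⟩
            4 * (s * (Γ * (Q * Qᵈ))) ≤⟨ h ⟩
            K ∎

          rescale : ∀ p q {X N} → n ^ q * b′ ^ p ≤ X * N → n ^ (p + q) ≤ K ^ p * X * N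
          rescale p q {X} {N} h = begin
            n ^ (p + q) ≡⟨ ^-distribˡ-+-* n p q ⟩
            n ^ p * n ^ q ≤⟨ *-monoˡ-≤ (n ^ q) (^-monoˡ-≤ p (≤-trans (<⇒≤ n<b′K) (≤-reflexive (*-comm b′ K)))) ⟩
            (K * b′) ^ p * n ^ q ≡⟨ cong (_* n ^ q) (^-distribʳ-* p K b′) ⟩
            K ^ p * b′ ^ p * n ^ q ≡⟨ lemma (K ^ p) (b′ ^ p) (n ^ q) ⟩
            K ^ p * (n ^ q * b′ ^ p) ≤⟨ *-monoʳ-≤ (K ^ p) h ⟩
            K ^ p * (X * N) ≡⟨ *-assoc (K ^ p) X N ⟨
            K ^ p * X * N ∎
            where
            lemma : ∀ a b c → a * b * c ≡ a * (c * b)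
            lemma = solve-∀

          rows : Types (bits M) K Γ ⊎ n ^ t * b′ ^ s ≤ Δ₁ ^ t * t ! * numberOfCopies A M
          rows = typesOrCopies A M b′ Λ Γ Δ₁ (s≤s z≤n) (fits {s} {{m^n≢0 Q (s ^ s * t)}} bound) n<b′K ≤-refl bound (power≤K {s} h₁) (m^n>0 2 Λ)
            where bound = threshold-bound {b′ = b′} {Γ} {s} {Q} b′K≤2n h₁

          cols : Types (bits (transpose M)) K Γ ⊎ n ^ s * b′ ^ t ≤ Δ₂ ^ s * s ! * numberOfCopies (transpose A) (transpose M)
          cols = typesOrCopies (transpose A) (transpose M) b′ Λ Γ Δ₂ (s≤s z≤n) (fits {t} {{m^n≢0 Q (t ^ t * s)}} bound) n<b′K ≤-refl bound (power≤K {t} h₂) (m^n>0 2 Λ)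
            where bound = threshold-bound {b′ = b′} {Γ} {t} {Q} b′K≤2n h₂

          F₁ F₂ F₃ F₄ : ℕ
          F₁ = small ^ (s + t)
          F₂ = K ^ s * (Δ₁ ^ t * t !)
          F₃ = K ^ t * (Δ₂ ^ s * s !)
          F₄ = 2 * (κ * θ) ^ (s + t)

          structured : Types (bits M) K Γ → Types (bits (transpose M)) K Γ → Result
          structured rs cs =
            let h , n≤ , ≤Bn = height B D n (s≤s (≤-trans (s≤s z≤n) (m≤n+m t s′))) 0<n B^D≤n
            in ≤-trans
                 (BlocksToCopies.blocks⇒copies A M (Combine.blocks (bits M) rs cs) κ k h θ D Z
                   {{K≢0}} {{D≢0}} {{m*n≢0 U (D * B) {{m*n≢0 8 Z}} {{m*n≢0 D B}}}} {{k≢0}}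
                   n≤ ≤Bn ≤-refl h₃ ≤-refl h₄ sk≤D tk≤D 0<n L uniq allCopies disj n²≤)
                 (*-monoˡ-≤ (numberOfCopies A M) (m≤n+m F₄ (F₁ + F₂ + F₃)))

          conclude : Types (bits M) K Γ ⊎ n ^ t * b′ ^ s ≤ Δ₁ ^ t * t ! * numberOfCopies A M →
                     Types (bits (transpose M)) K Γ ⊎ n ^ s * b′ ^ t ≤ Δ₂ ^ s * s ! * numberOfCopies (transpose A) (transpose M) → Result
          conclude (inj₂ p) _ = ≤-trans (rescale s t p) (*-monoˡ-≤ (numberOfCopies A M) (≤-sum₂ F₁ F₂ F₃ F₄))
          conclude (inj₁ _) (inj₂ p) = ≤-trans (≤-reflexive (cong (n ^_) (+-comm s t)))
            (≤-trans (rescale t s (≤-trans p (*-monoʳ-≤ (Δ₂ ^ s * s !) (numberOfCopies-transpose A M))))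
                     (*-monoˡ-≤ (numberOfCopies A M) (≤-sum₃ F₁ F₂ F₃ F₄)))
          conclude (inj₁ rs) (inj₁ cs) = structured rs cs

          conclusion : Result
          conclusion = conclude rows cols

      many-copies : Result
      many-copies = go (≤-<-connex small n) (n ℕ.≟ 0)
        where
        go : small ≤ n ⊎ n < small → Dec (n ≡ 0) → Result
        go _ (yes refl) = z≤n
        go (inj₁ p) (no n≢0) = Large.conclusion (n≢0⇒n>0 n≢0) (≤-trans (m≤m+n K (B ^ D)) p) (≤-trans (m≤n+m (B ^ D) K) p)
        -- Below `small` a single copy is enough, and the hypothesis supplies one.
        go (inj₂ p) (no n≢0) = begin
          n ^ (s + t) ≤⟨ ^-monoˡ-≤ (s + t) (<⇒≤ p) ⟩
          small ^ (s + t) ≤⟨ ≤-sum₁ (small ^ (s + t)) (K ^ s * (Δ₁ ^ t * t !)) (K ^ t * (Δ₂ ^ s * s !)) (2 * (κ * θ) ^ (s + t)) ⟩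
          copyFactor ≤⟨ m≤m*n copyFactor (numberOfCopies A M) {{>-nonZero (some-copy A M Z L allCopies n²≤ (n≢0⇒n>0 n≢0))}} ⟩
          copyFactor * numberOfCopies A M ∎

  -- Inequalities between the parameters.

  -- `Q` is at most `2 ^ suc γ * Λ`, so the left side is an exponential in `γ` times a power of `Λ`.
  -- The number `a` exceeds both rates, and `C` was chosen to dominate the product.
  row-scale : ∀ a C s d γ → 1 ≤ C → s + 2 * d + 5 ≤ a → 1 ≤ γ → 2 ^ (a * γ) * (C * γ) ^ a ≤ 2 ^ (C * γ) →
              let Q = suc (2 ^ γ * (C * γ)) in 4 * (s * (2 ^ γ * (Q * Q ^ d))) ≤ 2 ^ (C * γ)
  row-scale a C s d γ 1≤C s+2d+5≤a 1≤γ dominated = begin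
    4 * (s * (2 ^ γ * Q ^ suc d))
      ≤⟨ *-monoʳ-≤ 4 (*-mono-≤ (n≤2^n s) (*-monoʳ-≤ (2 ^ γ) (^-monoˡ-≤ (suc d) Q≤))) ⟩
    4 * (2 ^ s * (2 ^ γ * (2 ^ suc γ * Λ) ^ suc d))
      ≡⟨ cong (λ z → 4 * (2 ^ s * (2 ^ γ * z))) (trans (^-distribʳ-* (suc d) (2 ^ suc γ) Λ) (cong (_* Λ ^ suc d) (^-*-assoc 2 (suc γ) (suc d)))) ⟩
    4 * (2 ^ s * (2 ^ γ * (2 ^ (suc γ * suc d) * Λ ^ suc d)))
      ≡⟨ regroup (2 ^ s) (2 ^ γ) (2 ^ (suc γ * suc d)) (Λ ^ suc d) ⟩
    2 ^ 2 * 2 ^ s * 2 ^ γ * 2 ^ (suc γ * suc d) * Λ ^ suc d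
      ≡⟨ cong (_* Λ ^ suc d) collect ⟩
    2 ^ (2 + s + γ + suc γ * suc d) * Λ ^ suc d
      ≤⟨ *-mono-≤ (^-monoʳ-≤ 2 exponent) (^-monoʳ-≤ Λ {{>-nonZero 1≤Λ}} (≤-trans (≤-trans (m≤m+n (suc d) (s + d + 4)) (≤-reflexive (lemma s d))) s+2d+5≤a)) ⟩
    2 ^ (a * γ) * Λ ^ a
      ≤⟨ dominated ⟩
    2 ^ (C * γ) ∎
    where
    Λ = C * γ
    Q = suc (2 ^ γ * Λ)
    1≤Λ : 1 ≤ Λ
    1≤Λ = *-mono-≤ 1≤C 1≤γ
    Q≤ : Q ≤ 2 ^ suc γ * Λ
    Q≤ = ≤-trans (+-monoˡ-≤ (2 ^ γ * Λ) (*-mono-≤ (m^n>0 2 γ) 1≤Λ)) (≤-reflexive (lemma₂ (2 ^ γ) Λ))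
      where lemma₂ : ∀ x y → x * y + x * y ≡ 2 * x * y
            lemma₂ = solve-∀
    lemma : ∀ s d → suc d + (s + d + 4) ≡ s + 2 * d + 5
    lemma = solve-∀
    regroup : ∀ a b c x → 4 * (a * (b * (c * x))) ≡ 4 * a * b * c * x
    regroup = solve-∀
    collect : 2 ^ 2 * 2 ^ s * 2 ^ γ * 2 ^ (suc γ * suc d) ≡ 2 ^ (2 + s + γ + suc γ * suc d)
    collect = sym (trans (^-distribˡ-+-* 2 (2 + s + γ) (suc γ * suc d)) (cong (_* 2 ^ (suc γ * suc d))
      (trans (^-distribˡ-+-* 2 (2 + s) γ) (cong (_* 2 ^ γ) (^-distribˡ-+-* 2 2 s)))))
    exponent : 2 + s + γ + suc γ * suc d ≤ a * γ
    exponent = begin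
      2 + s + γ + suc γ * suc d ≡⟨ lemma₃ s γ d ⟩
      (s + d + 3) + (d + 2) * γ ≤⟨ +-monoˡ-≤ ((d + 2) * γ) (m≤m*g (s + d + 3) 1≤γ) ⟩
      (s + d + 3) * γ + (d + 2) * γ ≡⟨ lemma₄ s γ d ⟩
      (s + 2 * d + 5) * γ ≤⟨ *-monoˡ-≤ γ s+2d+5≤a ⟩
      a * γ ∎
      where
      lemma₃ : ∀ s γ d → 2 + s + γ + suc γ * suc d ≡ (s + d + 3) + (d + 2) * γ
      lemma₃ = solve-∀
      lemma₄ : ∀ s γ d → (s + d + 3) * γ + (d + 2) * γ ≡ (s + 2 * d + 5) * γ
      lemma₄ = solve-∀

  -- `h` is the binary logarithm of `8 * 2 ^ g * 2 ^ Λ * 2 ^ B`. Since `B ^ B` is at least twice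
  -- `B′ ^ B`, every `B` factors of `B / B′` gain a factor of two, hence `k = B * h`.
  depth-scale : ∀ B′ .{{_ : NonZero B′}} g Λ → let B = suc B′; h = g + 3 + Λ + B; k = B * h in
                8 * 2 ^ g * (2 ^ Λ * (B′ ^ k * B)) ≤ B ^ k
  depth-scale B′ g Λ = begin
    8 * 2 ^ g * (2 ^ Λ * (B′ ^ k * B)) ≤⟨ *-monoʳ-≤ (8 * 2 ^ g) (*-monoʳ-≤ (2 ^ Λ) (*-monoʳ-≤ (B′ ^ k) (n≤2^n B))) ⟩
    8 * 2 ^ g * (2 ^ Λ * (B′ ^ k * 2 ^ B)) ≡⟨ regroup (2 ^ g) (2 ^ Λ) (B′ ^ k) (2 ^ B) ⟩
    2 ^ g * 2 ^ 3 * 2 ^ Λ * 2 ^ B * B′ ^ k ≡⟨ cong (_* B′ ^ k) (sym (trans (^-distribˡ-+-* 2 (g + 3 + Λ) B)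
                (cong (_* 2 ^ B) (trans (^-distribˡ-+-* 2 (g + 3) Λ) (cong (_* 2 ^ Λ) (^-distribˡ-+-* 2 g 3)))))) ⟩
    2 ^ h * B′ ^ k ≡⟨ cong (2 ^ h *_) (^-*-assoc B′ B h) ⟨
    2 ^ h * (B′ ^ B) ^ h ≡⟨ ^-distribʳ-* h 2 (B′ ^ B) ⟨
    (2 * B′ ^ B) ^ h ≤⟨ ^-monoˡ-≤ h 2B′^B≤B^B ⟩
    (B ^ B) ^ h ≡⟨ ^-*-assoc B B h ⟩
    B ^ k ∎
    where
    B = suc B′
    h = g + 3 + Λ + B
    k = B * h
    regroup : ∀ a b c d → 8 * a * (b * (c * d)) ≡ a * 8 * b * d * c
    regroup = solve-∀
    2B′^B≤B^B : 2 * B′ ^ B ≤ B ^ B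
    2B′^B≤B^B = begin
      2 * (B′ * B′ ^ B′) ≡⟨ lemma B′ (B′ ^ B′) ⟩
      B′ * (2 * B′ ^ B′) ≤⟨ *-mono-≤ (n≤1+n B′) (2n^n≤[1+n]^n B′) ⟩
      B ^ B ∎
      where lemma : ∀ a b → 2 * (a * b) ≡ a * (2 * b)
            lemma = solve-∀

  -- The left side is at most `36 * U ^ 3 * (B * D) ^ 4`, and `D` is at most `c * γ`. So it is an
  -- exponential in `g` times `γ ^ 4`, which `2 ^ γ` dominates.
  error-scale : ∀ {s t B} → s ≤ B → t ≤ B → 1 ≤ B → ∀ CΛ Cγ g → 1 ≤ g → 1 ≤ Cγ →
    let γ = Cγ * g; Λ = CΛ * γ; h = g + 3 + Λ + B; D = B * (B * h); U = 8 * 2 ^ g; κ = U * (D * B)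
        c = B * (B * (4 + CΛ + B)); a = 18 + 4 * B + 4 * c in
    2 ^ (a * g) * γ ^ a ≤ 2 ^ γ →
    U * (1 + D * (D * (2 * (s * t) * (κ * κ)))) * 12 ≤ 2 ^ γ
  error-scale {s} {t} {B} s≤B t≤B 1≤B CΛ Cγ g 1≤g 1≤Cγ dominated = begin
    U * (1 + D * (D * (2 * (s * t) * (κ * κ)))) * 12
      ≤⟨ *-monoˡ-≤ 12 (*-monoʳ-≤ U (+-mono-≤ 1≤y (*-monoʳ-≤ D (*-monoʳ-≤ D (*-monoˡ-≤ (κ * κ) (*-monoʳ-≤ 2 (*-mono-≤ s≤B t≤B))))))) ⟩
    U * (y + D * (D * (2 * (B * B) * (κ * κ)))) * 12
      ≡⟨ lemma₁ (2 ^ g) D B ⟩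
    36 * (8 * 8 * 8) * (2 ^ g * (2 ^ g * 2 ^ g)) * (B * (B * (B * B)) * (D * (D * (D * D))))
      -- `36 * 8 ^ 3` is `18432`, which `14336` completes to `2 ^ 15`.
      ≤⟨ *-mono-≤ (*-monoˡ-≤ (2 ^ g * (2 ^ g * 2 ^ g)) (m≤m+n 18432 14336)) (*-mono-≤ (fourth-power-of-2 B (n≤2^n B)) (fourth-power D≤)) ⟩
    2 ^ 15 * (2 ^ g * (2 ^ g * 2 ^ g)) * (2 ^ (4 * B) * ((c * γ) * ((c * γ) * ((c * γ) * (c * γ)))))
      ≡⟨ cong (λ z → 2 ^ 15 * (2 ^ g * (2 ^ g * 2 ^ g)) * (2 ^ (4 * B) * z)) (lemma₂ c γ) ⟩
    2 ^ 15 * (2 ^ g * (2 ^ g * 2 ^ g)) * (2 ^ (4 * B) * (c * (c * (c * c)) * γ ^ 4))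
      ≤⟨ *-monoʳ-≤ (2 ^ 15 * (2 ^ g * (2 ^ g * 2 ^ g))) (*-monoʳ-≤ (2 ^ (4 * B)) (*-monoˡ-≤ (γ ^ 4) (fourth-power-of-2 c (n≤2^n c)))) ⟩
    2 ^ 15 * (2 ^ g * (2 ^ g * 2 ^ g)) * (2 ^ (4 * B) * (2 ^ (4 * c) * γ ^ 4))
      ≡⟨ lemma₃ (2 ^ 15) (2 ^ g * (2 ^ g * 2 ^ g)) (2 ^ (4 * B)) (2 ^ (4 * c)) (γ ^ 4) ⟩
    2 ^ 15 * (2 ^ g * (2 ^ g * 2 ^ g)) * 2 ^ (4 * B) * 2 ^ (4 * c) * γ ^ 4
      ≡⟨ cong (_* γ ^ 4) collect ⟩
    2 ^ (15 + (g + (g + g)) + 4 * B + 4 * c) * γ ^ 4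
      ≤⟨ *-mono-≤ (^-monoʳ-≤ 2 exponent) (^-monoʳ-≤ γ {{>-nonZero 1≤γ}} (m≤m+n 4 (14 + 4 * B + 4 * c))) ⟩
    2 ^ (a * g) * γ ^ a
      ≤⟨ dominated ⟩
    2 ^ γ ∎
    where
    γ = Cγ * g
    Λ = CΛ * γ
    h = g + 3 + Λ + B
    D = B * (B * h)
    U = 8 * 2 ^ g
    κ = U * (D * B)
    c = B * (B * (4 + CΛ + B))
    a = 18 + 4 * B + 4 * c
    y = D * (D * ((B * B) * (κ * κ)))
    1≤γ : 1 ≤ γ
    1≤γ = *-mono-≤ 1≤Cγ 1≤g
    1≤D : 1 ≤ D
    1≤D = *-mono-≤ 1≤B (*-mono-≤ 1≤B (≤-trans 1≤g (≤-trans (m≤m+n g (3 + Λ + B)) (≤-reflexive (lemma g Λ B)))))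
      where lemma : ∀ g Λ B → g + (3 + Λ + B) ≡ g + 3 + Λ + B
            lemma = solve-∀
    1≤y : 1 ≤ y
    1≤y = *-mono-≤ 1≤D (*-mono-≤ 1≤D (*-mono-≤ (*-mono-≤ 1≤B 1≤B) (*-mono-≤ 1≤κ 1≤κ)))
      where 1≤κ : 1 ≤ κ
            1≤κ = *-mono-≤ (*-mono-≤ (m≤m+n 1 7) (m^n>0 2 g)) (*-mono-≤ 1≤D 1≤B)
    D≤ : D ≤ c * γ
    D≤ = begin
      B * (B * h) ≤⟨ *-monoʳ-≤ B (*-monoʳ-≤ B h≤) ⟩
      B * (B * ((4 + CΛ + B) * γ)) ≡⟨ lemma B (4 + CΛ + B) γ ⟩
      c * γ ∎
      where
      lemma : ∀ b x γ → b * (b * (x * γ)) ≡ b * (b * x) * γ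
      lemma = solve-∀
      lemma′ : ∀ γ x b → γ + 3 * γ + x * γ + b * γ ≡ (4 + x + b) * γ
      lemma′ = solve-∀
      h≤ : h ≤ (4 + CΛ + B) * γ
      h≤ = ≤-trans (+-mono-≤ (+-monoˡ-≤ Λ (+-mono-≤ (≤-trans (≤-reflexive (sym (*-identityˡ g))) (*-monoˡ-≤ g 1≤Cγ)) (m≤m*g 3 1≤γ))) (m≤m*g B 1≤γ))
                   (≤-reflexive (lemma′ γ CΛ B))
    fourth-power : ∀ {x m} → x ≤ m → x * (x * (x * x)) ≤ m * (m * (m * m))
    fourth-power p = *-mono-≤ p (*-mono-≤ p (*-mono-≤ p p))
    fourth-power-of-2 : ∀ m {x} → x ≤ 2 ^ m → x * (x * (x * x)) ≤ 2 ^ (4 * m)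
    fourth-power-of-2 m p = ≤-trans (fourth-power p) (≤-reflexive
      (trans (lemma (2 ^ m)) (trans (^-*-assoc 2 m 4) (cong (2 ^_) (*-comm m 4)))))
      where lemma : ∀ x → x * (x * (x * x)) ≡ x * (x * (x * (x * 1)))
            lemma = solve-∀
    lemma₁ : ∀ z D B → (8 * z) * (D * (D * ((B * B) * (8 * z * (D * B) * (8 * z * (D * B))))) + D * (D * (2 * (B * B) * (8 * z * (D * B) * (8 * z * (D * B)))))) * 12
             ≡ 36 * (8 * 8 * 8) * (z * (z * z)) * (B * (B * (B * B)) * (D * (D * (D * D))))
    lemma₁ = solve-∀
    lemma₂ : ∀ c γ → c * γ * (c * γ * (c * γ * (c * γ))) ≡ c * (c * (c * c)) * (γ * (γ * (γ * (γ * 1))))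
    lemma₂ = solve-∀
    lemma₃ : ∀ a b c d e → a * b * (c * (d * e)) ≡ a * b * c * d * e
    lemma₃ = solve-∀
    collect : 2 ^ 15 * (2 ^ g * (2 ^ g * 2 ^ g)) * 2 ^ (4 * B) * 2 ^ (4 * c) ≡ 2 ^ (15 + (g + (g + g)) + 4 * B + 4 * c)
    collect = sym (trans (^-distribˡ-+-* 2 (15 + (g + (g + g)) + 4 * B) (4 * c)) (cong (_* 2 ^ (4 * c))
      (trans (^-distribˡ-+-* 2 (15 + (g + (g + g))) (4 * B)) (cong (_* 2 ^ (4 * B))
      (trans (^-distribˡ-+-* 2 15 (g + (g + g))) (cong (2 ^ 15 *_) (trans (^-distribˡ-+-* 2 g (g + g)) (cong (2 ^ g *_) (^-distribˡ-+-* 2 g g)))))))))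
    exponent : 15 + (g + (g + g)) + 4 * B + 4 * c ≤ a * g
    exponent = ≤-trans (+-mono-≤ (+-mono-≤ (+-monoˡ-≤ (g + (g + g)) (m≤m*g 15 1≤g)) (m≤m*g (4 * B) 1≤g)) (m≤m*g (4 * c) 1≤g))
      (≤-reflexive (lemma g B c))
      where lemma : ∀ g B c → 15 * g + (g + (g + g)) + 4 * B * g + 4 * c * g ≡ (18 + 4 * B + 4 * c) * g
            lemma = solve-∀

  -- The theorem in natural numbers, with `2 ^ g` in place of the inverse of ε; a linear exponent
  -- `C * g` expresses polynomial dependence.
  Dense-in-copies : ∀ {s t} → BinaryMatrix s t → Set
  Dense-in-copies {s} {t} A = ∃[ C ] ∀ g → 1 ≤ g → ∀ n (M : BinaryMatrix n n) (L : List (Location s t n n)) →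
    Unique L → All (IsCopy A M) L → PairwiseDisjoint L → n * n ≤ 2 ^ g * length L →
    n ^ (s + t) ≤ 2 ^ (C * g) * numberOfCopies A M

  -- Λ must exceed a multiple of its own logarithm, since Q contains Λ; likewise γ,
  -- since the depth D of the tree is linear in γ and 2 ^ γ must exceed D ^ 4.
  module Parameters (s′ t′ a₁ CΛ c₄ a₂ Cγ : ℕ) (1≤CΛ : 1 ≤ CΛ) (1≤Cγ : 1 ≤ Cγ) where

    s t B′ B d₁ d₂ : ℕ
    s = suc s′
    t = suc t′
    B′ = s′ + t
    B = suc B′
    d₁ = s ^ s * t
    d₂ = t ^ t * s

    γ Λ h k D : ℕ → ℕ
    γ g = Cγ * g
    Λ g = CΛ * γ g
    h g = g + 3 + Λ g + B
    k g = B * h g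
    D g = B * k g

    factor : ℕ → ℕ
    factor g = copyFactor {s′} {t′} (2 ^ g) (Λ g) (2 ^ γ g) (k g) (D g)
      {{m^n≢0 2 (γ g)}} {{D≢0 g}} {{k≢0 g}} {{m^n≢0 2 g}}
      where
      h≢0 : ∀ g → NonZero (h g)
      h≢0 g = >-nonZero (≤-trans (s≤s z≤n) (m≤n+m B (g + 3 + Λ g)))
      k≢0 : ∀ g → NonZero (k g)
      k≢0 g = m*n≢0 B (h g) {{_}} {{h≢0 g}}
      D≢0 : ∀ g → NonZero (D g)
      D≢0 g = m*n≢0 B (k g) {{_}} {{k≢0 g}}

    -- Follows the shape of `copyFactor`: every exponent that varies is linear in `g`, and all other
    -- exponents are constants.
    factor-exp : ExpLinear factor
    factor-exp = exp-+ (exp-+ (exp-+ (exp-power (s + t) (exp-+ K (exp-^ B linD)))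
        (exp-* (exp-power s K) (exp-* (exp-power t (Δ t t′)) (exp-const (t !)))))
        (exp-* (exp-power t K) (exp-* (exp-power s (Δ s s′)) (exp-const (s !)))))
      (exp-* (exp-const 2) (exp-power (s + t) (exp-* κ (exp-* U (exp-* K (exp-^ B linD))))))
      where
      linγ : Linear γ
      linγ = lin-* Cγ lin-id
      linΛ : Linear Λ
      linΛ = lin-* CΛ linγ
      linD : Linear D
      linD = lin-* B (lin-* B (lin-+ (lin-+ (lin-+ lin-id (lin-const 3)) linΛ) (lin-const B)))
      K : ExpLinear (λ g → 2 ^ Λ g)
      K = exp-^ 2 linΛ
      U : ExpLinear (λ g → 8 * 2 ^ g)
      U = exp-* (exp-const 8) (exp-^ 2 lin-id)
      κ : ExpLinear (λ g → 8 * 2 ^ g * (D g * B))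
      κ = exp-* U (exp-* (exp-lin linD) (exp-const B))
      Δ : ∀ t t′ → ExpLinear (λ g → 2 ^ γ g * (t * suc (2 ^ γ g * Λ g) ^ t′))
      Δ t t′ = exp-* (exp-^ 2 linγ) (exp-* (exp-const t) (exp-power t′
        (exp-+ (exp-const 1) (exp-* (exp-^ 2 linγ) (exp-lin linΛ)))))

    dense-in-copies :
      (∀ γ → 1 ≤ γ → 2 ^ (a₁ * γ) * (CΛ * γ) ^ a₁ ≤ 2 ^ (CΛ * γ)) →
      (∀ g → 1 ≤ g → 2 ^ (a₂ * g) * γ g ^ a₂ ≤ 2 ^ γ g) →
      s + t + 2 * (d₁ + d₂) + 5 ≡ a₁ → B * (B * (4 + CΛ + B)) ≡ c₄ → 18 + 4 * B + 4 * c₄ ≡ a₂ →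
      (A : BinaryMatrix s t) → Dense-in-copies A
    dense-in-copies domΛ domγ refl refl refl A = proj₁ factor-exp , λ g 1≤g n M L uniq allCopies disj n²≤ →
      let 1≤γ = *-mono-≤ 1≤Cγ 1≤g
          dominated = domΛ (γ g) 1≤γ
      in ≤-trans
        (many-copies {s′} {t′} (2 ^ g) (Λ g) (2 ^ γ g) (k g) (D g)
          {{m^n≢0 2 (γ g)}} {{>-nonZero (1≤D g)}} {{>-nonZero (1≤k g)}} {{m^n≢0 2 g}}
          (row-scale a₁ CΛ s d₁ (γ g) 1≤CΛ (a₁-large s t d₁ d₂) 1≤γ dominated)
          (row-scale a₁ CΛ t d₂ (γ g) 1≤CΛ (≤-trans (a₁-large t s d₂ d₁) (≤-reflexive (a₁-comm s t d₁ d₂))) 1≤γ dominated)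
          (depth-scale B′ {{>-nonZero (≤-trans (s≤s z≤n) (m≤n+m t s′))}} g (Λ g))
          (error-scale {s} {t} {B} (s≤s (m≤m+n s′ t)) (m≤n+m t (suc s′)) (s≤s z≤n) CΛ Cγ g 1≤g 1≤Cγ (domγ g 1≤g))
          (*-monoˡ-≤ (k g) {s} {B} (s≤s (m≤m+n s′ t))) (*-monoˡ-≤ (k g) {t} {B} (m≤n+m t (suc s′)))
          A M L uniq allCopies disj n²≤)
        (*-monoˡ-≤ (numberOfCopies A M) (proj₂ factor-exp g 1≤g))
      where
      1≤h : ∀ g → 1 ≤ h g
      1≤h g = ≤-trans (s≤s z≤n) (m≤n+m B (g + 3 + Λ g))
      1≤k : ∀ g → 1 ≤ k g
      1≤k g = *-mono-≤ {1} {B} (s≤s z≤n) (1≤h g)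
      1≤D : ∀ g → 1 ≤ D g
      1≤D g = *-mono-≤ {1} {B} (s≤s z≤n) (1≤k g)
      a₁-large : ∀ s t d e → s + 2 * d + 5 ≤ s + t + 2 * (d + e) + 5
      a₁-large s t d e = +-monoˡ-≤ 5 (+-mono-≤ (m≤m+n s t) (*-monoʳ-≤ 2 (m≤m+n d e)))
      a₁-comm : ∀ s t d e → t + s + 2 * (e + d) + 5 ≡ s + t + 2 * (d + e) + 5
      a₁-comm = solve-∀

  -- Matrices without rows or columns.

  -- A copy is now just an increasing tuple of columns. Applied to `t` equal sets, `orderedChoice`
  -- yields separated parts of at least `n / t` columns, and every transversal counts; the factor
  -- `2` absorbs the rounding.
  no-rows-count : ∀ {t′ n} (A : BinaryMatrix 0 (suc t′)) (M : BinaryMatrix n n) →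
    (0 < n → 1 ≤ numberOfCopies A M) → n ^ suc t′ ≤ (2 * suc t′) ^ suc t′ * numberOfCopies A M
  no-rows-count {t′} {zero} A M positive = z≤n
  no-rows-count {t′} {n@(suc _)} A M positive = go (≤-<-connex t n)
    where
    t = suc t′
    b = n / t
    go : t ≤ n ⊎ n < t → n ^ t ≤ (2 * t) ^ t * numberOfCopies A M
    go (inj₂ n<t) = begin
      n ^ t ≤⟨ ^-monoˡ-≤ t (≤-trans (<⇒≤ n<t) (m≤n*m t 2)) ⟩
      (2 * t) ^ t ≤⟨ m≤m*n ((2 * t) ^ t) (numberOfCopies A M) {{>-nonZero (positive (s≤s z≤n))}} ⟩
      (2 * t) ^ t * numberOfCopies A M ∎
    go (inj₁ t≤n) = begin
      n ^ t ≤⟨ ∑Π-large n (2 * t) t R? (λ i → ≤-trans n≤2tb (*-monoʳ-≤ (2 * t) (large i))) ⟩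
      (2 * t) ^ t * ∑Π t R? (λ _ → 1) ≤⟨ *-monoʳ-≤ ((2 * t) ^ t) (≤-trans (∑Π≤∑ℓ t R? increasing) (∑Copies≤ A M)) ⟩
      (2 * t) ^ t * numberOfCopies A M ∎
      where
      0<b : 0 < b
      0<b = m≥n⇒m/n>0 t≤n
      n≤2tb : n ≤ 2 * t * b
      n≤2tb = begin
        n ≡⟨ m≡m%n+[m/n]*n n t ⟩
        n % t + b * t ≤⟨ +-monoˡ-≤ (b * t) (≤-trans (<⇒≤ (m%n<n n t)) (m≤n*m t b {{>-nonZero 0<b}})) ⟩
        b * t + b * t ≡⟨ lemma b t ⟩
        2 * t * b ∎
        where lemma : ∀ b t → b * t + b * t ≡ 2 * t * b
              lemma = solve-∀
      open OrderedChoice (orderedChoice t b 0 {λ _ (_ : Fin n) → ⊤} (λ _ _ → yes tt) 0<b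
        (λ j → ≤-trans (≤-reflexive (*-comm t b)) (≤-trans (m/n*n≤m n t) (≤-reflexive (sym (#-all _ (λ _ → tt , z≤n)))))))
      open ListCopies (bits M) (rowsOf A)
      increasing : ∀ γ → γ ∈Π R → 1 ≤ 𝟙 (copy? [] γ)
      increasing γ p = ≤-reflexive (sym (𝟙-yes (copy? [] γ) ([] , separated⇒increasing t (λ {i} {j} → separated {i} {j}) γ p , refl)))

  -- `CΛ` works for every `γ` and is fixed before `Cγ`. So `a₂` may depend on `CΛ`, through the
  -- depth of the tree, without circularity.
  dense-in-copies⁺ : ∀ {s′ t′} (A : BinaryMatrix (suc s′) (suc t′)) → Dense-in-copies A
  dense-in-copies⁺ {s′} {t′} A = rows (exponential-dominates a₁)
    where
    s = suc s′
    t = suc t′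
    B = s + t
    a₁ = s + t + 2 * (s ^ s * t + t ^ t * s) + 5
    rows : Dominated a₁ → Dense-in-copies A
    rows (CΛ , 1≤CΛ , domΛ) = errors (exponential-dominates a₂)
      where
      c₄ = B * (B * (4 + CΛ + B))
      a₂ = 18 + 4 * B + 4 * c₄
      errors : Dominated a₂ → Dense-in-copies A
      errors (Cγ , 1≤Cγ , domγ) = Parameters.dense-in-copies s′ t′ a₁ CΛ c₄ a₂ Cγ 1≤CΛ 1≤Cγ domΛ domγ refl refl refl A

  dense-in-copies : ∀ s t (A : BinaryMatrix s t) → Dense-in-copies A
  dense-in-copies (suc s′) (suc t′) A = dense-in-copies⁺ A
  -- The empty location is a copy, even for `n = 0`, and matches `n ^ 0 = 1`.
  dense-in-copies zero zero A = 0 , λ g _ n M L _ _ _ _ →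
    ≤-trans (copy⇒positive A M {[] , []} ((λ ()) , (λ ()) , λ ())) (≤-reflexive (sym (*-identityˡ _)))
  dense-in-copies zero (suc t′) A =
    let C , p = exp-const ((2 * suc t′) ^ suc t′) in
    C , λ g 1≤g n M L _ allCopies _ n²≤ →
      ≤-trans (no-rows-count A M (some-copy A M (2 ^ g) L allCopies n²≤)) (*-monoˡ-≤ (numberOfCopies A M) (p g 1≤g))
  dense-in-copies (suc s′) zero A =
    let C , p = exp-const ((2 * suc s′) ^ suc s′) in
    C , λ g 1≤g n M L _ allCopies _ n²≤ → ≤-trans (≤-reflexive (cong (n ^_) (+-identityʳ (suc s′))))
      (≤-trans (no-rows-count (transpose A) (transpose M)
                 (λ 0<n → ≤-trans (some-copy A M (2 ^ g) L allCopies n²≤ 0<n) (numberOfCopies-transpose (transpose A) (transpose M))))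
               (*-mono-≤ (p g 1≤g) (numberOfCopies-transpose A M)))

open import Defs
open import Data.Nat using (ℕ; zero; suc; _^_)
import Data.Nat as ℕ
import Data.Nat.Properties as ℕ
import Data.Nat.Coprimality as Coprimality
open import Data.Integer using (+_)
import Data.Integer as ℤ
import Data.Integer.Properties as ℤ
open import Data.List.Base using (length; []; _∷_)
open import Data.Product using (Σ-syntax; ∃-syntax; _×_; _,_; proj₁; proj₂)
open import Data.Rational using (ℚ; 0ℚ; _+_; _*_; _≤_; _<_)
import Data.Rational as ℚ
import Data.Rational.Properties as ℚ
import Data.Rational.Unnormalised as ℚᵘ
import Data.Rational.Unnormalised.Properties as ℚᵘ
import Data.Rational.Solver as ℚ
open import Relation.Binary.PropositionalEquality
open import Relation.Nullary using (yes; no)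
open Counting using (n≤2^n; dense-in-copies)

-- Rational bounds and the polynomial.

2ℚ : ℚ
2ℚ = fromℕ 2

toℚᵘ-fromℕ : ∀ k → ℚ.toℚᵘ (fromℕ k) ≡ ℚᵘ.mkℚᵘ (+ k) 0
toℚᵘ-fromℕ k = cong ℚ.toℚᵘ (ℚ.normalize-coprime {k} {0} (Coprimality.sym (Coprimality.1-coprimeTo k)))

fromℕ-mono : ∀ {k l} → k ℕ.≤ l → fromℕ k ≤ fromℕ l
fromℕ-mono {k} {l} k≤l = ℚ.toℚᵘ-cancel-≤ (subst₂ ℚᵘ._≤_ (sym (toℚᵘ-fromℕ k)) (sym (toℚᵘ-fromℕ l))
  (ℚᵘ.*≤* (ℤ.*-monoʳ-≤-nonNeg (+ 1) (ℤ.+≤+ k≤l))))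

fromℕ-cancel : ∀ {k l} → fromℕ k ≤ fromℕ l → k ℕ.≤ l
fromℕ-cancel {k} {l} h with subst₂ ℚᵘ._≤_ (toℚᵘ-fromℕ k) (toℚᵘ-fromℕ l) (ℚ.toℚᵘ-mono-≤ h)
... | ℚᵘ.*≤* p = ℤ.drop‿+≤+ (ℤ.*-cancelʳ-≤-pos (+ k) (+ l) (+ 1) p)

fromℕ-* : ∀ k l → fromℕ (k ℕ.* l) ≡ fromℕ k * fromℕ l
fromℕ-* k l = ℚ.toℚᵘ-injective (ℚᵘ.≃-trans (ℚᵘ.≃-reflexive (toℚᵘ-fromℕ (k ℕ.* l)))
  (ℚᵘ.≃-trans (ℚᵘ.*≡* (cong (ℤ._* + 1) (ℤ.pos-* k l)))
  (ℚᵘ.≃-trans (ℚᵘ.≃-reflexive (sym (cong₂ ℚᵘ._*_ (toℚᵘ-fromℕ k) (toℚᵘ-fromℕ l))))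
  (ℚᵘ.≃-sym (ℚ.toℚᵘ-homo-* (fromℕ k) (fromℕ l))))))

0≤fromℕ : ∀ k → 0ℚ ≤ fromℕ k
0≤fromℕ k = fromℕ-mono {0} {k} ℕ.z≤n

*-mono-nonNeg : ∀ {a b c d} → 0ℚ ≤ a → 0ℚ ≤ d → a ≤ b → c ≤ d → a * c ≤ b * d
*-mono-nonNeg {a} {b} {c} {d} 0≤a 0≤d a≤b c≤d = ℚ.≤-trans
  (ℚ.*-monoˡ-≤-nonNeg a {{ℚ.nonNegative 0≤a}} c≤d)
  (ℚ.*-monoʳ-≤-nonNeg d {{ℚ.nonNegative 0≤d}} a≤b)

-- Multiplication by `2 + 2x`: a coefficient contributes twice itself to its own degree and to the
-- next, and `c` carries the latter along.
timesLinear : ℚ → Polynomial → Polynomial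
timesLinear c [] = c ∷ []
timesLinear c (a ∷ p) = c + 2ℚ * a ∷ timesLinear (2ℚ * a) p

eval-timesLinear : ∀ c p x → eval (timesLinear c p) x ≡ c + (2ℚ + 2ℚ * x) * eval p x
eval-timesLinear c [] x = cong (λ z → c + z) (trans (ℚ.*-zeroʳ x) (sym (ℚ.*-zeroʳ (2ℚ + 2ℚ * x))))
eval-timesLinear c (a ∷ p) x = trans (cong (λ z → c + 2ℚ * a + x * z) (eval-timesLinear (2ℚ * a) p x))
  (expand 2ℚ c a x (eval p x))
  where
  expand : ∀ u c a x e → c + u * a + x * (u * a + (u + u * x) * e) ≡ c + (u + u * x) * (a + x * e)
  expand = solve 5 (λ u c a x e → c :+ u :* a :+ x :* (u :* a :+ (u :+ u :* x) :* e) := c :+ (u :+ u :* x) :* (a :+ x :* e)) refl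
    where open ℚ.+-*-Solver

-- The `k`-th power of `2 + 2x`. At `x = 1 / ε` it is at least `2 ^ (g * k)`, because `2 ^ g` can be
-- taken below `2 + 2x`.
linearPower : ℕ → Polynomial
linearPower zero = fromℕ 1 ∷ []
linearPower (suc k) = timesLinear 0ℚ (linearPower k)

power≤linearPower : ∀ {m x} → fromℕ m ≤ 2ℚ + 2ℚ * x → ∀ k → fromℕ (m ^ k) ≤ eval (linearPower k) x
power≤linearPower {m} {x} h zero = ℚ.≤-reflexive (sym (trans (cong (λ z → fromℕ 1 + z) (ℚ.*-zeroʳ x)) (ℚ.+-identityʳ (fromℕ 1))))
power≤linearPower {m} {x} h (suc k) = begin
  fromℕ (m ℕ.* m ^ k) ≡⟨ fromℕ-* m (m ^ k) ⟩
  fromℕ m * fromℕ (m ^ k) ≤⟨ *-mono-nonNeg (0≤fromℕ m) (ℚ.≤-trans (0≤fromℕ (m ^ k)) ih) h ih ⟩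
  (2ℚ + 2ℚ * x) * eval (linearPower k) x ≡⟨ ℚ.+-identityˡ _ ⟨
  0ℚ + (2ℚ + 2ℚ * x) * eval (linearPower k) x ≡⟨ eval-timesLinear 0ℚ (linearPower k) x ⟨
  eval (linearPower (suc k)) x ∎
  where
  open ℚ.≤-Reasoning
  ih = power≤linearPower {m} {x} h k

≤numerator : ∀ x → 0ℚ < x → ∃[ m ] x ≤ fromℕ m
≤numerator (ℚ.mkℚ (+ m) d c) _ = m , ℚ.toℚᵘ-cancel-≤ (subst (ℚᵘ.mkℚᵘ (+ m) d ℚᵘ.≤_) (sym (toℚᵘ-fromℕ m))
  (ℚᵘ.*≤* (ℤ.*-monoˡ-≤-nonNeg (+ m) (ℤ.+≤+ (ℕ.s≤s ℕ.z≤n)))))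
≤numerator (ℚ.mkℚ (ℤ.-[1+ m ]) d c) (ℚ.*<* ())

-- The first sufficient power of two is at most `2 * x`, unless it is `2` itself; the summand `2ℚ`
-- covers that case.
exponent : ∀ x → 0ℚ < x → ∃[ g ] 1 ℕ.≤ g × x ≤ fromℕ (2 ^ g) × fromℕ (2 ^ g) ≤ 2ℚ + 2ℚ * x
exponent x 0<x = let m , x≤m = ≤numerator x 0<x in
  descend m (ℚ.≤-trans x≤m (fromℕ-mono (ℕ.≤-trans (n≤2^n m) (ℕ.^-monoʳ-≤ 2 (ℕ.n≤1+n m)))))
  where
  0≤2x : 0ℚ ≤ 2ℚ * x
  0≤2x = *-mono-nonNeg {0ℚ} {2ℚ} {0ℚ} {x} ℚ.≤-refl (ℚ.<⇒≤ 0<x) (0≤fromℕ 2) (ℚ.<⇒≤ 0<x)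
  descend : ∀ h → x ≤ fromℕ (2 ^ suc h) → ∃[ g ] 1 ℕ.≤ g × x ≤ fromℕ (2 ^ g) × fromℕ (2 ^ g) ≤ 2ℚ + 2ℚ * x
  descend zero p = 1 , ℕ.≤-refl , p , ℚ.≤-trans (ℚ.≤-reflexive (sym (ℚ.+-identityʳ 2ℚ))) (ℚ.+-monoʳ-≤ 2ℚ 0≤2x)
  descend (suc h) p with x ℚ.≤? fromℕ (2 ^ suc h)
  ... | yes q = descend h q
  ... | no ¬q = suc (suc h) , ℕ.s≤s ℕ.z≤n , p , (begin
    fromℕ (2 ℕ.* 2 ^ suc h) ≡⟨ fromℕ-* 2 (2 ^ suc h) ⟩
    2ℚ * fromℕ (2 ^ suc h) ≤⟨ ℚ.*-monoˡ-≤-nonNeg 2ℚ (ℚ.<⇒≤ (ℚ.≰⇒> ¬q)) ⟩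
    2ℚ * x ≡⟨ ℚ.+-identityˡ (2ℚ * x) ⟨
    0ℚ + 2ℚ * x ≤⟨ ℚ.+-monoˡ-≤ (2ℚ * x) (0≤fromℕ 2) ⟩
    2ℚ + 2ℚ * x ∎)
    where open ℚ.≤-Reasoning

0<inv : ∀ q (0<q : 0ℚ < q) → 0ℚ < inv q 0<q
0<inv q 0<q = ℚ.positive⁻¹ (inv q 0<q) {{ℚ.1/pos⇒pos q {{ℚ.positive 0<q}}}}

*-inv : ∀ q (0<q : 0ℚ < q) → q * inv q 0<q ≡ ℚ.1ℚ
*-inv q 0<q = ℚ.*-inverseʳ q {{ℚ.>-nonZero 0<q}}

theorem1p2 : ∀ (s t : ℕ) (A : BinaryMatrix s t) →
    ∃[ p ] ∀ (ε : ℚ) (ε>0 : 0ℚ < ε) →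
    Σ[ p>0 ∈ 0ℚ < eval p (inv ε ε>0) ]
    (let δ = inv (eval p (inv ε ε>0)) p>0 in
    ∀ (n : ℕ) (M : BinaryMatrix n n) →
    ContainsDisjointCopies A M (ε * fromℕ (n ^ 2)) →
    δ * fromℕ (n ^ (s ℕ.+ t)) ≤ fromℕ (numberOfCopies A M))
theorem1p2 s t A = linearPower C , λ ε ε>0 →
  let x = inv ε ε>0
      g , 1≤g , x≤2^g , 2^g≤ = exponent x (0<inv ε ε>0)
      E = eval (linearPower C) x
      2^gC≤E = power≤linearPower {2 ^ g} {x} 2^g≤ C
      0<E = ℚ.<-≤-trans (ℚ.positive⁻¹ (fromℕ 1)) (ℚ.≤-trans (fromℕ-mono (ℕ.m^n>0 (2 ^ g) {{ℕ.m^n≢0 2 g}} C)) 2^gC≤E)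
  in 0<E , λ n M (L , uniq , allCopies , disj , large) →
    let open ℚ.≤-Reasoning
        -- Multiplying the hypothesis by `x = 1 / ε` and rounding `x` up to `2 ^ g` turns it into a
        -- statement about natural numbers.
        n²≤ : n ℕ.* n ℕ.≤ 2 ^ g ℕ.* length L
        n²≤ = ℕ.≤-trans (ℕ.≤-reflexive (cong (n ℕ.*_) (sym (ℕ.*-identityʳ n)))) (fromℕ-cancel (begin
          fromℕ (n ^ 2) ≡⟨ ℚ.*-identityˡ _ ⟨
          ℚ.1ℚ * fromℕ (n ^ 2) ≡⟨ cong (_* fromℕ (n ^ 2)) (trans (ℚ.*-comm x ε) (*-inv ε ε>0)) ⟨
          x * ε * fromℕ (n ^ 2) ≡⟨ ℚ.*-assoc x ε (fromℕ (n ^ 2)) ⟩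
          x * (ε * fromℕ (n ^ 2)) ≤⟨ ℚ.*-monoˡ-≤-nonNeg x {{ℚ.nonNegative (ℚ.<⇒≤ (0<inv ε ε>0))}} large ⟩
          x * fromℕ (length L) ≤⟨ ℚ.*-monoʳ-≤-nonNeg (fromℕ (length L)) {{ℚ.nonNegative (0≤fromℕ (length L))}} x≤2^g ⟩
          fromℕ (2 ^ g) * fromℕ (length L) ≡⟨ fromℕ-* (2 ^ g) (length L) ⟨
          fromℕ (2 ^ g ℕ.* length L) ∎))
        N = numberOfCopies A M
        δ = inv E 0<E
    in begin
      δ * fromℕ (n ^ (s ℕ.+ t)) ≤⟨ ℚ.*-monoˡ-≤-nonNeg δ {{ℚ.nonNegative (ℚ.<⇒≤ (0<inv E 0<E))}} (begin
        fromℕ (n ^ (s ℕ.+ t)) ≤⟨ fromℕ-mono (bound g 1≤g n M L uniq allCopies disj n²≤) ⟩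
        fromℕ (2 ^ (C ℕ.* g) ℕ.* N) ≡⟨ fromℕ-* (2 ^ (C ℕ.* g)) N ⟩
        fromℕ (2 ^ (C ℕ.* g)) * fromℕ N ≤⟨ ℚ.*-monoʳ-≤-nonNeg (fromℕ N) {{ℚ.nonNegative (0≤fromℕ N)}}
                (ℚ.≤-trans (ℚ.≤-reflexive (cong fromℕ (trans (cong (2 ^_) (ℕ.*-comm C g)) (sym (ℕ.^-*-assoc 2 g C))))) 2^gC≤E) ⟩
        E * fromℕ N ∎) ⟩
      δ * (E * fromℕ N) ≡⟨ ℚ.*-assoc δ E (fromℕ N) ⟨
      δ * E * fromℕ N ≡⟨ cong (_* fromℕ N) (trans (ℚ.*-comm δ E) (*-inv E 0<E)) ⟩
      ℚ.1ℚ * fromℕ N ≡⟨ ℚ.*-identityˡ _ ⟩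
      fromℕ N ∎
  where
  C = proj₁ (dense-in-copies s t A)
  bound = proj₂ (dense-in-copies s t A)
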